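{- Let $k,N\ge 1$ be integers and let $X_1,\dots,X_k$ be pairwise disjoint finite nonempty sets with $|X_i|=n_i$. Let $\mathrm{EC}(N)$ be the set of eventually $N$-cyclic $k$-tuples $f=(f_1,\dots,f_k)$ of functions $f_i:X_i\to X_{i+1}$ (indices modulo $k$), and let $P_N(\mathbf x)=\sum_{f\in\mathrm{EC}(N)}w(f)$. Then $$P_N(\mathbf x)=\frac{(N!)^k}{N}\prod_{i=1}^k e_1(X_i)^{n_{i-1}-(N+1)}\left(\prod_{j=1}^k e_N(X_j)e_1(X_j)-(N+1)^k\prod_{j=1}^k e_{N+1}(X_j)\right).$$
   Context: Indices are modulo $k$, so $X_{k+1}=X_1$ and $n_0=n_k$. A $k$-tuple $(f_1,\dots,f_k)$ with $f_i:X_i\to X_{i+1}$ is eventually $N$-cyclic if the iterated images $(f_k\cdots f_1)^m(X_1)$ of the composition $f_k\cdots f_1:X_1\to X_1$ eventually stabilize (for large $m$) to a subset of $X_1$ of cardinality $N$ on which $f_k\cdots f_1$ acts as an $N$-cycle (a single cyclic permutation of all $N$ elements). There is one commuting variable $x_v$ for each $v\in X=\bigsqcup_i X_i$. The weight of a $k$-tuple is $w(f)=\prod_{i=1}^k\prod_{v\in X_i}x_{f_i(v)}$. For a vertex set $U$, $e_j(U)=\sum_{S\subseteq U,\,|S|=j}\prod_{v\in S}x_v$ (so $e_j(U)=0$ if $j>|U|$). Where an exponent is negative, the identity is read in the field of rational functions in the $x_v$. -}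

module Defs where

open import Level using (0ℓ)
open import Algebra.Bundles using (CommutativeRing)
import Algebra.Properties.Group as GroupProperties
import Algebra.Properties.Ring as RingProperties
import Algebra.Properties.Semiring.Exp as Exp
import Algebra.Properties.Semiring.Mult as Mult
import Algebra.Solver.Ring.NaturalCoefficients.Default as Solver
open import Data.Bool.Base using (true)
open import Data.Empty using (⊥-elim)
open import Data.Fin.Base using (Fin; zero; suc; toℕ; _↑ˡ_; _↑ʳ_)
open import Data.Fin.Properties using (any?; all?; toℕ-injective; toℕ-fromℕ<; ∀-cons)
  renaming (_≟_ to _≟F_)
open import Data.Fin.Subset using (Subset; inside; outside; ∣_∣; _⊆_; ⊤) renaming (_∈_ to _∈ˢ_)
open import Data.Fin.Subset.Properties using (_∈?_; ⊆-antisym; ⊆-max; p⊂q⇒∣p∣<∣q∣; ∣p∣≤n)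
open import Data.Integer.Base using (ℤ; +_; -[1+_])
open import Data.List.Base using (List; []; _∷_; map; foldr; filter; allFin; cartesianProductWith)
open import Data.Nat.Base as ℕ using (ℕ; zero; suc; NonZero; _≤_; _∸_)
open import Data.Nat.DivMod using (_%_; _mod_; [m+n]%n≡m%n; %-distribˡ-+; m%n%n≡m%n; m%n<n)
open import Data.Nat.GeneralisedArithmetic using (fold)
import Data.Nat.Properties as ℕ
open import Data.Product.Base using (∃; _×_; _,_; proj₁; proj₂)
import Data.Rational.Base as ℚ
import Data.Rational.Properties as ℚ
open import Data.Sum.Base as Sum using (_⊎_; inj₁; inj₂)
open import Data.Vec.Base using ([]; _∷_; tabulate)
import Data.Vec.Functional as Vector
open import Data.Vec.Properties using (lookup∘tabulate; []=⇒lookup; lookup⇒[]=)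
open import Function.Base using (_∘_)
open import Function.Bundles using (_⇔_; mk⇔; Equivalence)
import Relation.Binary.Reasoning.Setoid as SetoidReasoning
open import Relation.Binary.PropositionalEquality as ≡ using (_≡_; refl)
open import Relation.Nullary using (¬_; Dec; yes; no; does)
open import Relation.Nullary.Decidable as Dec using (_×-dec_; _→-dec_; dec-true; map′)

record IntegralDomain : Set₁ where
  field
    commutativeRing : CommutativeRing 0ℓ 0ℓ
  open CommutativeRing commutativeRing public
  field
    _≟0           : ∀ x → Dec (x ≈ 0#)
    1≉0           : ¬ 1# ≈ 0#
    noZeroDivisor : ∀ x y → x * y ≈ 0# → x ≈ 0# ⊎ y ≈ 0#

-- The inverse is made total by 0⁻¹ = 0.  The theorem only inverts
-- e₁(Xᵢ) with Xᵢ nonempty and N ≥ 1, which are nonzero in ℚ(x).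
record Field : Set₁ where
  field
    commutativeRing : CommutativeRing 0ℓ 0ℓ
  open CommutativeRing commutativeRing public
  infix 8 _⁻¹
  field
    _⁻¹      : Carrier → Carrier
    ⁻¹-cong  : ∀ {x y} → x ≈ y → x ⁻¹ ≈ y ⁻¹
    inverseʳ : ∀ x → ¬ x ≈ 0# → x * x ⁻¹ ≈ 1#
    0⁻¹≈0    : 0# ⁻¹ ≈ 0#
    1≉0      : ¬ 1# ≈ 0#

ℚ-domain : IntegralDomain
ℚ-domain = record
  { commutativeRing = ℚ.+-*-commutativeRing
  ; _≟0             = ℚ._≟ ℚ.0ℚ
  ; 1≉0             = λ ()
  ; noZeroDivisor   = noZeroDivisor
  }
  where
  noZeroDivisor : ∀ p q → p ℚ.* q ≡ ℚ.0ℚ → p ≡ ℚ.0ℚ ⊎ q ≡ ℚ.0ℚ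
  noZeroDivisor p q pq≡0 with p ℚ.≟ ℚ.0ℚ
  ... | yes p≡0 = inj₁ p≡0
  ... | no  p≢0 = inj₂ (begin
      q                    ≡⟨ ℚ.*-identityˡ q ⟨
      ℚ.1ℚ ℚ.* q           ≡⟨ ≡.cong (ℚ._* q) (ℚ.*-inverseˡ p) ⟨
      ℚ.1/ p ℚ.* p ℚ.* q   ≡⟨ ℚ.*-assoc (ℚ.1/ p) p q ⟩
      ℚ.1/ p ℚ.* (p ℚ.* q) ≡⟨ ≡.cong (ℚ.1/ p ℚ.*_) pq≡0 ⟩
      ℚ.1/ p ℚ.* ℚ.0ℚ      ≡⟨ ℚ.*-zeroʳ (ℚ.1/ p) ⟩
      ℚ.0ℚ                 ∎)
    where
    open ≡.≡-Reasoning
    instance _ = ℚ.≢-nonZero p≢0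

module UnivariatePolynomials (D : IntegralDomain) where
  open IntegralDomain D renaming (refl to ≈-refl; sym to ≈-sym; trans to ≈-trans)
  open Solver commutativeSemiring using (solve; _:=_; _:+_; _:*_; con)
  open SetoidReasoning setoid

  -- Coefficients in order of increasing degree; trailing zeros are allowed.
  Poly : Set
  Poly = List Carrier

  coeff : Poly → ℕ → Carrier
  coeff []      i       = 0#
  coeff (a ∷ p) zero    = a
  coeff (a ∷ p) (suc i) = coeff p i

  infix 4 _≈ₚ_
  record _≈ₚ_ (p q : Poly) : Set where
    constructor ≈-coeff
    field coeff-≈ : ∀ i → coeff p i ≈ coeff q i
  open _≈ₚ_ public

  infixl 6 _+ₚ_
  infixl 7 _*ₚ_

  _+ₚ_ : Poly → Poly → Poly
  []      +ₚ q       = q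
  (a ∷ p) +ₚ []      = a ∷ p
  (a ∷ p) +ₚ (b ∷ q) = a + b ∷ p +ₚ q

  -ₚ_ : Poly → Poly
  -ₚ p = map -_ p

  _*ₚ_ : Poly → Poly → Poly
  []      *ₚ q = []
  (a ∷ p) *ₚ q = map (a *_) q +ₚ (0# ∷ p *ₚ q)

  constant : Carrier → Poly
  constant a = a ∷ []

  X : Poly
  X = 0# ∷ 1# ∷ []

  open RingProperties ring using (-0#≈0#)

  coeff-+ : ∀ p q i → coeff (p +ₚ q) i ≈ coeff p i + coeff q i
  coeff-+ []      q       i       = ≈-sym (+-identityˡ _)
  coeff-+ (a ∷ p) []      i       = ≈-sym (+-identityʳ _)
  coeff-+ (a ∷ p) (b ∷ q) zero    = ≈-refl
  coeff-+ (a ∷ p) (b ∷ q) (suc i) = coeff-+ p q i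

  coeff-neg : ∀ p i → coeff (-ₚ p) i ≈ - coeff p i
  coeff-neg []      i       = ≈-sym -0#≈0#
  coeff-neg (a ∷ p) zero    = ≈-refl
  coeff-neg (a ∷ p) (suc i) = coeff-neg p i

  coeff-scale : ∀ a p i → coeff (map (a *_) p) i ≈ a * coeff p i
  coeff-scale a []      i       = ≈-sym (zeroʳ a)
  coeff-scale a (b ∷ p) zero    = ≈-refl
  coeff-scale a (b ∷ p) (suc i) = coeff-scale a p i

  Seq : Set
  Seq = ℕ → Carrier

  conv : Seq → Seq → Seq
  conv f g zero    = f 0 * g 0
  conv f g (suc n) = f 0 * g (suc n) + conv (f ∘ suc) g n

  conv-cong : ∀ {f f′ g g′} → (∀ i → f i ≈ f′ i) → (∀ i → g i ≈ g′ i) →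
              ∀ n → conv f g n ≈ conv f′ g′ n
  conv-cong p q zero    = *-cong (p 0) (q 0)
  conv-cong p q (suc n) = +-cong (*-cong (p 0) (q (suc n))) (conv-cong (p ∘ suc) q n)

  conv-zeroˡ : ∀ g n → conv (λ _ → 0#) g n ≈ 0#
  conv-zeroˡ g zero    = zeroˡ _
  conv-zeroˡ g (suc n) = ≈-trans (+-cong (zeroˡ _) (conv-zeroˡ g n)) (+-identityˡ _)

  conv-sucʳ : ∀ f g n → conv f g (suc n) ≈ conv f (g ∘ suc) n + f (suc n) * g 0
  conv-sucʳ f g zero    = ≈-refl
  conv-sucʳ f g (suc n) = ≈-trans (+-congˡ (conv-sucʳ (f ∘ suc) g n)) (≈-sym (+-assoc _ _ _))

  conv-comm : ∀ f g n → conv f g n ≈ conv g f n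
  conv-comm f g zero    = *-comm _ _
  conv-comm f g (suc n) = begin
    f 0 * g (suc n) + conv (f ∘ suc) g n ≈⟨ +-cong (*-comm _ _) (conv-comm (f ∘ suc) g n) ⟩
    g (suc n) * f 0 + conv g (f ∘ suc) n ≈⟨ +-comm _ _ ⟩
    conv g (f ∘ suc) n + g (suc n) * f 0 ≈⟨ conv-sucʳ g f n ⟨
    conv g f (suc n)                     ∎

  conv-distribʳ : ∀ f g h n → conv (λ i → f i + g i) h n ≈ conv f h n + conv g h n
  conv-distribʳ f g h zero    = distribʳ _ _ _
  conv-distribʳ f g h (suc n) = ≈-trans (+-congˡ (conv-distribʳ (f ∘ suc) (g ∘ suc) h n))
    (solve 5 (λ a b c x y → (a :+ b) :* c :+ (x :+ y) := (a :* c :+ x) :+ (b :* c :+ y)) ≈-refl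
      (f 0) (g 0) (h (suc n)) (conv (f ∘ suc) h n) (conv (g ∘ suc) h n))

  conv-scaleˡ : ∀ a f g n → conv (λ i → a * f i) g n ≈ a * conv f g n
  conv-scaleˡ a f g zero    = *-assoc _ _ _
  conv-scaleˡ a f g (suc n) =
    ≈-trans (+-cong (*-assoc _ _ _) (conv-scaleˡ a (f ∘ suc) g n)) (≈-sym (distribˡ _ _ _))

  conv-assoc : ∀ f g h n → conv (conv f g) h n ≈ conv f (conv g h) n
  conv-assoc f g h zero    = *-assoc _ _ _
  conv-assoc f g h (suc n) = begin
    f 0 * g 0 * h (suc n) + conv (conv f g ∘ suc) h n
      ≈⟨ +-congˡ (conv-distribʳ (λ m → f 0 * g (suc m)) (conv (f ∘ suc) g) h n) ⟩
    f 0 * g 0 * h (suc n) + (conv (λ m → f 0 * g (suc m)) h n + conv (conv (f ∘ suc) g) h n)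
      ≈⟨ +-congˡ (+-cong (conv-scaleˡ (f 0) (g ∘ suc) h n) (conv-assoc (f ∘ suc) g h n)) ⟩
    f 0 * g 0 * h (suc n) + (f 0 * conv (g ∘ suc) h n + conv (f ∘ suc) (conv g h) n)
      ≈⟨ solve 5 (λ a b c x y → a :* b :* c :+ (a :* x :+ y) := a :* (b :* c :+ x) :+ y) ≈-refl
           (f 0) (g 0) (h (suc n)) (conv (g ∘ suc) h n) (conv (f ∘ suc) (conv g h) n) ⟩
    f 0 * (g 0 * h (suc n) + conv (g ∘ suc) h n) + conv (f ∘ suc) (conv g h) n ∎

  coeff-* : ∀ p q n → coeff (p *ₚ q) n ≈ conv (coeff p) (coeff q) n
  coeff-* []      q n       = ≈-sym (conv-zeroˡ (coeff q) n)
  coeff-* (a ∷ p) q zero    = ≈-trans (coeff-+ (map (a *_) q) _ 0)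
    (≈-trans (+-congʳ (coeff-scale a q 0)) (+-identityʳ _))
  coeff-* (a ∷ p) q (suc n) = ≈-trans (coeff-+ (map (a *_) q) _ (suc n))
    (+-cong (coeff-scale a q (suc n)) (coeff-* p q n))

  coeff-1* : ∀ q n → conv (coeff (constant 1#)) (coeff q) n ≈ coeff q n
  coeff-1* q zero    = *-identityˡ _
  coeff-1* q (suc n) =
    ≈-trans (+-cong (*-identityˡ _) (conv-zeroˡ (coeff q) n)) (+-identityʳ _)

  *ₚ-comm : ∀ p q → p *ₚ q ≈ₚ q *ₚ p
  *ₚ-comm p q .coeff-≈ n = begin
    coeff (p *ₚ q) n           ≈⟨ coeff-* p q n ⟩
    conv (coeff p) (coeff q) n ≈⟨ conv-comm (coeff p) (coeff q) n ⟩
    conv (coeff q) (coeff p) n ≈⟨ coeff-* q p n ⟨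
    coeff (q *ₚ p) n           ∎

  ≈ₚ-trans : ∀ {p q r} → p ≈ₚ q → q ≈ₚ r → p ≈ₚ r
  ≈ₚ-trans e e′ .coeff-≈ i = ≈-trans (coeff-≈ e i) (coeff-≈ e′ i)

  +ₚ-cong : ∀ {p p′ q q′} → p ≈ₚ p′ → q ≈ₚ q′ → p +ₚ q ≈ₚ p′ +ₚ q′
  +ₚ-cong {p} {p′} {q} {q′} e e′ .coeff-≈ i = begin
    coeff (p +ₚ q) i        ≈⟨ coeff-+ p q i ⟩
    coeff p i + coeff q i   ≈⟨ +-cong (coeff-≈ e i) (coeff-≈ e′ i) ⟩
    coeff p′ i + coeff q′ i ≈⟨ coeff-+ p′ q′ i ⟨
    coeff (p′ +ₚ q′) i      ∎

  +ₚ-comm : ∀ p q → p +ₚ q ≈ₚ q +ₚ p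
  +ₚ-comm p q .coeff-≈ i = begin
    coeff (p +ₚ q) i      ≈⟨ coeff-+ p q i ⟩
    coeff p i + coeff q i ≈⟨ +-comm _ _ ⟩
    coeff q i + coeff p i ≈⟨ coeff-+ q p i ⟨
    coeff (q +ₚ p) i      ∎

  +ₚ-assoc : ∀ p q r → (p +ₚ q) +ₚ r ≈ₚ p +ₚ (q +ₚ r)
  +ₚ-assoc p q r .coeff-≈ i = begin
    coeff ((p +ₚ q) +ₚ r) i               ≈⟨ coeff-+ (p +ₚ q) r i ⟩
    coeff (p +ₚ q) i + coeff r i          ≈⟨ +-congʳ (coeff-+ p q i) ⟩
    coeff p i + coeff q i + coeff r i     ≈⟨ +-assoc _ _ _ ⟩
    coeff p i + (coeff q i + coeff r i)   ≈⟨ +-congˡ (coeff-+ q r i) ⟨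
    coeff p i + coeff (q +ₚ r) i          ≈⟨ coeff-+ p (q +ₚ r) i ⟨
    coeff (p +ₚ (q +ₚ r)) i               ∎

  +ₚ-inverseˡ : ∀ p → (-ₚ p) +ₚ p ≈ₚ []
  +ₚ-inverseˡ p .coeff-≈ i = begin
    coeff ((-ₚ p) +ₚ p) i        ≈⟨ coeff-+ (-ₚ p) p i ⟩
    coeff (-ₚ p) i + coeff p i   ≈⟨ +-congʳ (coeff-neg p i) ⟩
    - coeff p i + coeff p i      ≈⟨ -‿inverseˡ _ ⟩
    0#                           ∎

  -ₚ-cong : ∀ {p q} → p ≈ₚ q → -ₚ p ≈ₚ -ₚ q
  -ₚ-cong {p} {q} e .coeff-≈ i = begin
    coeff (-ₚ p) i ≈⟨ coeff-neg p i ⟩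
    - coeff p i    ≈⟨ -‿cong (coeff-≈ e i) ⟩
    - coeff q i    ≈⟨ coeff-neg q i ⟨
    coeff (-ₚ q) i ∎

  *ₚ-cong : ∀ {p p′ q q′} → p ≈ₚ p′ → q ≈ₚ q′ → p *ₚ q ≈ₚ p′ *ₚ q′
  *ₚ-cong {p} {p′} {q} {q′} e e′ .coeff-≈ i = begin
    coeff (p *ₚ q) i             ≈⟨ coeff-* p q i ⟩
    conv (coeff p) (coeff q) i   ≈⟨ conv-cong (coeff-≈ e) (coeff-≈ e′) i ⟩
    conv (coeff p′) (coeff q′) i ≈⟨ coeff-* p′ q′ i ⟨
    coeff (p′ *ₚ q′) i           ∎

  *ₚ-assoc : ∀ p q r → (p *ₚ q) *ₚ r ≈ₚ p *ₚ (q *ₚ r)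
  *ₚ-assoc p q r .coeff-≈ i = begin
    coeff ((p *ₚ q) *ₚ r) i                     ≈⟨ coeff-* (p *ₚ q) r i ⟩
    conv (coeff (p *ₚ q)) (coeff r) i           ≈⟨ conv-cong (coeff-* p q) (λ _ → ≈-refl) i ⟩
    conv (conv (coeff p) (coeff q)) (coeff r) i ≈⟨ conv-assoc (coeff p) (coeff q) (coeff r) i ⟩
    conv (coeff p) (conv (coeff q) (coeff r)) i ≈⟨ conv-cong (λ _ → ≈-refl) (coeff-* q r) i ⟨
    conv (coeff p) (coeff (q *ₚ r)) i           ≈⟨ coeff-* p (q *ₚ r) i ⟨
    coeff (p *ₚ (q *ₚ r)) i                     ∎

  *ₚ-identityˡ : ∀ p → constant 1# *ₚ p ≈ₚ p
  *ₚ-identityˡ p .coeff-≈ i = ≈-trans (coeff-* (constant 1#) p i) (coeff-1* p i)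

  *ₚ-distribʳ : ∀ r p q → (p +ₚ q) *ₚ r ≈ₚ p *ₚ r +ₚ q *ₚ r
  *ₚ-distribʳ r p q .coeff-≈ i = begin
    coeff ((p +ₚ q) *ₚ r) i                     ≈⟨ coeff-* (p +ₚ q) r i ⟩
    conv (coeff (p +ₚ q)) (coeff r) i           ≈⟨ conv-cong (coeff-+ p q) (λ _ → ≈-refl) i ⟩
    conv (λ j → coeff p j + coeff q j) (coeff r) i
      ≈⟨ conv-distribʳ (coeff p) (coeff q) (coeff r) i ⟩
    conv (coeff p) (coeff r) i + conv (coeff q) (coeff r) i
      ≈⟨ +-cong (coeff-* p r i) (coeff-* q r i) ⟨
    coeff (p *ₚ r) i + coeff (q *ₚ r) i         ≈⟨ coeff-+ (p *ₚ r) (q *ₚ r) i ⟨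
    coeff (p *ₚ r +ₚ q *ₚ r) i                  ∎

  ∷-≈[] : ∀ {a p} → a ≈ 0# → p ≈ₚ [] → a ∷ p ≈ₚ []
  ∷-≈[] a≈0 p≈0 .coeff-≈ zero    = a≈0
  ∷-≈[] a≈0 p≈0 .coeff-≈ (suc i) = coeff-≈ p≈0 i

  _≟[] : ∀ p → Dec (p ≈ₚ [])
  []      ≟[] = yes (≈-coeff λ _ → ≈-refl)
  (a ∷ p) ≟[] = map′ (λ (a≈0 , p≈0) → ∷-≈[] a≈0 p≈0)
                     (λ e → coeff-≈ e 0 , ≈-coeff (coeff-≈ e ∘ suc))
                     ((a ≟0) ×-dec (p ≟[]))

  drop-headˡ : ∀ {a} p q → a ≈ 0# → (a ∷ p) *ₚ q ≈ₚ [] → p *ₚ q ≈ₚ []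
  drop-headˡ {a} p q a≈0 e .coeff-≈ i = begin
    coeff (p *ₚ q) i                             ≈⟨ coeff-* p q i ⟩
    conv (coeff p) (coeff q) i                   ≈⟨ +-identityˡ _ ⟨
    0# + conv (coeff p) (coeff q) i              ≈⟨ +-congʳ (≈-trans (*-congʳ a≈0) (zeroˡ _)) ⟨
    conv (coeff (a ∷ p)) (coeff q) (suc i)       ≈⟨ coeff-* (a ∷ p) q (suc i) ⟨
    coeff ((a ∷ p) *ₚ q) (suc i)                 ≈⟨ coeff-≈ e (suc i) ⟩
    0#                                           ∎

  drop-headʳ : ∀ {b} p q → b ≈ 0# → p *ₚ (b ∷ q) ≈ₚ [] → p *ₚ q ≈ₚ []
  drop-headʳ p q b≈0 e = ≈ₚ-trans (*ₚ-comm p q)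
    (drop-headˡ q p b≈0 (≈ₚ-trans (*ₚ-comm (_ ∷ q) p) e))

  noZeroDivisor-step : ∀ a p b q → (a ∷ p) *ₚ (b ∷ q) ≈ₚ [] →
    (a ≈ 0# → p ≈ₚ [] ⊎ b ∷ q ≈ₚ []) →
    (b ≈ 0# → a ∷ p ≈ₚ [] ⊎ q ≈ₚ []) →
    a ∷ p ≈ₚ [] ⊎ b ∷ q ≈ₚ []
  noZeroDivisor-step a p b q e ifa ifb with a ≟0 | b ≟0
  ... | yes a≈0 | _       = Sum.map₁ (∷-≈[] a≈0) (ifa a≈0)
  ... | no  _   | yes b≈0 = Sum.map₂ (∷-≈[] b≈0) (ifb b≈0)
  ... | no  a≉0 | no  b≉0
    with noZeroDivisor a b (≈-trans (≈-sym (coeff-* (a ∷ p) (b ∷ q) 0)) (coeff-≈ e 0))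
  ...   | inj₁ a≈0 = ⊥-elim (a≉0 a≈0)
  ...   | inj₂ b≈0 = ⊥-elim (b≉0 b≈0)

  noZeroDivisorₚ : ∀ p q → p *ₚ q ≈ₚ [] → p ≈ₚ [] ⊎ q ≈ₚ []
  noZeroDivisorₚ []      q       e = inj₁ (≈-coeff λ _ → ≈-refl)
  noZeroDivisorₚ (a ∷ p) []      e = inj₂ (≈-coeff λ _ → ≈-refl)
  noZeroDivisorₚ (a ∷ p) (b ∷ q) e = noZeroDivisor-step a p b q e
    (λ a≈0 → noZeroDivisorₚ p (b ∷ q) (drop-headˡ p (b ∷ q) a≈0 e))
    (λ b≈0 → noZeroDivisorₚ (a ∷ p) q (drop-headʳ (a ∷ p) q b≈0 e))

  polynomialDomain : IntegralDomain
  polynomialDomain = record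
    { commutativeRing = record
      { Carrier = Poly
      ; _≈_ = _≈ₚ_
      ; _+_ = _+ₚ_
      ; _*_ = _*ₚ_
      ; -_  = -ₚ_
      ; 0#  = []
      ; 1#  = constant 1#
      ; isCommutativeRing = record
        { isRing = record
          { +-isAbelianGroup = record
            { isGroup = record
              { isMonoid = record
                { isSemigroup = record
                  { isMagma = record
                    { isEquivalence = record
                      { refl  = ≈-coeff λ _ → ≈-refl
                      ; sym   = λ e → ≈-coeff λ i → ≈-sym (coeff-≈ e i)
                      ; trans = ≈ₚ-trans
                      }
                    ; ∙-cong = +ₚ-cong
                    }
                  ; assoc = +ₚ-assoc
                  }
                ; identity = (λ _ → ≈-coeff λ _ → ≈-refl)
                           , (λ p → +ₚ-comm p [])
                }
              ; inverse = +ₚ-inverseˡ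
                        , (λ p → ≈ₚ-trans (+ₚ-comm p (-ₚ p)) (+ₚ-inverseˡ p))
              ; ⁻¹-cong = -ₚ-cong
              }
            ; comm = +ₚ-comm
            }
          ; *-cong     = *ₚ-cong
          ; *-assoc    = *ₚ-assoc
          ; *-identity = *ₚ-identityˡ
                       , (λ p → ≈ₚ-trans (*ₚ-comm p (constant 1#)) (*ₚ-identityˡ p))
          ; distrib    = (λ r p q → ≈ₚ-trans (*ₚ-comm r (p +ₚ q))
                           (≈ₚ-trans (*ₚ-distribʳ r p q) (+ₚ-cong (*ₚ-comm p r) (*ₚ-comm q r))))
                       , *ₚ-distribʳ
          }
        ; *-comm = *ₚ-comm
        }
      }
    ; _≟0           = _≟[]
    ; 1≉0           = λ e → 1≉0 (coeff-≈ e 0)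
    ; noZeroDivisor = noZeroDivisorₚ
    }

-- ℚ[x₀, …, xₘ₋₁] as iterated univariate polynomials: the outermost
-- indeterminate is x₀.
ℚ[_] : ℕ → IntegralDomain
ℚ[ zero  ] = ℚ-domain
ℚ[ suc m ] = UnivariatePolynomials.polynomialDomain ℚ[ m ]

indeterminate : ∀ {m} → Fin m → IntegralDomain.Carrier ℚ[ m ]
indeterminate {suc m} zero    = UnivariatePolynomials.X ℚ[ m ]
indeterminate {suc m} (suc i) = UnivariatePolynomials.constant ℚ[ m ] (indeterminate i)

module Fractions (D : IntegralDomain) where
  open IntegralDomain D renaming (refl to ≈-refl; sym to ≈-sym; trans to ≈-trans)
  open Solver commutativeSemiring using (solve; _:=_; _:+_; _:*_; con)
  open SetoidReasoning setoid

  infix 5 _/_[_]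
  record Fraction : Set where
    constructor _/_[_]
    field
      num   : Carrier
      den   : Carrier
      den≉0 : ¬ den ≈ 0#
  open Fraction public

  infix 4 _≈ᶠ_
  record _≈ᶠ_ (x y : Fraction) : Set where
    constructor ≈-cross
    field cross : num x * den y ≈ num y * den x
  open _≈ᶠ_ public

  open RingProperties ring using (-‿distribˡ-*)
  open GroupProperties +-group using (x∙y⁻¹≈ε⇒x≈y)

  *≉0 : ∀ {a b} → ¬ a ≈ 0# → ¬ b ≈ 0# → ¬ a * b ≈ 0#
  *≉0 {a} {b} a≉0 b≉0 ab≈0 with noZeroDivisor a b ab≈0
  ... | inj₁ a≈0 = a≉0 a≈0
  ... | inj₂ b≈0 = b≉0 b≈0

  *-cancelʳ : ∀ {a b c} → ¬ c ≈ 0# → a * c ≈ b * c → a ≈ b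
  *-cancelʳ {a} {b} {c} c≉0 ac≈bc with noZeroDivisor (a - b) c (begin
      (a - b) * c       ≈⟨ distribʳ c a (- b) ⟩
      a * c + - b * c   ≈⟨ +-cong ac≈bc (≈-sym (-‿distribˡ-* b c)) ⟩
      b * c - b * c     ≈⟨ -‿inverseʳ _ ⟩
      0#                ∎)
  ... | inj₁ a-b≈0 = x∙y⁻¹≈ε⇒x≈y a b a-b≈0
  ... | inj₂ c≈0   = ⊥-elim (c≉0 c≈0)

  infixl 6 _+ᶠ_
  infixl 7 _*ᶠ_

  _+ᶠ_ : Fraction → Fraction → Fraction
  (a / b [ b≉0 ]) +ᶠ (c / d [ d≉0 ]) = (a * d + c * b) / (b * d) [ *≉0 b≉0 d≉0 ]

  _*ᶠ_ : Fraction → Fraction → Fraction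
  (a / b [ b≉0 ]) *ᶠ (c / d [ d≉0 ]) = (a * c) / (b * d) [ *≉0 b≉0 d≉0 ]

  -ᶠ_ : Fraction → Fraction
  -ᶠ (a / b [ b≉0 ]) = (- a) / b [ b≉0 ]

  embed : Carrier → Fraction
  embed a = a / 1# [ 1≉0 ]

  _⁻¹ᶠ : Fraction → Fraction
  (a / b [ b≉0 ]) ⁻¹ᶠ with a ≟0
  ... | yes _   = embed 0#
  ... | no  a≉0 = b / a [ a≉0 ]

  ≈ᶠ-refl : ∀ {x} → x ≈ᶠ x
  ≈ᶠ-refl .cross = ≈-refl

  ≈ᶠ-sym : ∀ {x y} → x ≈ᶠ y → y ≈ᶠ x
  ≈ᶠ-sym e .cross = ≈-sym (cross e)

  ≈ᶠ-trans : ∀ {x y z} → x ≈ᶠ y → y ≈ᶠ z → x ≈ᶠ z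
  ≈ᶠ-trans {a / b [ _ ]} {c / d [ d≉0 ]} {e / f [ _ ]} (≈-cross ad≈cb) (≈-cross cf≈ed) .cross =
    *-cancelʳ d≉0 (begin
      a * f * d   ≈⟨ solve 3 (λ a f d → a :* f :* d := a :* d :* f) ≈-refl a f d ⟩
      a * d * f   ≈⟨ *-congʳ ad≈cb ⟩
      c * b * f   ≈⟨ solve 3 (λ c b f → c :* b :* f := c :* f :* b) ≈-refl c b f ⟩
      c * f * b   ≈⟨ *-congʳ cf≈ed ⟩
      e * d * b   ≈⟨ solve 3 (λ e d b → e :* d :* b := e :* b :* d) ≈-refl e d b ⟩
      e * b * d   ∎)

  +ᶠ-cong : ∀ {x y u v} → x ≈ᶠ y → u ≈ᶠ v → x +ᶠ u ≈ᶠ y +ᶠ v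
  +ᶠ-cong {a / b [ _ ]} {a′ / b′ [ _ ]} {c / d [ _ ]} {c′ / d′ [ _ ]} (≈-cross e) (≈-cross e′) .cross = begin
    (a * d + c * b) * (b′ * d′)
      ≈⟨ solve 6 (λ a b c d b′ d′ → (a :* d :+ c :* b) :* (b′ :* d′)
                    := a :* b′ :* (d :* d′) :+ c :* d′ :* (b :* b′)) ≈-refl a b c d b′ d′ ⟩
    a * b′ * (d * d′) + c * d′ * (b * b′)
      ≈⟨ +-cong (*-congʳ e) (*-congʳ e′) ⟩
    a′ * b * (d * d′) + c′ * d * (b * b′)
      ≈⟨ solve 6 (λ a′ b′ c′ d′ b d → a′ :* b :* (d :* d′) :+ c′ :* d :* (b :* b′)
                    := (a′ :* d′ :+ c′ :* b′) :* (b :* d)) ≈-refl a′ b′ c′ d′ b d ⟩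
    (a′ * d′ + c′ * b′) * (b * d) ∎

  *ᶠ-cong : ∀ {x y u v} → x ≈ᶠ y → u ≈ᶠ v → x *ᶠ u ≈ᶠ y *ᶠ v
  *ᶠ-cong {a / b [ _ ]} {a′ / b′ [ _ ]} {c / d [ _ ]} {c′ / d′ [ _ ]} (≈-cross e) (≈-cross e′) .cross = begin
    a * c * (b′ * d′)
      ≈⟨ solve 4 (λ a c b′ d′ → a :* c :* (b′ :* d′) := a :* b′ :* (c :* d′)) ≈-refl a c b′ d′ ⟩
    a * b′ * (c * d′)  ≈⟨ *-cong e e′ ⟩
    a′ * b * (c′ * d)
      ≈⟨ solve 4 (λ a′ b c′ d → a′ :* b :* (c′ :* d) := a′ :* c′ :* (b :* d)) ≈-refl a′ b c′ d ⟩
    a′ * c′ * (b * d)  ∎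

  -ᶠ-cong : ∀ {x y} → x ≈ᶠ y → -ᶠ x ≈ᶠ -ᶠ y
  -ᶠ-cong {a / b [ _ ]} {c / d [ _ ]} (≈-cross e) .cross = begin
    - a * d   ≈⟨ -‿distribˡ-* a d ⟨
    - (a * d) ≈⟨ -‿cong e ⟩
    - (c * b) ≈⟨ -‿distribˡ-* c b ⟩
    - c * b   ∎

  +ᶠ-comm : ∀ x y → x +ᶠ y ≈ᶠ y +ᶠ x
  +ᶠ-comm (a / b [ _ ]) (c / d [ _ ]) .cross = solve 4 (λ a b c d →
    (a :* d :+ c :* b) :* (d :* b) := (c :* b :+ a :* d) :* (b :* d)) ≈-refl a b c d

  +ᶠ-assoc : ∀ x y z → (x +ᶠ y) +ᶠ z ≈ᶠ x +ᶠ (y +ᶠ z)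
  +ᶠ-assoc (a / b [ _ ]) (c / d [ _ ]) (e / f [ _ ]) .cross = solve 6 (λ a b c d e f →
    ((a :* d :+ c :* b) :* f :+ e :* (b :* d)) :* (b :* (d :* f))
      := (a :* (d :* f) :+ (c :* f :+ e :* d) :* b) :* (b :* d :* f)) ≈-refl a b c d e f

  +ᶠ-identityˡ : ∀ x → embed 0# +ᶠ x ≈ᶠ x
  +ᶠ-identityˡ (a / b [ _ ]) .cross =
    solve 2 (λ a b → (con 0 :* b :+ a :* con 1) :* b := a :* (con 1 :* b)) ≈-refl a b

  +ᶠ-inverseˡ : ∀ x → (-ᶠ x) +ᶠ x ≈ᶠ embed 0#
  +ᶠ-inverseˡ (a / b [ _ ]) .cross = begin
    (- a * b + a * b) * 1#  ≈⟨ *-identityʳ _ ⟩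
    - a * b + a * b         ≈⟨ distribʳ b (- a) a ⟨
    (- a + a) * b           ≈⟨ *-congʳ (-‿inverseˡ a) ⟩
    0# * b                  ≈⟨ zeroˡ b ⟩
    0#                      ≈⟨ zeroˡ (b * b) ⟨
    0# * (b * b)            ∎

  *ᶠ-comm : ∀ x y → x *ᶠ y ≈ᶠ y *ᶠ x
  *ᶠ-comm (a / b [ _ ]) (c / d [ _ ]) .cross = *-cong (*-comm a c) (*-comm d b)

  *ᶠ-assoc : ∀ x y z → (x *ᶠ y) *ᶠ z ≈ᶠ x *ᶠ (y *ᶠ z)
  *ᶠ-assoc (a / b [ _ ]) (c / d [ _ ]) (e / f [ _ ]) .cross =
    *-cong (*-assoc a c e) (≈-sym (*-assoc b d f))

  *ᶠ-identityˡ : ∀ x → embed 1# *ᶠ x ≈ᶠ x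
  *ᶠ-identityˡ (a / b [ _ ]) .cross =
    solve 2 (λ a b → con 1 :* a :* b := a :* (con 1 :* b)) ≈-refl a b

  *ᶠ-distribʳ : ∀ z x y → (x +ᶠ y) *ᶠ z ≈ᶠ x *ᶠ z +ᶠ y *ᶠ z
  *ᶠ-distribʳ (e / f [ _ ]) (a / b [ _ ]) (c / d [ _ ]) .cross = solve 6 (λ a b c d e f →
    (a :* d :+ c :* b) :* e :* (b :* f :* (d :* f))
      := (a :* e :* (d :* f) :+ c :* e :* (b :* f)) :* (b :* d :* f)) ≈-refl a b c d e f

  numerator≈0 : ∀ {x} → x ≈ᶠ embed 0# → num x ≈ 0#
  numerator≈0 {a / b [ _ ]} (≈-cross e) = ≈-trans (≈-sym (*-identityʳ a)) (≈-trans e (zeroˡ b))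

  ≈-numerator≈0 : ∀ {x y} → x ≈ᶠ y → num x ≈ 0# → num y ≈ 0#
  ≈-numerator≈0 {x} {y} (≈-cross e) n≈0 = *-cancelʳ (den≉0 x) (begin
    num y * den x ≈⟨ e ⟨
    num x * den y ≈⟨ *-congʳ n≈0 ⟩
    0# * den y    ≈⟨ zeroˡ _ ⟩
    0#            ≈⟨ zeroˡ _ ⟨
    0# * den x    ∎)

  ⁻¹ᶠ-cong : ∀ {x y} → x ≈ᶠ y → x ⁻¹ᶠ ≈ᶠ y ⁻¹ᶠ
  ⁻¹ᶠ-cong {a / b [ b≉0 ]} {c / d [ d≉0 ]} e with a ≟0 | c ≟0
  ... | yes _   | yes _   = ≈ᶠ-refl
  ... | yes a≈0 | no  c≉0 = ⊥-elim (c≉0 (≈-numerator≈0 e a≈0))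
  ... | no  a≉0 | yes c≈0 = ⊥-elim (a≉0 (≈-numerator≈0 (≈ᶠ-sym e) c≈0))
  ... | no  a≉0 | no  c≉0 = ≈-cross (begin
    b * c ≈⟨ *-comm b c ⟩
    c * b ≈⟨ cross e ⟨
    a * d ≈⟨ *-comm a d ⟩
    d * a ∎)

  inverseʳᶠ : ∀ x → ¬ x ≈ᶠ embed 0# → x *ᶠ x ⁻¹ᶠ ≈ᶠ embed 1#
  inverseʳᶠ (a / b [ b≉0 ]) x≉0 with a ≟0
  ... | yes a≈0 = ⊥-elim (x≉0 (≈-cross
                    (≈-trans (*-identityʳ a) (≈-trans a≈0 (≈-sym (zeroˡ b))))))
  ... | no  a≉0 = ≈-cross
    (solve 2 (λ a b → a :* b :* con 1 := con 1 :* (b :* a)) ≈-refl a b)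

  0⁻¹≈0ᶠ : embed 0# ⁻¹ᶠ ≈ᶠ embed 0#
  0⁻¹≈0ᶠ with 0# ≟0
  ... | yes _   = ≈ᶠ-refl
  ... | no  0≉0 = ⊥-elim (0≉0 ≈-refl)

  fractionField : Field
  fractionField = record
    { commutativeRing = record
      { Carrier = Fraction
      ; _≈_ = _≈ᶠ_
      ; _+_ = _+ᶠ_
      ; _*_ = _*ᶠ_
      ; -_  = -ᶠ_
      ; 0#  = embed 0#
      ; 1#  = embed 1#
      ; isCommutativeRing = record
        { isRing = record
          { +-isAbelianGroup = record
            { isGroup = record
              { isMonoid = record
                { isSemigroup = record
                  { isMagma = record
                    { isEquivalence = record
                      { refl = ≈ᶠ-refl ; sym = ≈ᶠ-sym ; trans = ≈ᶠ-trans }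
                    ; ∙-cong = +ᶠ-cong
                    }
                  ; assoc = +ᶠ-assoc
                  }
                ; identity = +ᶠ-identityˡ
                           , (λ x → ≈ᶠ-trans (+ᶠ-comm x (embed 0#)) (+ᶠ-identityˡ x))
                }
              ; inverse = +ᶠ-inverseˡ
                        , (λ x → ≈ᶠ-trans (+ᶠ-comm x (-ᶠ x)) (+ᶠ-inverseˡ x))
              ; ⁻¹-cong = -ᶠ-cong
              }
            ; comm = +ᶠ-comm
            }
          ; *-cong     = *ᶠ-cong
          ; *-assoc    = *ᶠ-assoc
          ; *-identity = *ᶠ-identityˡ
                       , (λ x → ≈ᶠ-trans (*ᶠ-comm x (embed 1#)) (*ᶠ-identityˡ x))
          ; distrib    = (λ z x y → ≈ᶠ-trans (*ᶠ-comm z (x +ᶠ y))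
                           (≈ᶠ-trans (*ᶠ-distribʳ z x y) (+ᶠ-cong (*ᶠ-comm x z) (*ᶠ-comm y z))))
                       , *ᶠ-distribʳ
          }
        ; *-comm = *ᶠ-comm
        }
      }
    ; _⁻¹      = _⁻¹ᶠ
    ; ⁻¹-cong  = ⁻¹ᶠ-cong
    ; inverseʳ = inverseʳᶠ
    ; 0⁻¹≈0    = 0⁻¹≈0ᶠ
    ; 1≉0      = λ e → 1≉0 (numerator≈0 e)
    }

ℚ⟨_⟩ : ℕ → Field
ℚ⟨ m ⟩ = Fractions.fractionField ℚ[ m ]

variable-of : ∀ {m} → Fin m → Field.Carrier ℚ⟨ m ⟩
variable-of {m} i = Fractions.embed ℚ[ m ] (indeterminate i)

image : ∀ {m} → (Fin m → Fin m) → Subset m → Subset m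
image g S = tabulate λ v → does (any? λ u → (u ∈? S) ×-dec (g u ≟F v))

iteratedImage : ∀ {m} → (Fin m → Fin m) → ℕ → Subset m
iteratedImage g t = fold ⊤ (image g) t

-- On S, g is the N-cycle (v, g v, …, gᴺ⁻¹ v).
record IsCycleOn {m} (g : Fin m → Fin m) (N : ℕ) (S : Subset m) (v : Fin m) : Set where
  field
    distinct : ∀ (i j : Fin N) → fold v g (toℕ i) ≡ fold v g (toℕ j) → i ≡ j
    support  : ∀ u → u ∈ˢ S ⇔ ∃ λ (j : Fin N) → fold v g (toℕ j) ≡ u
    closed   : fold v g N ≡ v

ActsAsCycle : ∀ {m} → (Fin m → Fin m) → ℕ → Subset m → Set
ActsAsCycle g N S = ∃ (IsCycleOn g N S)

StabilizesTo : ∀ {m} → (Fin m → Fin m) → Subset m → Set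
StabilizesTo g S = ∃ λ M → ∀ t → M ≤ t → iteratedImage g t ≡ S

EventuallyCyclicMap : ∀ {m} → ℕ → (Fin m → Fin m) → Set
EventuallyCyclicMap N g = ∃ λ S → StabilizesTo g S × ∣ S ∣ ≡ N × ActsAsCycle g N S

module _ {m} (g : Fin m → Fin m) where
  ∈-image⁺ : ∀ {S u} → u ∈ˢ S → g u ∈ˢ image g S
  ∈-image⁺ {S} {u} u∈S = lookup⇒[]= (g u) _
    (≡.trans (lookup∘tabulate _ (g u)) (dec-true (any? _) (u , u∈S , refl)))

  ∈-image⁻ : ∀ {S v} → v ∈ˢ image g S → ∃ λ u → u ∈ˢ S × g u ≡ v
  ∈-image⁻ {S} {v} v∈ = extract (any? _)
    (≡.trans (≡.sym (lookup∘tabulate _ v)) ([]=⇒lookup v∈))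
    where
    extract : ∀ {P : Set} (d : Dec P) → does d ≡ true → P
    extract (yes p) refl = p

  image-mono : ∀ {S T} → S ⊆ T → image g S ⊆ image g T
  image-mono S⊆T v∈ with ∈-image⁻ v∈
  ... | u , u∈S , refl = ∈-image⁺ (S⊆T u∈S)

  decreasing : ∀ t → iteratedImage g (suc t) ⊆ iteratedImage g t
  decreasing zero    = ⊆-max _
  decreasing (suc t) = image-mono (decreasing t)

  ⊆⇒≡⊎< : ∀ {S T : Subset m} → S ⊆ T → S ≡ T ⊎ ∣ S ∣ ℕ.< ∣ T ∣
  ⊆⇒≡⊎< {S} {T} S⊆T with any? (λ v → (v ∈? T) ×-dec Dec.¬? (v ∈? S))
  ... | yes (v , v∈T , v∉S) = inj₂ (p⊂q⇒∣p∣<∣q∣ (S⊆T , v , v∈T , v∉S))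
  ... | no  none            = inj₁ (⊆-antisym S⊆T
    λ {v} v∈T → Dec.decidable-stable (v ∈? S) λ v∉S → none (v , v∈T , v∉S))

  stabilizes-or-shrinks : ∀ t → iteratedImage g (suc t) ≡ iteratedImage g t
                              ⊎ ∣ iteratedImage g t ∣ ℕ.+ t ≤ m
  stabilizes-or-shrinks zero    = inj₂ (≡.subst (_≤ m) (≡.sym (ℕ.+-identityʳ _)) (∣p∣≤n ⊤))
  stabilizes-or-shrinks (suc t) with stabilizes-or-shrinks t | ⊆⇒≡⊎< (decreasing t)
  ... | inj₁ e | _      = inj₁ (≡.cong (image g) e)
  ... | inj₂ _ | inj₁ e = inj₁ (≡.cong (image g) e)
  ... | inj₂ b | inj₂ l = inj₂ (ℕ.≤-trans (ℕ.≤-reflexive (ℕ.+-suc _ t))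
                                 (ℕ.≤-trans (ℕ.+-monoˡ-≤ t l) b))

  fixed : iteratedImage g (suc (suc m)) ≡ iteratedImage g (suc m)
  fixed with stabilizes-or-shrinks (suc m)
  ... | inj₁ e = e
  ... | inj₂ b = ⊥-elim (ℕ.1+n≰n (ℕ.≤-trans (ℕ.m≤n+m (suc m) _) b))

  constant-after : ∀ d → iteratedImage g (d ℕ.+ suc m) ≡ iteratedImage g (suc m)
  constant-after zero    = refl
  constant-after (suc d) = ≡.trans (≡.cong (image g) (constant-after d)) fixed

  stabilizes : StabilizesTo g (iteratedImage g (suc m))
  stabilizes = suc m , λ t M≤t →
    ≡.subst (λ s → iteratedImage g s ≡ iteratedImage g (suc m)) (ℕ.m∸n+n≡m M≤t)
      (constant-after (t ∸ suc m))

  stable-unique : ∀ {S T} → StabilizesTo g S → StabilizesTo g T → S ≡ T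
  stable-unique (M , toS) (M′ , toT) =
    ≡.trans (≡.sym (toS (M ℕ.+ M′) (ℕ.m≤m+n M M′))) (toT (M ℕ.+ M′) (ℕ.m≤n+m M′ M))

  isCycleOn? : ∀ N S v → Dec (IsCycleOn g N S v)
  isCycleOn? N S v = map′
    (λ (d , s , c) → record { distinct = d ; support = λ u → mk⇔ (proj₁ (s u)) (proj₂ (s u)) ; closed = c })
    (λ r → let open IsCycleOn r in
       distinct , (λ u → Equivalence.to (support u) , Equivalence.from (support u)) , closed)
    ( all? (λ i → all? λ j → (fold v g (toℕ i) ≟F fold v g (toℕ j)) →-dec (i ≟F j))
    ×-dec all? (λ u → let orbit? = any? λ (j : Fin N) → fold v g (toℕ j) ≟F u in
                 ((u ∈? S) →-dec orbit?) ×-dec (orbit? →-dec (u ∈? S)))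
    ×-dec (fold v g N ≟F v))

  eventuallyCyclicMap? : ∀ N → Dec (EventuallyCyclicMap N g)
  eventuallyCyclicMap? N = map′
    (λ (c , a) → iteratedImage g (suc m) , stabilizes , c , a)
    (λ (S , st , c , a) → ≡.subst (λ T → ∣ T ∣ ≡ N × ActsAsCycle g N T) (stable-unique st stabilizes) (c , a))
    ((∣ iteratedImage g (suc m) ∣ ℕ.≟ N) ×-dec any? (isCycleOn? N (iteratedImage g (suc m))))

-- The cyclic indices 1, …, k are represented by 0, …, k - 1.
module _ {k : ℕ} .{{_ : NonZero k}} where
  first : Fin k
  first = 0 mod k

  next : Fin k → Fin k
  next i = suc (toℕ i) mod k

  prev : Fin k → Fin k
  prev i = (toℕ i ℕ.+ (k ∸ 1)) mod k

  toℕ-next^ : ∀ t → toℕ (fold first next t) ≡ t % k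
  toℕ-next^ zero    = toℕ-fromℕ< (m%n<n 0 k)
  toℕ-next^ (suc t) = begin
    toℕ (next (fold first next t))    ≡⟨ toℕ-fromℕ< (m%n<n (suc (toℕ (fold first next t))) k) ⟩
    suc (toℕ (fold first next t)) % k ≡⟨ ≡.cong (λ s → suc s % k) (toℕ-next^ t) ⟩
    suc (t % k) % k                   ≡⟨ %-distribˡ-+ 1 (t % k) k ⟩
    (1 % k ℕ.+ t % k % k) % k         ≡⟨ ≡.cong (λ s → (1 % k ℕ.+ s) % k) (m%n%n≡m%n t k) ⟩
    (1 % k ℕ.+ t % k) % k             ≡⟨ %-distribˡ-+ 1 t k ⟨
    suc t % k                         ∎
    where open ≡.≡-Reasoning

  next^k-first : fold first next k ≡ first
  next^k-first = toℕ-injective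
    (≡.trans (toℕ-next^ k) (≡.trans ([m+n]%n≡m%n 0 k) (≡.sym (toℕ-next^ 0))))

  -- Xᵢ is Fin (n i); the sets are disjoint because a vertex is a pair (i , v).
  Tuple : (Fin k → ℕ) → Set
  Tuple n = ∀ i → Fin (n i) → Fin (n (next i))

  module _ {n : Fin k → ℕ} (f : Tuple n) where
    walk : ∀ t → Fin (n first) → Fin (n (fold first next t))
    walk zero    v = v
    walk (suc t) v = f (fold first next t) (walk t v)

    composite : Fin (n first) → Fin (n first)
    composite v = ≡.subst (Fin ∘ n) next^k-first (walk k v)

  EventuallyCyclic : ∀ {n} → ℕ → Tuple n → Set
  EventuallyCyclic N f = EventuallyCyclicMap N (composite f)

  eventuallyCyclic? : ∀ {n} N (f : Tuple n) → Dec (EventuallyCyclic N f)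
  eventuallyCyclic? N f = eventuallyCyclicMap? (composite f) N

-- All dependent functions f with f i in the list bs i.
choices : ∀ {m} {B : Fin m → Set} → (∀ i → List (B i)) → List (∀ i → B i)
choices {zero}  bs = (λ ()) ∷ []
choices {suc m} bs = cartesianProductWith ∀-cons (bs zero) (choices (bs ∘ suc))

allTuples : ∀ {k} .{{_ : NonZero k}} (n : Fin k → ℕ) → List (Tuple n)
allTuples n = choices λ i → choices λ _ → allFin (n (next i))

EC : ∀ {k} .{{_ : NonZero k}} (n : Fin k → ℕ) → ℕ → List (Tuple n)
EC n N = filter (eventuallyCyclic? N) (allTuples n)

allSubsets : ∀ m → List (Subset m)
allSubsets zero    = [] ∷ []
allSubsets (suc m) = cartesianProductWith _∷_ (outside ∷ inside ∷ []) (allSubsets m)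

subsetsOfSize : ∀ m → ℕ → List (Subset m)
subsetsOfSize m j = filter (λ S → ∣ S ∣ ℕ.≟ j) (allSubsets m)

elements : ∀ {m} → Subset m → List (Fin m)
elements {m} S = filter (_∈? S) (allFin m)

total : ∀ {k} → (Fin k → ℕ) → ℕ
total n = Vector.foldr ℕ._+_ 0 n

-- Bijection ⨆ᵢ Fin (n i) → Fin (total n), listing the blocks in order.
position : ∀ {k} (n : Fin k → ℕ) (i : Fin k) → Fin (n i) → Fin (total n)
position {suc k} n zero    v = v ↑ˡ total (n ∘ suc)
position {suc k} n (suc i) v = n zero ↑ʳ position (n ∘ suc) i v

vertexVariable : ∀ {k} (n : Fin k → ℕ) (i : Fin k) → Fin (n i) → Field.Carrier ℚ⟨ total n ⟩
vertexVariable n i v = variable-of (position n i v)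

module Expressions (K : Field) where
  open Field K
  open Exp semiring public using (_^_)
  open Mult semiring using () renaming (_×_ to _×′_)

  infixr 8 _^ℤ_
  infix  5 sumOver prodOver

  fromℕ : ℕ → Carrier
  fromℕ m = m ×′ 1#

  _^ℤ_ : Carrier → ℤ → Carrier
  x ^ℤ (+ m)    = x ^ m
  x ^ℤ -[1+ m ] = (x ⁻¹) ^ suc m

  sumOver : {A : Set} → List A → (A → Carrier) → Carrier
  sumOver as t = foldr (λ a s → t a + s) 0# as

  prodOver : {A : Set} → List A → (A → Carrier) → Carrier
  prodOver as t = foldr (λ a s → t a * s) 1# as

  syntax sumOver as (λ a → t)  = Σ[ a ← as ] t
  syntax prodOver as (λ a → t) = Π[ a ← as ] t

  e : ℕ → ∀ {m} → (Fin m → Carrier) → Carrier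
  e j {m} x = Σ[ S ← subsetsOfSize m j ] Π[ v ← elements S ] x v

  weight : ∀ {k} .{{_ : NonZero k}} {n : Fin k → ℕ} →
           (∀ i → Fin (n i) → Carrier) → Tuple n → Carrier
  weight {k} {n} x f = Π[ i ← allFin k ] Π[ v ← allFin (n i) ] x (next i) (f i v)

{-# OPTIONS --safe #-}

-- Normalise the variables to pᵢ = xᵢ / e₁(Xᵢ), so that the weights turn the
-- maps fᵢ into families of independent random values, and let d_N(q) = N! e_N(q)
-- be the probability that N independent samples of law q are distinct.
--
-- One random self-map G of law q.  Fix a cyclic word of N distinct vertices.
-- Given that G follows it, all other vertices flow into it with probability the
-- mass of the word: reveal the value of one vertex, contract that edge, induct.
-- Summing over words, N · P(G is eventually N-cyclic) = d_N(q) − d_{N+1}(q).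
--
-- Given f₂, …, f_k, the composite is again such a random self-map, whose law is
-- the push-forward of p₂ under f_k ⋯ f₂.  Since the mean of d_N(f₊p) over a random
-- map f of law q is d_N(p) d_N(q), averaging over f₂, …, f_k gives
-- N · P = ∏ d_N(pᵢ) − ∏ d_{N+1}(pᵢ), which rescales to the formula.

module Submission where

open import Defs
open import Data.Bool.Base using (Bool; true; false; if_then_else_; _∨_; not)
open import Data.Bool.Properties using (∨-zeroʳ; not-¬) renaming (_≟_ to _≟B_)
open import Data.Empty using (⊥-elim)
open import Data.Fin.Base using (Fin; zero; suc; toℕ; fromℕ<)
open import Data.Fin.Permutation using (permutation)
open import Data.Fin.Properties
  using (∀-cons; toℕ<n; toℕ-fromℕ<; toℕ-injective; suc-injective; 0≢1+n) renaming (_≟_ to _≟F_)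
open import Data.Fin.Subset using (Subset; inside; outside; ∣_∣; _∈_; _∉_) renaming (_-_ to _∖_)
open import Data.Fin.Subset.Properties
  using (_∈?_; ∈⊤; Empty-unique; ∣⊥∣≡0; p─⊥≡p; p─q⊆p; x∈p∧x≢y⇒x∈p-y)
open import Data.Integer.Base as ℤ using (+_)
import Data.Integer.Properties as ℤ
open import Data.List.Base
  using (List; []; _∷_; _++_; foldr; map; filter; length; allFin; tabulate; cartesianProductWith)
open import Data.Nat.Base as ℕ using (ℕ; zero; suc; NonZero; _!; _≤_; _∸_)
open import Data.Nat.DivMod
  using (_%_; [m+n]%n≡m%n; %-distribˡ-+; m%n%n≡m%n; m%n<n; m<n⇒m%n≡m)
open import Data.Nat.GeneralisedArithmetic using (fold; fold-+)
import Data.Nat.Properties as ℕ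
open import Data.Product.Base using (∃; _×_; _,_; proj₁; proj₂)
import Data.Rational.Base as ℚ
import Data.Rational.Properties as ℚ
open import Data.Sum.Base using (_⊎_; inj₁; inj₂)
open import Data.Vec.Base using ([]; _∷_; here; there)
open import Function.Base using (_∘_)
open import Function.Bundles using (_⇔_; mk⇔; Equivalence)
import Algebra.Properties.CommutativeMonoid.Sum as Sum
import Algebra.Properties.CommutativeSemigroup as CommutativeSemigroupProperties
import Algebra.Properties.CommutativeSemiring.Exp as CommutativeExp
import Algebra.Properties.Group as GroupProperties
import Algebra.Properties.Ring as RingProperties
import Algebra.Properties.Semiring.Exp as Exp
import Algebra.Properties.Semiring.Mult as Mult
import Algebra.Solver.Ring.NaturalCoefficients.Default as Solver
import Relation.Binary.Reasoning.Setoid as SetoidReasoning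
open import Relation.Binary.PropositionalEquality as ≡ using (_≡_; _≗_)
open import Relation.Nullary using (¬_; Dec; yes; no; does)
open import Relation.Nullary.Decidable as Dec using (_×-dec_; ¬?; dec-true; dec-false)
open import Relation.Unary using (Decidable)

-- The difference d_N - d_{N+1} arises as follows. A word w of N distinct letters closes up and
-- attracts everything with probability q(w₁)⋯q(w_N) · mass(w), and mass(w) is 1 minus the mass of
-- the letters outside w. Summed over all words, the 1 gives d_N, and the letter outside w prolongs
-- the word and gives d_{N+1}. The factor N counts the possible first letters of one cycle. The main
-- obstacle is conditioning on a few values of a random map. Coordinates are never removed. One
-- coordinate is redrawn, and the rest of the event is shown not to read its old value; each event
-- is therefore stated relative to a set b of vertices whose values are already spent. Two
-- inductions need a wider statement: contracting an edge shrinks the vertex set but not the sample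
-- space, hence the relabelling ρ; the mean of d_N(f₊p) needs a weight r that excludes image letters
-- already used. The exponents come from degrees: in the variables of Xᵢ a weight has degree
-- n_{i-1}, and the bracket of the formula has degree N + 1.

-- Finite sums, products and Iverson brackets.

module FiniteSums (K : Field) where
  open Field K hiding (zero)
  open Expressions K
  open Solver commutativeSemiring using (solve; _:=_; _:+_; _:*_; con)
  open SetoidReasoning setoid

  private variable
    A B C : Set

  Σ-cong : (as : List A) {s t : A → Carrier} → (∀ a → s a ≈ t a) →
           sumOver as s ≈ sumOver as t
  Σ-cong []       s≈t = refl
  Σ-cong (a ∷ as) s≈t = +-cong (s≈t a) (Σ-cong as s≈t)

  Σ-zero : (as : List A) → (Σ[ a ← as ] 0#) ≈ 0#
  Σ-zero []       = refl
  Σ-zero (a ∷ as) = trans (+-identityˡ _) (Σ-zero as)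

  Σ-+ : (as : List A) (s t : A → Carrier) →
        (Σ[ a ← as ] s a + t a) ≈ sumOver as s + sumOver as t
  Σ-+ []       s t = sym (+-identityˡ 0#)
  Σ-+ (a ∷ as) s t = trans (+-congˡ (Σ-+ as s t))
    (solve 4 (λ a b c d → a :+ b :+ (c :+ d) := a :+ c :+ (b :+ d)) refl _ _ _ _)

  Σ-*ˡ : (as : List A) (c : Carrier) (t : A → Carrier) →
         (Σ[ a ← as ] c * t a) ≈ c * sumOver as t
  Σ-*ˡ []       c t = sym (zeroʳ c)
  Σ-*ˡ (a ∷ as) c t = trans (+-congˡ (Σ-*ˡ as c t)) (sym (distribˡ _ _ _))

  Σ-*ʳ : (as : List A) (c : Carrier) (t : A → Carrier) →
         (Σ[ a ← as ] t a * c) ≈ sumOver as t * c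
  Σ-*ʳ as c t = trans (Σ-cong as λ a → *-comm _ _) (trans (Σ-*ˡ as c t) (*-comm _ _))

  Σ-swap : (as : List A) (bs : List B) (t : A → B → Carrier) →
           (Σ[ a ← as ] Σ[ b ← bs ] t a b) ≈ (Σ[ b ← bs ] Σ[ a ← as ] t a b)
  Σ-swap []       bs t = sym (Σ-zero bs)
  Σ-swap (a ∷ as) bs t = trans (+-congˡ (Σ-swap as bs t)) (sym (Σ-+ bs _ _))

  Σ-++ : (as bs : List A) (t : A → Carrier) →
         sumOver (as ++ bs) t ≈ sumOver as t + sumOver bs t
  Σ-++ []       bs t = sym (+-identityˡ _)
  Σ-++ (a ∷ as) bs t = trans (+-congˡ (Σ-++ as bs t)) (sym (+-assoc _ _ _))

  Σ-map : (g : A → B) (as : List A) (t : B → Carrier) →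
          sumOver (map g as) t ≈ (Σ[ a ← as ] t (g a))
  Σ-map g []       t = refl
  Σ-map g (a ∷ as) t = +-congˡ (Σ-map g as t)

  Σ-cartesianProductWith : (g : A → B → C) (as : List A) (bs : List B) (t : C → Carrier) →
    sumOver (cartesianProductWith g as bs) t ≈ (Σ[ a ← as ] Σ[ b ← bs ] t (g a b))
  Σ-cartesianProductWith g []       bs t = refl
  Σ-cartesianProductWith g (a ∷ as) bs t = trans (Σ-++ (map (g a) bs) _ t)
    (+-cong (Σ-map (g a) bs t) (Σ-cartesianProductWith g as bs t))

  Σ-tabulate : ∀ {n} (g : Fin n → A) (t : A → Carrier) →
               sumOver (tabulate g) t ≈ (Σ[ i ← allFin n ] t (g i))
  Σ-tabulate {n = zero}  g t = refl
  Σ-tabulate {n = suc n} g t = +-congˡ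
    (trans (Σ-tabulate (g ∘ suc) t) (sym (Σ-tabulate suc (t ∘ g))))

  Σ-suc : ∀ n (t : Fin (suc n) → Carrier) →
          sumOver (allFin (suc n)) t ≈ t zero + (Σ[ i ← allFin n ] t (suc i))
  Σ-suc n t = +-congˡ (Σ-tabulate suc t)

  Π-cong : (as : List A) {s t : A → Carrier} → (∀ a → s a ≈ t a) →
           prodOver as s ≈ prodOver as t
  Π-cong []       s≈t = refl
  Π-cong (a ∷ as) s≈t = *-cong (s≈t a) (Π-cong as s≈t)

  Π-* : (as : List A) (s t : A → Carrier) →
        (Π[ a ← as ] s a * t a) ≈ prodOver as s * prodOver as t
  Π-* []       s t = sym (*-identityˡ 1#)
  Π-* (a ∷ as) s t = trans (*-congˡ (Π-* as s t))
    (solve 4 (λ a b c d → a :* b :* (c :* d) := a :* c :* (b :* d)) refl _ _ _ _)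

  Π-tabulate : ∀ {n} (g : Fin n → A) (t : A → Carrier) →
               prodOver (tabulate g) t ≈ (Π[ i ← allFin n ] t (g i))
  Π-tabulate {n = zero}  g t = refl
  Π-tabulate {n = suc n} g t = *-congˡ
    (trans (Π-tabulate (g ∘ suc) t) (sym (Π-tabulate suc (t ∘ g))))

  Π-suc : ∀ n (t : Fin (suc n) → Carrier) →
          prodOver (allFin (suc n)) t ≈ t zero * (Π[ i ← allFin n ] t (suc i))
  Π-suc n t = *-congˡ (Π-tabulate suc t)

  Π-const : ∀ n (c : Carrier) → (Π[ i ← allFin n ] c) ≈ c ^ n
  Π-const zero    c = refl
  Π-const (suc n) c = trans (Π-suc n λ _ → c) (*-congˡ (Π-const n c))

  𝟙 : Bool → Carrier
  𝟙 b = if b then 1# else 0#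

  -- The Iverson bracket. It reads only the Boolean of the decision, so it reduces whenever the
  -- decision procedure does.
  ⟦_⟧ : {P : Set} → Dec P → Carrier
  ⟦ p? ⟧ = 𝟙 (does p?)

  ⟦⟧-true : {P : Set} (p? : Dec P) → P → ⟦ p? ⟧ ≈ 1#
  ⟦⟧-true p? p = reflexive (≡.cong 𝟙 (dec-true p? p))

  ⟦⟧-false : {P : Set} (p? : Dec P) → ¬ P → ⟦ p? ⟧ ≈ 0#
  ⟦⟧-false p? ¬p = reflexive (≡.cong 𝟙 (dec-false p? ¬p))

  ⟦⟧-cong : {P Q : Set} (p? : Dec P) (q? : Dec Q) → (P → Q) → (Q → P) → ⟦ p? ⟧ ≈ ⟦ q? ⟧
  ⟦⟧-cong p? (yes q) _ q⇒p = ⟦⟧-true p? (q⇒p q)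
  ⟦⟧-cong p? (no ¬q) p⇒q _ = ⟦⟧-false p? (¬q ∘ p⇒q)

  ⟦⟧-× : {P Q : Set} (p? : Dec P) (q? : Dec Q) → ⟦ p? ×-dec q? ⟧ ≈ ⟦ p? ⟧ * ⟦ q? ⟧
  ⟦⟧-× (yes _) q? = sym (*-identityˡ _)
  ⟦⟧-× (no _)  q? = sym (zeroˡ _)

  Σ-filter : {P : A → Set} (P? : Decidable P) (as : List A) (t : A → Carrier) →
             sumOver (filter P? as) t ≈ (Σ[ a ← as ] t a * ⟦ P? a ⟧)
  Σ-filter P? []       t = refl
  Σ-filter P? (a ∷ as) t with P? a
  ... | yes _ = +-cong (sym (*-identityʳ _)) (Σ-filter P? as t)
  ... | no  _ = trans (Σ-filter P? as t) (sym (trans (+-congʳ (zeroʳ _)) (+-identityˡ _)))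

  Π-filter : {P : A → Set} (P? : Decidable P) (as : List A) (t : A → Carrier) →
             prodOver (filter P? as) t ≈ (Π[ a ← as ] (if does (P? a) then t a else 1#))
  Π-filter P? []       t = refl
  Π-filter P? (a ∷ as) t with P? a
  ... | yes _ = *-congˡ (Π-filter P? as t)
  ... | no  _ = trans (Π-filter P? as t) (sym (*-identityˡ _))

  Σ-δ : ∀ {n} (i : Fin n) (t : Fin n → Carrier) → (Σ[ j ← allFin n ] t j * ⟦ i ≟F j ⟧) ≈ t i
  Σ-δ {suc n} zero t = begin
    (Σ[ j ← allFin (suc n) ] t j * ⟦ zero ≟F j ⟧) ≈⟨ Σ-suc n _ ⟩
    t zero * 1# + (Σ[ j ← allFin n ] t (suc j) * 0#)
      ≈⟨ +-cong (*-identityʳ _) (trans (Σ-cong (allFin n) λ j → zeroʳ _) (Σ-zero (allFin n))) ⟩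
    t zero + 0# ≈⟨ +-identityʳ _ ⟩
    t zero ∎
  Σ-δ {suc n} (suc i) t = begin
    (Σ[ j ← allFin (suc n) ] t j * ⟦ suc i ≟F j ⟧) ≈⟨ Σ-suc n _ ⟩
    t zero * 0# + (Σ[ j ← allFin n ] t (suc j) * ⟦ i ≟F j ⟧)
      ≈⟨ +-cong (zeroʳ _) (Σ-δ i (t ∘ suc)) ⟩
    0# + t (suc i) ≈⟨ +-identityˡ _ ⟩
    t (suc i) ∎

-- Elementary symmetric functions and words of distinct letters.

module SymmetricFunctions (K : Field) where
  open Field K hiding (zero)
  open Expressions K
  open FiniteSums K
  open Mult semiring using (×1-homo-*)
  open Solver commutativeSemiring using (solve; _:=_; _:+_; _:*_; con)
  open SetoidReasoning setoid

  -- The padding by 1 makes the product run over all of `Fin m` instead of `elements S`, so that it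
  -- splits at the first vertex.
  monomial : ∀ {m} → (Fin m → Carrier) → Subset m → Carrier
  monomial {m} x S = Π[ v ← allFin m ] (if does (v ∈? S) then x v else 1#)

  e-monomials : ∀ j {m} (x : Fin m → Carrier) →
                e j x ≈ (Σ[ S ← allSubsets m ] monomial x S * ⟦ ∣ S ∣ ℕ.≟ j ⟧)
  e-monomials j {m} x = trans (Σ-filter (λ S → ∣ S ∣ ℕ.≟ j) (allSubsets m) _)
    (Σ-cong (allSubsets m) λ S → *-congʳ (Π-filter (_∈? S) (allFin m) x))

  monomial-outside : ∀ {m} (x : Fin (suc m) → Carrier) S →
                     monomial x (outside ∷ S) ≈ monomial (x ∘ suc) S
  monomial-outside {m} x S = trans (Π-suc m (λ v → if does (v ∈? (outside ∷ S)) then x v else 1#)) (*-identityˡ _)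

  monomial-inside : ∀ {m} (x : Fin (suc m) → Carrier) S →
                    monomial x (inside ∷ S) ≈ x zero * monomial (x ∘ suc) S
  monomial-inside {m} x S = Π-suc m (λ v → if does (v ∈? (inside ∷ S)) then x v else 1#)

  e-split : ∀ j {m} (x : Fin (suc m) → Carrier) →
    e j x ≈ (Σ[ S ← allSubsets m ] monomial (x ∘ suc) S * ⟦ ∣ S ∣ ℕ.≟ j ⟧)
          + (Σ[ S ← allSubsets m ] x zero * (monomial (x ∘ suc) S * ⟦ suc ∣ S ∣ ℕ.≟ j ⟧))
  e-split j {m} x = trans (e-monomials j x) (trans
    (Σ-cartesianProductWith _∷_ (outside ∷ inside ∷ []) (allSubsets m) _)
    (+-cong
      (Σ-cong (allSubsets m) λ S → *-congʳ (monomial-outside x S))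
      (trans (+-identityʳ _) (Σ-cong (allSubsets m) λ S →
        trans (*-congʳ (monomial-inside x S)) (*-assoc _ _ _)))))

  e-suc-suc : ∀ j {m} (x : Fin (suc m) → Carrier) →
              e (suc j) x ≈ e (suc j) (x ∘ suc) + x zero * e j (x ∘ suc)
  e-suc-suc j {m} x = trans (e-split (suc j) x) (+-cong (sym (e-monomials (suc j) (x ∘ suc)))
    (trans (Σ-*ˡ (allSubsets m) (x zero) _) (*-congˡ (trans
      (Σ-cong (allSubsets m) λ S → *-congˡ
        (⟦⟧-cong (suc ∣ S ∣ ℕ.≟ suc j) (∣ S ∣ ℕ.≟ j) ℕ.suc-injective (≡.cong suc)))
      (sym (e-monomials j (x ∘ suc)))))))

  e-0 : ∀ {m} (x : Fin m → Carrier) → e 0 x ≈ 1#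
  e-0 {zero}  x = +-identityʳ 1#
  e-0 {suc m} x = begin
    e 0 x ≈⟨ e-split 0 x ⟩
    (Σ[ S ← allSubsets m ] monomial (x ∘ suc) S * ⟦ ∣ S ∣ ℕ.≟ 0 ⟧)
      + (Σ[ S ← allSubsets m ] x zero * (monomial (x ∘ suc) S * 0#))
        ≈⟨ +-cong (sym (e-monomials 0 (x ∘ suc)))
             (trans (Σ-cong (allSubsets m) λ S → trans (*-congˡ (zeroʳ _)) (zeroʳ _))
                    (Σ-zero (allSubsets m))) ⟩
    e 0 (x ∘ suc) + 0# ≈⟨ +-identityʳ _ ⟩
    e 0 (x ∘ suc)      ≈⟨ e-0 (x ∘ suc) ⟩
    1#                 ∎

  e-cong : ∀ j {m} {x y : Fin m → Carrier} → (∀ v → x v ≈ y v) → e j x ≈ e j y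
  e-cong j {m} x≈y = Σ-cong (subsetsOfSize m j) λ S → Π-cong (elements S) x≈y

  e-1 : ∀ {m} (x : Fin m → Carrier) → e 1 x ≈ sumOver (allFin m) x
  e-1 {zero}  x = refl
  e-1 {suc m} x = begin
    e 1 x                                          ≈⟨ e-suc-suc 0 x ⟩
    e 1 (x ∘ suc) + x zero * e 0 (x ∘ suc)
      ≈⟨ +-cong (e-1 (x ∘ suc)) (trans (*-congˡ (e-0 (x ∘ suc))) (*-identityʳ _)) ⟩
    sumOver (allFin m) (x ∘ suc) + x zero          ≈⟨ +-comm _ _ ⟩
    x zero + sumOver (allFin m) (x ∘ suc)          ≈⟨ Σ-suc m x ⟨
    sumOver (allFin (suc m)) x                     ∎

  e-scale : ∀ j {m} (c : Carrier) (x : Fin m → Carrier) → e j (λ v → c * x v) ≈ c ^ j * e j x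
  e-scale zero            c x = trans (e-0 (λ v → c * x v)) (sym (trans (*-identityˡ _) (e-0 x)))
  e-scale (suc j) {zero}  c x = sym (zeroʳ _)
  e-scale (suc j) {suc m} c x = begin
    e (suc j) (λ v → c * x v) ≈⟨ e-suc-suc j (λ v → c * x v) ⟩
    e (suc j) (λ v → c * x (suc v)) + c * x zero * e j (λ v → c * x (suc v))
      ≈⟨ +-cong (e-scale (suc j) c (x ∘ suc)) (*-congˡ (e-scale j c (x ∘ suc))) ⟩
    c * c ^ j * e (suc j) (x ∘ suc) + c * x zero * (c ^ j * e j (x ∘ suc))
      ≈⟨ solve 5 (λ c d a b x → c :* d :* a :+ c :* x :* (d :* b) := c :* d :* (a :+ x :* b)) refl
           c (c ^ j) (e (suc j) (x ∘ suc)) (e j (x ∘ suc)) (x zero) ⟩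
    c * c ^ j * (e (suc j) (x ∘ suc) + x zero * e j (x ∘ suc)) ≈⟨ *-congˡ (e-suc-suc j x) ⟨
    c * c ^ j * e (suc j) x ∎

  -- Deletes the letter z by giving it mass zero; the index type stays the same, and `d` can recurse
  -- on it.
  zeroed : ∀ {m} → (Fin m → Carrier) → Fin m → Fin m → Carrier
  zeroed q z v = if does (z ≟F v) then 0# else q v

  -- The sum of q(w₁)⋯q(w_N) over all words of N distinct letters.
  d : ℕ → ∀ {m} → (Fin m → Carrier) → Carrier
  d zero        q = 1#
  d (suc N) {m} q = Σ[ z ← allFin m ] q z * d N (zeroed q z)

  zeroed-cong : ∀ {m} {q r : Fin m → Carrier} → (∀ v → q v ≈ r v) →
                ∀ z v → zeroed q z v ≈ zeroed r z v
  zeroed-cong q≈r z v with does (z ≟F v)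
  ... | true  = refl
  ... | false = q≈r v

  d-cong : ∀ N {m} {q r : Fin m → Carrier} → (∀ v → q v ≈ r v) → d N q ≈ d N r
  d-cong zero        q≈r = refl
  d-cong (suc N) {m} q≈r = Σ-cong (allFin m) λ z →
    *-cong (q≈r z) (d-cong N (zeroed-cong q≈r z))

  e-zeroed-zero : ∀ j {m} (x : Fin (suc m) → Carrier) → e j (zeroed x zero) ≈ e j (x ∘ suc)
  e-zeroed-zero zero    x = trans (e-0 (zeroed x zero)) (sym (e-0 (x ∘ suc)))
  e-zeroed-zero (suc j) x = trans (e-suc-suc j (zeroed x zero))
    (trans (+-congˡ (zeroˡ _)) (+-identityʳ _))

  -- Each set of j + 1 variables arises once for every choice of its element z. The induction splits
  -- both sides at the first variable by `e-suc-suc`.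
  Σ-e-zeroed : ∀ j {m} (x : Fin m → Carrier) →
    (Σ[ z ← allFin m ] x z * e j (zeroed x z)) ≈ fromℕ (suc j) * e (suc j) x
  Σ-e-zeroed j {zero} x = sym (zeroʳ _)
  Σ-e-zeroed zero {suc m} x = begin
    (Σ[ z ← allFin (suc m) ] x z * e 0 (zeroed x z))
      ≈⟨ Σ-cong (allFin (suc m)) (λ z → trans (*-congˡ (e-0 (zeroed x z))) (*-identityʳ _)) ⟩
    sumOver (allFin (suc m)) x ≈⟨ e-1 x ⟨
    e 1 x                      ≈⟨ *-identityˡ _ ⟨
    1# * e 1 x                 ≈⟨ *-congʳ (+-identityʳ 1#) ⟨
    fromℕ 1 * e 1 x            ∎
  Σ-e-zeroed (suc j) {suc m} x = begin
    (Σ[ z ← allFin (suc m) ] x z * e (suc j) (zeroed x z))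
      ≈⟨ Σ-suc m (λ z → x z * e (suc j) (zeroed x z)) ⟩
    x₀ * e (suc j) (zeroed x zero) + (Σ[ z ← allFin m ] xs z * e (suc j) (zeroed x (suc z)))
      ≈⟨ +-cong (*-congˡ (e-zeroed-zero (suc j) x))
           (trans (Σ-cong (allFin m) λ z → trans (*-congˡ (e-suc-suc j (zeroed x (suc z))))
                     (solve 4 (λ a b c d → a :* (b :+ c :* d) := a :* b :+ c :* (a :* d)) refl
                       (xs z) (e (suc j) (zeroed xs z)) x₀ (e j (zeroed xs z))))
                  (trans (Σ-+ (allFin m) _ _) (+-congˡ (Σ-*ˡ (allFin m) x₀ _)))) ⟩
    x₀ * e (suc j) xs + ((Σ[ z ← allFin m ] xs z * e (suc j) (zeroed xs z))
                         + x₀ * (Σ[ z ← allFin m ] xs z * e j (zeroed xs z)))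
      ≈⟨ +-congˡ (+-cong (Σ-e-zeroed (suc j) xs) (*-congˡ (Σ-e-zeroed j xs))) ⟩
    x₀ * e (suc j) xs + (fromℕ (2 ℕ.+ j) * e (2 ℕ.+ j) xs + x₀ * (fromℕ (suc j) * e (suc j) xs))
      ≈⟨ solve 4 (λ x n a b → x :* a :+ ((con 1 :+ n) :* b :+ x :* (n :* a))
                   := (con 1 :+ n) :* (b :+ x :* a)) refl x₀ (fromℕ (suc j)) (e (suc j) xs) (e (2 ℕ.+ j) xs) ⟩
    fromℕ (2 ℕ.+ j) * (e (2 ℕ.+ j) xs + x₀ * e (suc j) xs)
      ≈⟨ *-congˡ (e-suc-suc (suc j) x) ⟨
    fromℕ (2 ℕ.+ j) * e (2 ℕ.+ j) x ∎
    where
    x₀ = x zero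
    xs = x ∘ suc

  d≈N!e : ∀ N {m} (q : Fin m → Carrier) → d N q ≈ fromℕ (N !) * e N q
  d≈N!e zero q = sym (trans (*-cong (+-identityʳ 1#) (e-0 q)) (*-identityʳ 1#))
  d≈N!e (suc N) {m} q = begin
    (Σ[ z ← allFin m ] q z * d N (zeroed q z))
      ≈⟨ Σ-cong (allFin m) (λ z → trans (*-congˡ (d≈N!e N (zeroed q z)))
           (solve 3 (λ a b c → a :* (b :* c) := b :* (a :* c)) refl
             (q z) (fromℕ (N !)) (e N (zeroed q z)))) ⟩
    (Σ[ z ← allFin m ] fromℕ (N !) * (q z * e N (zeroed q z)))
      ≈⟨ Σ-*ˡ (allFin m) (fromℕ (N !)) _ ⟩
    fromℕ (N !) * (Σ[ z ← allFin m ] q z * e N (zeroed q z))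
      ≈⟨ *-congˡ (Σ-e-zeroed N q) ⟩
    fromℕ (N !) * (fromℕ (suc N) * e (suc N) q)
      ≈⟨ solve 3 (λ a b c → a :* (b :* c) := b :* a :* c) refl _ _ _ ⟩
    fromℕ (suc N) * fromℕ (N !) * e (suc N) q
      ≈⟨ *-congʳ (×1-homo-* (suc N) (N !)) ⟨
    fromℕ (suc N !) * e (suc N) q ∎

-- Independent coordinates and push-forward laws.

-- Built from `∀-cons`, as the functions in `choices` are: an update of `∀-cons b f` reduces to a
-- `∀-cons`, so `𝔼-resample` can proceed by `𝔼-suc` without function extensionality.
update : ∀ {m} {B : Fin m → Set} → (∀ i → B i) → ∀ i → B i → ∀ i → B i
update f zero    b = ∀-cons b (f ∘ suc)
update f (suc i) b = ∀-cons (f zero) (update (f ∘ suc) i b)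

update-same : ∀ {m} {B : Fin m → Set} (f : ∀ i → B i) i b → update f i b i ≡ b
update-same f zero    b = ≡.refl
update-same f (suc i) b = update-same (f ∘ suc) i b

update-other : ∀ {m} {B : Fin m → Set} (f : ∀ i → B i) i b {j} → ¬ i ≡ j → update f i b j ≡ f j
update-other f zero    b {zero}  i≢j = ⊥-elim (i≢j ≡.refl)
update-other f zero    b {suc j} i≢j = ≡.refl
update-other f (suc i) b {zero}  i≢j = ≡.refl
update-other f (suc i) b {suc j} i≢j = update-other (f ∘ suc) i b (i≢j ∘ ≡.cong suc)

module Expectation (K : Field) where
  open Field K hiding (zero)
  open Expressions K
  open FiniteSums K
  open SymmetricFunctions K
  open Solver commutativeSemiring using (solve; _:=_; _:+_; _:*_; con)
  open SetoidReasoning setoid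

  private variable
    A C : Set

  mean : List A → (A → Carrier) → (A → Carrier) → Carrier
  mean as w φ = Σ[ a ← as ] w a * φ a

  mean-cong : (as : List A) (w : A → Carrier) {φ ψ : A → Carrier} → (∀ a → φ a ≈ ψ a) →
              mean as w φ ≈ mean as w ψ
  mean-cong as w φ≈ψ = Σ-cong as λ a → *-congˡ (φ≈ψ a)

  mean-+ : (as : List A) (w φ ψ : A → Carrier) →
           mean as w (λ a → φ a + ψ a) ≈ mean as w φ + mean as w ψ
  mean-+ as w φ ψ = trans (Σ-cong as λ a → distribˡ _ _ _) (Σ-+ as _ _)

  mean-*ˡ : (as : List A) (w : A → Carrier) (c : Carrier) (φ : A → Carrier) →
            mean as w (λ a → c * φ a) ≈ c * mean as w φ
  mean-*ˡ as w c φ = trans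
    (Σ-cong as λ a → solve 3 (λ w c t → w :* (c :* t) := c :* (w :* t)) refl (w a) c (φ a))
    (Σ-*ˡ as c _)

  mean-*ʳ : (as : List A) (w : A → Carrier) (c : Carrier) (φ : A → Carrier) →
            mean as w (λ a → φ a * c) ≈ mean as w φ * c
  mean-*ʳ as w c φ = trans (Σ-cong as λ a → sym (*-assoc _ _ _)) (Σ-*ʳ as c _)

  mean-const : (as : List A) (w : A → Carrier) → sumOver as w ≈ 1# → (c : Carrier) →
               mean as w (λ _ → c) ≈ c
  mean-const as w Σw≈1 c = trans (Σ-*ʳ as c w) (trans (*-congʳ Σw≈1) (*-identityˡ c))

  mean-Σ : (as : List A) (w : A → Carrier) (cs : List C) (t : A → C → Carrier) →
           mean as w (λ a → Σ[ c ← cs ] t a c) ≈ (Σ[ c ← cs ] mean as w (λ a → t a c))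
  mean-Σ as w cs t = trans (Σ-cong as λ a → sym (Σ-*ˡ cs (w a) (t a))) (Σ-swap as cs _)

  mean-swap : (as : List A) (w : A → Carrier) (cs : List C) (v : C → Carrier)
              (t : A → C → Carrier) →
              mean as w (λ a → mean cs v (t a)) ≈ mean cs v (λ c → mean as w (λ a → t a c))
  mean-swap as w cs v t = trans (mean-Σ as w cs _)
    (Σ-cong cs λ c → mean-*ˡ as w (v c) (λ a → t a c))

  𝔼 : ∀ {m} {B : Fin m → Set} → (∀ i → List (B i)) → (∀ i → B i → Carrier) →
      ((∀ i → B i) → Carrier) → Carrier
  𝔼 {m} bs ws = mean (choices bs) (λ f → Π[ i ← allFin m ] ws i (f i))

  𝔼-suc : ∀ {m} {B : Fin (suc m) → Set} (bs : ∀ i → List (B i)) (ws : ∀ i → B i → Carrier) φ →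
          𝔼 bs ws φ ≈ mean (bs zero) (ws zero) (λ b → 𝔼 (bs ∘ suc) (λ i → ws (suc i)) (λ f → φ (∀-cons b f)))
  𝔼-suc {m} {B} bs ws φ = trans
    (Σ-cartesianProductWith (∀-cons {P = B}) (bs zero) (choices (bs ∘ suc)) _)
    (Σ-cong (bs zero) λ b → trans
      (Σ-cong (choices (bs ∘ suc)) λ f → trans
        (*-congʳ (Π-suc m λ i → ws i (∀-cons {P = B} b f i)))
        (*-assoc _ _ _))
      (Σ-*ˡ (choices (bs ∘ suc)) (ws zero b) _))

  𝔼-normalised : ∀ {m} {B : Fin m → Set} (bs : ∀ i → List (B i)) (ws : ∀ i → B i → Carrier) →
    (∀ i → sumOver (bs i) (ws i) ≈ 1#) →
    sumOver (choices bs) (λ f → Π[ i ← allFin m ] ws i (f i)) ≈ 1#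
  𝔼-normalised {zero}  bs ws Σw≈1 = +-identityʳ 1#
  𝔼-normalised {suc m} bs ws Σw≈1 = begin
    sumOver (choices bs) W                            ≈⟨ Σ-cong (choices bs) (λ f → *-identityʳ (W f)) ⟨
    𝔼 bs ws (λ _ → 1#)                                ≈⟨ 𝔼-suc bs ws (λ _ → 1#) ⟩
    mean (bs zero) (ws zero) (λ b → 𝔼 (bs ∘ suc) (λ i → ws (suc i)) (λ _ → 1#))
      ≈⟨ mean-const (bs zero) (ws zero) (Σw≈1 zero) _ ⟩
    𝔼 (bs ∘ suc) (λ i → ws (suc i)) (λ _ → 1#)
      ≈⟨ mean-const (choices (bs ∘ suc)) _ (𝔼-normalised (bs ∘ suc) (λ i → ws (suc i)) (Σw≈1 ∘ suc)) 1# ⟩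
    1# ∎
    where W = λ f → Π[ i ← allFin (suc m) ] ws i (f i)

  -- Independence of the coordinates: after coordinate i is redrawn, its old value no longer occurs
  -- and averages out with total mass 1. This replaces conditioning on coordinate i, which becomes a
  -- separate variable while f remains a full family.
  𝔼-resample : ∀ {m} {B : Fin m → Set} (bs : ∀ i → List (B i)) (ws : ∀ i → B i → Carrier) →
    (∀ i → sumOver (bs i) (ws i) ≈ 1#) → ∀ i φ →
    𝔼 bs ws φ ≈ 𝔼 bs ws (λ f → mean (bs i) (ws i) (λ b → φ (update f i b)))
  𝔼-resample bs ws Σw≈1 zero φ = begin
    𝔼 bs ws φ ≈⟨ 𝔼-suc bs ws φ ⟩
    mean (bs zero) (ws zero) (λ b → 𝔼 bs′ ws′ (λ f → φ (∀-cons b f)))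
      ≈⟨ mean-swap (bs zero) (ws zero) (choices bs′) _ (λ b f → φ (∀-cons b f)) ⟩
    𝔼 bs′ ws′ (λ f → mean (bs zero) (ws zero) (λ b → φ (∀-cons b f)))
      ≈⟨ mean-const (bs zero) (ws zero) (Σw≈1 zero) _ ⟨
    mean (bs zero) (ws zero) (λ _ → 𝔼 bs′ ws′ (λ f → mean (bs zero) (ws zero) (λ b → φ (∀-cons b f))))
      ≈⟨ 𝔼-suc bs ws (λ f → mean (bs zero) (ws zero) (λ b → φ (update f zero b))) ⟨
    𝔼 bs ws (λ f → mean (bs zero) (ws zero) (λ b → φ (update f zero b))) ∎
    where
    bs′ = λ i → bs (suc i)
    ws′ = λ i → ws (suc i)
  𝔼-resample bs ws Σw≈1 (suc i) φ = begin
    𝔼 bs ws φ ≈⟨ 𝔼-suc bs ws φ ⟩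
    mean (bs zero) (ws zero) (λ b → 𝔼 bs′ ws′ (λ f → φ (∀-cons b f)))
      ≈⟨ mean-cong (bs zero) (ws zero) (λ b →
           𝔼-resample bs′ ws′ (Σw≈1 ∘ suc) i (λ f → φ (∀-cons b f))) ⟩
    mean (bs zero) (ws zero) (λ b → 𝔼 bs′ ws′ (λ f →
      mean (bs (suc i)) (ws (suc i)) (λ b′ → φ (∀-cons b (update f i b′)))))
      ≈⟨ 𝔼-suc bs ws (λ f → mean (bs (suc i)) (ws (suc i)) (λ b → φ (update f (suc i) b))) ⟨
    𝔼 bs ws (λ f → mean (bs (suc i)) (ws (suc i)) (λ b → φ (update f (suc i) b))) ∎
    where
    bs′ = λ i → bs (suc i)
    ws′ = λ i → ws (suc i)

  -- The mean over maps Fin m → Fin n whose values are independent with law q.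
  𝔼ᶠ : ∀ m {n} → (Fin n → Carrier) → ((Fin m → Fin n) → Carrier) → Carrier
  𝔼ᶠ m {n} q = 𝔼 {m} (λ _ → allFin n) (λ _ → q)

  𝔼ᶠ-cong : ∀ m {n} (q : Fin n → Carrier) {φ ψ : (Fin m → Fin n) → Carrier} →
            (∀ f → φ f ≈ ψ f) → 𝔼ᶠ m q φ ≈ 𝔼ᶠ m q ψ
  𝔼ᶠ-cong m {n} q = mean-cong (choices {m} λ _ → allFin n) _

  𝔼ᶠ-const : ∀ m {n} (q : Fin n → Carrier) → sumOver (allFin n) q ≈ 1# → ∀ c → 𝔼ᶠ m q (λ _ → c) ≈ c
  𝔼ᶠ-const m {n} q Σq≈1 = mean-const (choices {m} λ _ → allFin n) _
    (𝔼-normalised {m} (λ _ → allFin n) (λ _ → q) (λ _ → Σq≈1))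

  𝔼ᶠ-resample : ∀ m {n} (q : Fin n → Carrier) → sumOver (allFin n) q ≈ 1# → ∀ i φ →
    𝔼ᶠ m q φ ≈ mean (allFin n) q (λ z → 𝔼ᶠ m q (λ f → φ (update f i z)))
  𝔼ᶠ-resample m {n} q Σq≈1 i φ = trans
    (𝔼-resample {m} (λ _ → allFin n) (λ _ → q) (λ _ → Σq≈1) i φ)
    (mean-swap (choices {m} λ _ → allFin n) (λ f → Π[ v ← allFin m ] q (f v)) (allFin n) q (λ f z → φ (update f i z)))

  pushforward : ∀ {m n} → (Fin m → Fin n) → (Fin m → Carrier) → Fin n → Carrier
  pushforward {m} f p z = Σ[ y ← allFin m ] p y * ⟦ f y ≟F z ⟧

  mean-pushforward : ∀ {m n} (f : Fin m → Fin n) (p : Fin m → Carrier) ψ →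
    mean (allFin n) (pushforward f p) ψ ≈ mean (allFin m) p (ψ ∘ f)
  mean-pushforward {m} {n} f p ψ = begin
    (Σ[ z ← allFin n ] pushforward f p z * ψ z)
      ≈⟨ Σ-cong (allFin n) (λ z → sym (Σ-*ʳ (allFin m) (ψ z) (λ y → p y * ⟦ f y ≟F z ⟧))) ⟩
    (Σ[ z ← allFin n ] Σ[ y ← allFin m ] p y * ⟦ f y ≟F z ⟧ * ψ z)
      ≈⟨ Σ-swap (allFin n) (allFin m) (λ z y → p y * ⟦ f y ≟F z ⟧ * ψ z) ⟩
    (Σ[ y ← allFin m ] Σ[ z ← allFin n ] p y * ⟦ f y ≟F z ⟧ * ψ z)
      ≈⟨ Σ-cong (allFin m) (λ y → trans
           (Σ-cong (allFin n) λ z → trans (*-assoc _ _ _) (*-congˡ (*-comm _ _)))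
           (trans (Σ-*ˡ (allFin n) (p y) (λ z → ψ z * ⟦ f y ≟F z ⟧)) (*-congˡ (Σ-δ (f y) ψ)))) ⟩
    (Σ[ y ← allFin m ] p y * ψ (f y)) ∎

  pushforward-normalised : ∀ {m n} (f : Fin m → Fin n) (p : Fin m → Carrier) →
    sumOver (allFin m) p ≈ 1# → sumOver (allFin n) (pushforward f p) ≈ 1#
  pushforward-normalised {m} {n} f p Σp≈1 = begin
    sumOver (allFin n) (pushforward f p)            ≈⟨ Σ-cong (allFin n) (λ z → *-identityʳ _) ⟨
    mean (allFin n) (pushforward f p) (λ _ → 1#)    ≈⟨ mean-pushforward f p (λ _ → 1#) ⟩
    mean (allFin m) p (λ _ → 1#)                    ≈⟨ mean-const (allFin m) p Σp≈1 1# ⟩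
    1#                                              ∎

  pushforward-congˡ : ∀ {m n} {f g : Fin m → Fin n} → f ≗ g → ∀ p z →
                     pushforward f p z ≈ pushforward g p z
  pushforward-congˡ {m} f≗g p z = Σ-cong (allFin m) λ y →
    *-congˡ (reflexive (≡.cong (λ s → ⟦ s ≟F z ⟧) (f≗g y)))

  -- The images under g of independent samples of law q are independent samples of the push-forward.
  -- The hypothesis on φ is there because `g ∘ ∀-cons z f` and `∀-cons (g z) (g ∘ f)` agree only
  -- pointwise.
  𝔼ᶠ-pushforward : ∀ m {n n′} (g : Fin n → Fin n′) (q : Fin n → Carrier) φ →
    (∀ {f f′} → f ≗ f′ → φ f ≈ φ f′) →
    𝔼ᶠ m q (λ f → φ (g ∘ f)) ≈ 𝔼ᶠ m (pushforward g q) φ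
  𝔼ᶠ-pushforward zero    g q φ φ-cong = +-congʳ (*-congˡ (φ-cong λ ()))
  𝔼ᶠ-pushforward (suc m) {n} {n′} g q φ φ-cong = begin
    𝔼ᶠ (suc m) q (λ f → φ (g ∘ f))
      ≈⟨ 𝔼-suc {m} (λ _ → allFin n) (λ _ → q) (λ f → φ (g ∘ f)) ⟩
    mean (allFin n) q (λ z → 𝔼ᶠ m q (λ f → φ (g ∘ ∀-cons z f)))
      ≈⟨ mean-cong (allFin n) q (λ z → trans
           (𝔼ᶠ-cong m q λ f → φ-cong λ { zero → ≡.refl ; (suc v) → ≡.refl })
           (𝔼ᶠ-pushforward m g q (λ f → φ (∀-cons (g z) f))
             λ f≗f′ → φ-cong λ { zero → ≡.refl ; (suc v) → f≗f′ v })) ⟩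
    mean (allFin n) q (λ z → 𝔼ᶠ m (pushforward g q) (λ f → φ (∀-cons (g z) f)))
      ≈⟨ mean-pushforward g q (λ z → 𝔼ᶠ m (pushforward g q) (λ f → φ (∀-cons z f))) ⟨
    mean (allFin n′) (pushforward g q) (λ z → 𝔼ᶠ m (pushforward g q) (λ f → φ (∀-cons z f)))
      ≈⟨ 𝔼-suc {m} (λ _ → allFin n′) (λ _ → pushforward g q) φ ⟨
    𝔼ᶠ (suc m) (pushforward g q) φ ∎

-- Distinct samples of a random push-forward law.

module DistinctSamples (K : Field) where
  open Field K hiding (zero)
  open Expressions K
  open FiniteSums K
  open SymmetricFunctions K
  open Expectation K
  open Solver commutativeSemiring using (solve; _:=_; _:+_; _:*_; con)
  open SetoidReasoning setoid

  zeroed-* : ∀ {m} (r q : Fin m → Carrier) z v →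
             zeroed (λ v → r v * q v) z v ≈ zeroed r z v * q v
  zeroed-* r q z v with does (z ≟F v)
  ... | true  = sym (zeroˡ _)
  ... | false = refl

  pushforward-zeroed : ∀ {m n} (f : Fin m → Fin n) (p : Fin m → Carrier) y {z} → ¬ f y ≡ z →
                       pushforward f p z ≈ pushforward f (zeroed p y) z
  pushforward-zeroed {m} f p y {z} fy≢z = Σ-cong (allFin m) λ y′ → term y′
    where
    term : ∀ y′ → p y′ * ⟦ f y′ ≟F z ⟧ ≈ zeroed p y y′ * ⟦ f y′ ≟F z ⟧
    term y′ with y ≟F y′
    ... | yes ≡.refl = trans (trans (*-congˡ (⟦⟧-false (f y ≟F z) fy≢z)) (zeroʳ _)) (sym (zeroˡ _))
    ... | no  _      = refl

  -- Once the letter f y is deleted in the target, the mass of y is invisible, so y can be deleted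
  -- in the source too. The remaining expression then no longer depends on f y.
  zeroed-pushforward : ∀ {m n} (f : Fin m → Fin n) (p : Fin m → Carrier) (r : Fin n → Carrier) y z →
    zeroed (λ z → r z * pushforward f p z) (f y) z ≈ zeroed r (f y) z * pushforward f (zeroed p y) z
  zeroed-pushforward f p r y z with f y ≟F z
  ... | yes _    = sym (zeroˡ _)
  ... | no  fy≢z = *-congˡ (pushforward-zeroed f p y fy≢z)

  pushforward-update : ∀ {m n} (f : Fin m → Fin n) (p : Fin m → Carrier) y x z →
    pushforward (update f y x) (zeroed p y) z ≈ pushforward f (zeroed p y) z
  pushforward-update {m} f p y x z = Σ-cong (allFin m) term
    where
    term : ∀ y′ → zeroed p y y′ * ⟦ update f y x y′ ≟F z ⟧ ≈ zeroed p y y′ * ⟦ f y′ ≟F z ⟧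
    term y′ with y ≟F y′
    ... | yes _    = trans (zeroˡ _) (sym (zeroˡ _))
    ... | no  y≢y′ = *-congˡ (reflexive (≡.cong (λ s → ⟦ s ≟F z ⟧) (update-other f y x y≢y′)))

  -- A first letter of law f₊p is f y for a y of law p; the word continues without f y in the target
  -- and without y in the source.
  d-suc-pushforward : ∀ N {m n} (f : Fin m → Fin n) (p : Fin m → Carrier) (r : Fin n → Carrier) →
    d (suc N) (λ z → r z * pushforward f p z) ≈
    mean (allFin m) p (λ y → r (f y) * d N (λ z → zeroed r (f y) z * pushforward f (zeroed p y) z))
  d-suc-pushforward N {m} {n} f p r = begin
    (Σ[ z ← allFin n ] r z * pushforward f p z * d N (zeroed rf z))
      ≈⟨ Σ-cong (allFin n) (λ z →
           solve 3 (λ a b c → a :* b :* c := b :* (a :* c)) refl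
             (r z) (pushforward f p z) (d N (zeroed rf z))) ⟩
    mean (allFin n) (pushforward f p) (λ z → r z * d N (zeroed rf z))
      ≈⟨ mean-pushforward f p (λ z → r z * d N (zeroed rf z)) ⟩
    mean (allFin m) p (λ y → r (f y) * d N (zeroed rf (f y)))
      ≈⟨ mean-cong (allFin m) p (λ y → *-congˡ (d-cong N (zeroed-pushforward f p r y))) ⟩
    mean (allFin m) p (λ y → r (f y) * d N (λ z → zeroed r (f y) z * pushforward f (zeroed p y) z)) ∎
    where rf = λ z → r z * pushforward f p z

  -- d_N(f₊p) sums over words y₁⋯y_N with distinct images. Such yᵢ are distinct, with total mass
  -- d_N(p), and their images are N independent samples of law q, distinct with mass d_N(q). The
  -- weight r vanishes on the image letters already used.
  𝔼-d-pushforward : ∀ N {m n} (q : Fin n → Carrier) → sumOver (allFin n) q ≈ 1# →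
    (p : Fin m → Carrier) (r : Fin n → Carrier) →
    𝔼ᶠ m q (λ f → d N (λ z → r z * pushforward f p z)) ≈ d N p * d N (λ z → r z * q z)
  𝔼-d-pushforward zero {m} q Σq≈1 p r = trans (𝔼ᶠ-const m q Σq≈1 1#) (sym (*-identityˡ 1#))
  𝔼-d-pushforward (suc N) {m} {n} q Σq≈1 p r = begin
    𝔼ᶠ m q (λ f → d (suc N) (λ z → r z * pushforward f p z))
      ≈⟨ 𝔼ᶠ-cong m q (λ f → d-suc-pushforward N f p r) ⟩
    𝔼ᶠ m q (λ f → mean (allFin m) p (λ y → F y (f y) f))
      ≈⟨ mean-swap (choices {m} λ _ → allFin n) _ (allFin m) p (λ f y → F y (f y) f) ⟩
    mean (allFin m) p (λ y → 𝔼ᶠ m q (λ f → F y (f y) f))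
      ≈⟨ mean-cong (allFin m) p resampled ⟩
    mean (allFin m) p (λ y → d N (zeroed p y) * d (suc N) (λ z → r z * q z))
      ≈⟨ trans (Σ-cong (allFin m) λ y → sym (*-assoc _ _ _)) (Σ-*ʳ (allFin m) _ _) ⟩
    d (suc N) p * d (suc N) (λ z → r z * q z) ∎
    where
    -- The value x at y is a separate argument: since `zeroed p y` has no mass at y, nothing else in
    -- `F y x f` depends on f y.
    F : Fin m → Fin n → (Fin m → Fin n) → Carrier
    F y x f = r x * d N (λ z → zeroed r x z * pushforward f (zeroed p y) z)

    F-update : ∀ f y x → F y (update f y x y) (update f y x) ≈ F y x f
    F-update f y x = trans
      (reflexive (≡.cong (λ s → F y s (update f y x)) (update-same f y x)))
      (*-congˡ (d-cong N λ z → *-congˡ (pushforward-update f p y x z)))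

    resampled : ∀ y → 𝔼ᶠ m q (λ f → F y (f y) f) ≈ d N (zeroed p y) * d (suc N) (λ z → r z * q z)
    resampled y = begin
      𝔼ᶠ m q (λ f → F y (f y) f)
        ≈⟨ 𝔼ᶠ-resample m q Σq≈1 y (λ f → F y (f y) f) ⟩
      mean (allFin n) q (λ x → 𝔼ᶠ m q (λ f → F y (update f y x y) (update f y x)))
        ≈⟨ mean-cong (allFin n) q (λ x → 𝔼ᶠ-cong m q λ f → F-update f y x) ⟩
      mean (allFin n) q (λ x → 𝔼ᶠ m q (F y x))
        ≈⟨ mean-cong (allFin n) q (λ x → trans
             (mean-*ˡ (choices {m} λ _ → allFin n) _ (r x) _)
             (*-congˡ (𝔼-d-pushforward N q Σq≈1 (zeroed p y) (zeroed r x)))) ⟩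
      mean (allFin n) q (λ x → r x * (d N (zeroed p y) * d N (λ z → zeroed r x z * q z)))
        ≈⟨ Σ-cong (allFin n) (λ x → trans
             (*-congˡ (*-congˡ (*-congˡ (d-cong N λ z → sym (zeroed-* r q x z)))))
             (solve 4 (λ q r a b → q :* (r :* (a :* b)) := a :* (r :* q :* b)) refl
               (q x) (r x) (d N (zeroed p y)) (d N (zeroed (λ z → r z * q z) x)))) ⟩
      (Σ[ x ← allFin n ] d N (zeroed p y) * (r x * q x * d N (zeroed (λ z → r z * q z) x)))
        ≈⟨ Σ-*ˡ (allFin n) (d N (zeroed p y)) _ ⟩
      d N (zeroed p y) * d (suc N) (λ z → r z * q z) ∎

-- Edge contraction and the mass of the roots.

-- Rooted forests: the vertices are suc v, and zero is the root.
data ToRoot {l} (f : Fin l → Fin (suc l)) : Fin (suc l) → Set where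
  root : ToRoot f zero
  step : ∀ {v} → ToRoot f (f v) → ToRoot f (suc v)

Acyclic : ∀ {l} → (Fin l → Fin (suc l)) → Set
Acyclic f = ∀ y → ToRoot f y

ToRoot-cong : ∀ {l} {f g : Fin l → Fin (suc l)} → f ≗ g → ∀ {y} → ToRoot f y → ToRoot g y
ToRoot-cong f≗g root             = root
ToRoot-cong {g = g} f≗g (step {v} p) = step (≡.subst (ToRoot g) (f≗g v) (ToRoot-cong f≗g p))

-- The first vertex, suc zero, is merged into its target w.
lower : ∀ {l} → Fin (suc (suc l)) → Fin (suc l)
lower zero          = zero
-- A default for a vertex that is its own target; `acyclic?` rejects this loop separately.
lower (suc zero)    = zero
lower (suc (suc u)) = suc u

contraction : ∀ {l} → Fin (suc (suc l)) → Fin (suc (suc l)) → Fin (suc l)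
contraction w zero          = zero
contraction w (suc zero)    = lower w
contraction w (suc (suc u)) = suc u

contract : ∀ {l} → (Fin (suc l) → Fin (suc (suc l))) → Fin l → Fin (suc l)
contract f u = contraction (f zero) (f (suc u))

module _ {l} (f : Fin (suc l) → Fin (suc (suc l))) where
  private
    w : Fin (suc (suc l))
    w = f zero

    raise : Fin (suc l) → Fin (suc (suc l))
    raise zero    = zero
    raise (suc u) = suc (suc u)

    raise-lower : ∀ {y} → ¬ y ≡ suc zero → raise (lower y) ≡ y
    raise-lower {zero}          y≢1 = ≡.refl
    raise-lower {suc zero}      y≢1 = ⊥-elim (y≢1 ≡.refl)
    raise-lower {suc (suc u)}   y≢1 = ≡.refl

  -- Induction on the path: its remainder starts again at the looping vertex, so it could never end.
  loop⇒¬ToRoot : w ≡ suc zero → ¬ ToRoot f (suc zero)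
  loop⇒¬ToRoot w≡1 (step p) = loop⇒¬ToRoot′ w≡1 p
    where
    loop⇒¬ToRoot′ : ∀ {y} → y ≡ suc zero → ¬ ToRoot f y
    loop⇒¬ToRoot′ ≡.refl (step p) = loop⇒¬ToRoot′ w≡1 p

  ToRoot-contract⁺ : ∀ {y} → ToRoot f y → ToRoot (contract f) (contraction w y)
  ToRoot-contract⁺ root                 = root
  ToRoot-contract⁺ (step {suc u} p)     = step (ToRoot-contract⁺ p)
  -- This step uses the contracted edge, whose two ends have the same image; the projected path
  -- omits it.
  ToRoot-contract⁺ (step {zero} p) with f zero | ToRoot-contract⁺ p
  ... | zero        | p′ = p′
  ... | suc zero    | p′ = root
  ... | suc (suc u) | p′ = p′

  module _ (w≢1 : ¬ w ≡ suc zero) where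
    ToRoot-raise-contraction : ∀ y → ToRoot f (raise (contraction w y)) → ToRoot f y
    ToRoot-raise-contraction zero          p = root
    ToRoot-raise-contraction (suc zero)    p = step (≡.subst (ToRoot f) (raise-lower w≢1) p)
    ToRoot-raise-contraction (suc (suc u)) p = p

    ToRoot-contract⁻ : ∀ {y} → ToRoot (contract f) y → ToRoot f (raise y)
    ToRoot-contract⁻ root         = root
    ToRoot-contract⁻ (step {u} p) = step (ToRoot-raise-contraction (f (suc u)) (ToRoot-contract⁻ p))

    Acyclic-contract⁻ : Acyclic (contract f) → Acyclic f
    Acyclic-contract⁻ ac y = ToRoot-raise-contraction y (ToRoot-contract⁻ (ac (contraction w y)))

  Acyclic-contract⁺ : Acyclic f → Acyclic (contract f)
  Acyclic-contract⁺ ac zero    = root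
  Acyclic-contract⁺ ac (suc u) = ToRoot-contract⁺ (ac (suc (suc u)))

-- Decided by contracting one edge at a time, so that the Boolean unfolds to the factorisation which
-- `acyclic-suc` needs.
acyclic? : ∀ {l} (f : Fin l → Fin (suc l)) → Dec (Acyclic f)
acyclic? {zero}  f = yes λ { zero → root }
acyclic? {suc l} f = Dec.map′
  (λ (w≢1 , ac) → Acyclic-contract⁻ f w≢1 ac)
  (λ ac → (λ w≡1 → loop⇒¬ToRoot f w≡1 (ac (suc zero))) , Acyclic-contract⁺ f ac)
  (¬? (f zero ≟F suc zero) ×-dec acyclic? (contract f))

-- With ρ = `suc`, acyclicity of `cut b suc G` says that every orbit of G enters b. A general ρ
-- keeps the sample space `Fin n` fixed while contractions reduce the number l of vertices.
cut : ∀ {n l} → (Fin l → Bool) → (Fin n → Fin (suc l)) → (Fin l → Fin n) → Fin l → Fin (suc l)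
cut b ρ G v = if b v then zero else ρ (G v)

isRoot : ∀ {l} → (Fin l → Bool) → Fin (suc l) → Bool
isRoot b zero    = true
isRoot b (suc v) = b v

module Forests (K : Field) where
  open Field K hiding (zero)
  open Expressions K
  open FiniteSums K
  open SymmetricFunctions K
  open Expectation K
  open Solver commutativeSemiring using (solve; _:=_; _:+_; _:*_; con)
  open SetoidReasoning setoid

  acyclic-cong : ∀ {l} {f g : Fin l → Fin (suc l)} → f ≗ g → ⟦ acyclic? f ⟧ ≈ ⟦ acyclic? g ⟧
  acyclic-cong {f = f} {g} f≗g = ⟦⟧-cong (acyclic? f) (acyclic? g)
    (λ ac y → ToRoot-cong f≗g (ac y)) (λ ac y → ToRoot-cong (≡.sym ∘ f≗g) (ac y))

  𝟙-not : ∀ b → 𝟙 (not b) + 𝟙 b ≈ 1#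
  𝟙-not true  = +-identityˡ 1#
  𝟙-not false = +-identityʳ 1#

  isRoot-contraction-root : ∀ {l} (b : Fin (suc l) → Bool) y → b zero ≡ true →
    𝟙 (isRoot (b ∘ suc) (contraction zero y)) ≈ 𝟙 (isRoot b y)
  isRoot-contraction-root b zero          b0 = refl
  isRoot-contraction-root b (suc zero)    b0 = reflexive (≡.cong 𝟙 (≡.sym b0))
  isRoot-contraction-root b (suc (suc u)) b0 = refl

  -- Only the contracted vertex can change status: it was not a root, and it takes over the status
  -- of its target w.
  isRoot-contraction : ∀ {l} (b : Fin (suc l) → Bool) w y → b zero ≡ false →
    𝟙 (isRoot (b ∘ suc) (contraction w y))
    ≈ 𝟙 (isRoot b y) + 𝟙 (isRoot (b ∘ suc) (lower w)) * ⟦ y ≟F suc zero ⟧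
  isRoot-contraction b w zero          b0 = sym (trans (+-congˡ (zeroʳ _)) (+-identityʳ _))
  isRoot-contraction b w (suc zero)    b0 =
    sym (trans (+-cong (reflexive (≡.cong 𝟙 b0)) (*-identityʳ _)) (+-identityˡ _))
  isRoot-contraction b w (suc (suc u)) b0 = sym (trans (+-congˡ (zeroʳ _)) (+-identityʳ _))

  isRoot-lower : ∀ {l} (b : Fin (suc l) → Bool) w → b zero ≡ false →
    𝟙 (not (does (w ≟F suc zero))) * 𝟙 (isRoot (b ∘ suc) (lower w)) ≈ 𝟙 (isRoot b w)
  isRoot-lower b zero          b0 = *-identityˡ _
  isRoot-lower b (suc zero)    b0 = trans (zeroˡ _) (reflexive (≡.cong 𝟙 (≡.sym b0)))
  isRoot-lower b (suc (suc u)) b0 = *-identityˡ _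

  acyclic-suc : ∀ {l} (f : Fin (suc l) → Fin (suc (suc l))) →
    ⟦ acyclic? f ⟧ ≈ 𝟙 (not (does (f zero ≟F suc zero))) * ⟦ acyclic? (contract f) ⟧
  acyclic-suc f = ⟦⟧-× (¬? (f zero ≟F suc zero)) (acyclic? (contract f))

  module _ {n} (q : Fin n → Carrier) (Σq≈1 : sumOver (allFin n) q ≈ 1#) where
    -- Contracting the edge out of the first vertex preserves the shape of the statement.
    𝔼-acyclic : ∀ {l} (b : Fin l → Bool) (ρ : Fin n → Fin (suc l)) →
      𝔼ᶠ l q (λ G → ⟦ acyclic? (cut b ρ G) ⟧) ≈ mean (allFin n) q (λ z → 𝟙 (isRoot b (ρ z)))
    𝔼-acyclic {zero} b ρ = begin
      𝔼ᶠ 0 q (λ G → ⟦ acyclic? (cut b ρ G) ⟧)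
        ≈⟨ 𝔼ᶠ-cong 0 q (λ G → ⟦⟧-true (acyclic? (cut b ρ G)) λ { zero → root }) ⟩
      𝔼ᶠ 0 q (λ _ → 1#)                       ≈⟨ 𝔼ᶠ-const 0 q Σq≈1 1# ⟩
      1#                                      ≈⟨ mean-const (allFin n) q Σq≈1 1# ⟨
      mean (allFin n) q (λ _ → 1#)
        ≈⟨ mean-cong (allFin n) q (λ z → reflexive (≡.cong 𝟙 (isRoot-0 (ρ z)))) ⟩
      mean (allFin n) q (λ z → 𝟙 (isRoot b (ρ z))) ∎
      where
      isRoot-0 : ∀ (y : Fin 1) → true ≡ isRoot b y
      isRoot-0 zero = ≡.refl
    𝔼-acyclic {suc l} b ρ = begin
      𝔼ᶠ (suc l) q (λ G → ⟦ acyclic? (cut b ρ G) ⟧)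
        ≈⟨ 𝔼-suc {l} (λ _ → allFin n) (λ _ → q) (λ G → ⟦ acyclic? (cut b ρ G) ⟧) ⟩
      mean (allFin n) q (λ z → 𝔼ᶠ l q (λ G → ⟦ acyclic? (cut b ρ (∀-cons z G)) ⟧))
        ≈⟨ mean-cong (allFin n) q (λ z → trans
             (𝔼ᶠ-cong l q λ G → trans (acyclic-suc (cut b ρ (∀-cons z G)))
               (*-congˡ (acyclic-cong (contract-cut z G))))
             (trans (mean-*ˡ (choices {l} λ _ → allFin n) _ _ _)
               (*-congˡ (𝔼-acyclic b′ (contraction (W z) ∘ ρ))))) ⟩
      mean (allFin n) q (λ z → notLoop (W z) * R (W z))
        ≈⟨ by-first (b zero) ≡.refl ⟩
      mean (allFin n) q (λ z → 𝟙 (isRoot b (ρ z))) ∎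
      where
      b′ = λ v → b (suc v)
      W : Fin n → Fin (suc (suc l))
      W z = if b zero then zero else ρ z
      notLoop : Fin (suc (suc l)) → Carrier
      notLoop w = 𝟙 (not (does (w ≟F suc zero)))
      R : Fin (suc (suc l)) → Carrier
      R w = mean (allFin n) q (λ z → 𝟙 (isRoot b′ (contraction w (ρ z))))

      contract-cut : ∀ z G → contract (cut b ρ (∀-cons z G)) ≗ cut b′ (contraction (W z) ∘ ρ) G
      contract-cut z G v with b (suc v)
      ... | true  = ≡.refl
      ... | false = ≡.refl

      -- Q is the mass of the roots, V that of the first vertex. If the latter is not a root, it
      -- avoids a loop with mass 1 - V, and contraction raises the root mass by V when its target is
      -- a root, which has mass Q. The result is (1 - V) Q + Q V = Q.
      Q = mean (allFin n) q (λ z → 𝟙 (isRoot b (ρ z)))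
      V = mean (allFin n) q (λ z → ⟦ ρ z ≟F suc zero ⟧)

      by-first : ∀ b₀ → b zero ≡ b₀ → mean (allFin n) q (λ z → notLoop (W z) * R (W z)) ≈ Q
      by-first true b0 = begin
        mean (allFin n) q (λ z → notLoop (W z) * R (W z))
          ≈⟨ mean-cong (allFin n) q (λ z → trans
               (reflexive (≡.cong (λ c → let w = if c then zero else ρ z in notLoop w * R w) b0))
               (*-identityˡ _)) ⟩
        mean (allFin n) q (λ z → R zero)
          ≈⟨ mean-const (allFin n) q Σq≈1 (R zero) ⟩
        R zero
          ≈⟨ mean-cong (allFin n) q (λ z → isRoot-contraction-root b (ρ z) b0) ⟩
        Q ∎
      by-first false b0 = begin
        mean (allFin n) q (λ z → notLoop (W z) * R (W z))
          ≈⟨ mean-cong (allFin n) q (λ z → trans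
               (reflexive (≡.cong (λ c → let w = if c then zero else ρ z in notLoop w * R w) b0))
               (trans (*-congˡ (R-split (ρ z))) (rearrange (ρ z)))) ⟩
        mean (allFin n) q (λ z → notLoop (ρ z) * Q + 𝟙 (isRoot b (ρ z)) * V)
          ≈⟨ trans (mean-+ (allFin n) q _ _)
               (+-cong (mean-*ʳ (allFin n) q Q _) (mean-*ʳ (allFin n) q V _)) ⟩
        mean (allFin n) q (λ z → notLoop (ρ z)) * Q + Q * V
          ≈⟨ solve 3 (λ a q v → a :* q :+ q :* v := (a :+ v) :* q) refl _ _ _ ⟩
        (mean (allFin n) q (λ z → notLoop (ρ z)) + V) * Q
          ≈⟨ *-congʳ (trans (sym (mean-+ (allFin n) q _ _))
               (trans (mean-cong (allFin n) q λ z → 𝟙-not (does (ρ z ≟F suc zero)))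
                      (mean-const (allFin n) q Σq≈1 1#))) ⟩
        1# * Q ≈⟨ *-identityˡ Q ⟩
        Q ∎
        where
        R-split : ∀ w → R w ≈ Q + 𝟙 (isRoot b′ (lower w)) * V
        R-split w = trans (mean-cong (allFin n) q λ z → isRoot-contraction b w (ρ z) b0)
          (trans (mean-+ (allFin n) q _ _) (+-congˡ (mean-*ˡ (allFin n) q _ _)))

        rearrange : ∀ w → notLoop w * (Q + 𝟙 (isRoot b′ (lower w)) * V) ≈ notLoop w * Q + 𝟙 (isRoot b w) * V
        rearrange w = trans (distribˡ _ _ _)
          (+-congˡ (trans (sym (*-assoc _ _ _)) (*-congʳ (isRoot-lower b w b0))))

-- Cardinality by enumeration, and a uniform bound.

∣p∣≡1+∣p-x∣ : ∀ {m} {p : Subset m} {x} → x ∈ p → ∣ p ∣ ≡ suc ∣ p ∖ x ∣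
∣p∣≡1+∣p-x∣ {p = inside ∷ p}  here        = ≡.cong (suc ∘ ∣_∣) (≡.sym (p─⊥≡p p))
∣p∣≡1+∣p-x∣ {p = inside ∷ p}  (there x∈p) = ≡.cong suc (∣p∣≡1+∣p-x∣ x∈p)
∣p∣≡1+∣p-x∣ {p = outside ∷ p} (there x∈p) = ∣p∣≡1+∣p-x∣ x∈p

x∉p-x : ∀ {m} (p : Subset m) x → x ∉ p ∖ x
x∉p-x (inside  ∷ p) zero    ()
x∉p-x (outside ∷ p) zero    ()
x∉p-x (_       ∷ p) (suc x) (there x∈) = x∉p-x p x x∈

enumeration⇒∣p∣≡N : ∀ N {m} {p : Subset m} (g : Fin N → Fin m) →
  (∀ i j → g i ≡ g j → i ≡ j) → (∀ {v} → v ∈ p → ∃ λ j → g j ≡ v) → (∀ j → g j ∈ p) → ∣ p ∣ ≡ N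
enumeration⇒∣p∣≡N zero {m} g inj onto into =
  ≡.trans (≡.cong ∣_∣ (Empty-unique λ (v , v∈p) → case (onto v∈p))) (∣⊥∣≡0 m)
  where
  case : ∀ {v} → ¬ ∃ λ (j : Fin 0) → g j ≡ v
  case ()
enumeration⇒∣p∣≡N (suc N) {p = p} g inj onto into = ≡.trans (∣p∣≡1+∣p-x∣ (into zero))
  (≡.cong suc (enumeration⇒∣p∣≡N N (g ∘ suc)
    (λ i j e → suc-injective (inj (suc i) (suc j) e))
    onto′
    (λ j → x∈p∧x≢y⇒x∈p-y (into (suc j)) λ e → 0≢1+n (inj zero (suc j) (≡.sym e)))))
  where
  onto′ : ∀ {v} → v ∈ p ∖ g zero → ∃ λ j → g (suc j) ≡ v
  onto′ v∈ with onto (p─q⊆p p _ v∈)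
  ... | zero  , ≡.refl = ⊥-elim (x∉p-x p _ v∈)
  ... | suc j , e      = j , e

-- The sum of the individual bounds works for all v. It serves to find one time at which every orbit
-- has entered the cycle.
uniform-bound : ∀ {m} (P : Fin m → ℕ → Set) → (∀ v s {t} → P v t → P v (s ℕ.+ t)) →
                (∀ v → ∃ (P v)) → ∃ λ T → ∀ v → P v T
uniform-bound {zero}  P up ex = 0 , λ ()
uniform-bound {suc m} P up ex =
  let T , bounds = uniform-bound (P ∘ suc) (up ∘ suc) (ex ∘ suc)
      t , bound  = ex zero
  in t ℕ.+ T , λ { zero    → ≡.subst (P zero) (ℕ.+-comm T t) (up zero T bound)
                 ; (suc v) → up (suc v) t (bounds v) }

-- Orbits and limit cycles of a self-map.

insert : ∀ {m} → (Fin m → Bool) → Fin m → Fin m → Bool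
insert b z v = does (z ≟F v) ∨ b v

singleton : ∀ {m} → Fin m → Fin m → Bool
singleton = insert λ _ → false

insert-same : ∀ {m} (b : Fin m → Bool) z → insert b z z ≡ true
insert-same b z = ≡.cong (_∨ b z) (dec-true (z ≟F z) ≡.refl)

insert-⊇ : ∀ {m} (b : Fin m → Bool) z {v} → b v ≡ true → insert b z v ≡ true
insert-⊇ b z {v} bv = ≡.trans (≡.cong (does (z ≟F v) ∨_) bv) (∨-zeroʳ _)

insert⁻-true : ∀ {m} (b : Fin m → Bool) z {v} → insert b z v ≡ true → z ≡ v ⊎ b v ≡ true
insert⁻-true b z {v} e with z ≟F v
... | yes z≡v = inj₁ z≡v
... | no  _   = inj₂ e

insert⁻-false : ∀ {m} (b : Fin m → Bool) z {v} → insert b z v ≡ false → ¬ z ≡ v × b v ≡ false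
insert⁻-false b z {v} e with z ≟F v | e
... | yes _  | ()
... | no z≢v | e = z≢v , e

insert⁺-false : ∀ {m} (b : Fin m → Bool) z {v} → ¬ z ≡ v → b v ≡ false → insert b z v ≡ false
insert⁺-false b z {v} z≢v bv = ≡.trans (≡.cong (_∨ b v) (dec-false (z ≟F v) z≢v)) bv

-- The orbit of c takes exactly j further vertices outside b and then returns
-- to u, and every orbit meets b or the vertices collected on the way.
Returns : ∀ {m} → (Fin m → Fin m) → ℕ → (Fin m → Bool) → Fin m → Fin m → Set
Returns G zero    b u c = G c ≡ u × Acyclic (cut b suc G)
Returns G (suc j) b u c = b (G c) ≡ false × Returns G j (insert b (G c)) u (G c)

returns? : ∀ {m} (G : Fin m → Fin m) j b u c → Dec (Returns G j b u c)
returns? G zero    b u c = (G c ≟F u) ×-dec acyclic? (cut b suc G)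
returns? G (suc j) b u c = (b (G c) ≟B false) ×-dec returns? G j (insert b (G c)) u (G c)

cut-local : ∀ {m} {G G′ : Fin m → Fin m} {b c} → b c ≡ true → (∀ {v} → ¬ c ≡ v → G v ≡ G′ v) →
            cut b suc G ≗ cut b suc G′
cut-local {b = b} {c} bc agree v with b v in bv
... | true  = ≡.refl
... | false = ≡.cong suc (agree λ { ≡.refl → not-¬ bc bv })

-- The event reads G at c′ and at vertices outside b only, so the value at another vertex c of b is
-- free. This is the independence behind revealing one value at a time.
Returns-local : ∀ {m} {G G′ : Fin m → Fin m} j {b u c c′} → b c ≡ true → ¬ c ≡ c′ →
  (∀ {v} → ¬ c ≡ v → G v ≡ G′ v) → Returns G j b u c′ → Returns G′ j b u c′
Returns-local zero bc c≢c′ agree (e , ac) =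
  ≡.trans (≡.sym (agree c≢c′)) e , λ y → ToRoot-cong (cut-local bc agree) (ac y)
Returns-local {G = G} {G′} (suc j) {b} {u} {c} {c′} bc c≢c′ agree (bz , r) =
  ≡.subst (λ z → b z ≡ false × Returns G′ j (insert b z) u z) (agree c≢c′)
    (bz , Returns-local j (insert-⊇ b (G c′) bc) (λ { ≡.refl → not-¬ bc bz }) agree r)

module _ {m} (G : Fin m → Fin m) where
  fold-shift : ∀ c t → fold (G c) G t ≡ G (fold c G t)
  fold-shift c zero    = ≡.refl
  fold-shift c (suc t) = ≡.cong G (fold-shift c t)

  ToRoot⇒enters : ∀ b {v} → ToRoot (cut b suc G) (suc v) → ∃ λ t → b (fold v G t) ≡ true
  ToRoot⇒enters b {v} (step p) with b v in bv | p
  ... | true  | _ = 0 , bv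
  ... | false | p =
    let t , hit = ToRoot⇒enters b p
    in suc t , ≡.trans (≡.cong b (≡.sym (fold-shift v t))) hit

  enters⇒ToRoot : ∀ b {v} t → b (fold v G t) ≡ true → ToRoot (cut b suc G) (suc v)
  enters⇒ToRoot b {v} t hit = step (next-step t hit)
    where
    next-step : ∀ t → b (fold v G t) ≡ true → ToRoot (cut b suc G) (cut b suc G v)
    next-step t hit with b v in bv
    next-step t       hit | true  = root
    next-step zero    hit | false = ⊥-elim (not-¬ hit bv)
    next-step (suc t) hit | false =
      enters⇒ToRoot b t (≡.trans (≡.cong b (fold-shift v t)) hit)

  -- `Returns` restated through iterates: the recursive form suits expectations, this one the
  -- comparison with `IsCycleOn`.
  record Trail (j : ℕ) (b : Fin m → Bool) (u c : Fin m) : Set where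
    field
      closed   : fold c G (suc j) ≡ u
      fresh    : ∀ (s : Fin j) → b (fold c G (suc (toℕ s))) ≡ false
      distinct : ∀ (s t : Fin j) → fold c G (suc (toℕ s)) ≡ fold c G (suc (toℕ t)) → s ≡ t
      attracts : ∀ v → ∃ λ t → b (fold v G t) ≡ true
                             ⊎ ∃ λ (s : Fin j) → fold c G (suc (toℕ s)) ≡ fold v G t

  Returns⇒Trail : ∀ j b u c → Returns G j b u c → Trail j b u c
  Returns⇒Trail zero b u c (e , ac) = record
    { closed   = e
    ; fresh    = λ ()
    ; distinct = λ ()
    ; attracts = λ v → let t , hit = ToRoot⇒enters b (ac (suc v)) in t , inj₁ hit
    }
  Returns⇒Trail (suc j) b u c (bz , r) = record
    { closed   = ≡.trans (shift j) T.closed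
    ; fresh    = λ { zero → bz
                   ; (suc s) → ≡.trans (≡.cong b (shift (toℕ s))) (proj₂ (insert⁻-false b z (T.fresh s))) }
    ; distinct = distinct
    ; attracts = λ v → let t , hit = T.attracts v in t , attracts hit
    }
    where
    z = G c
    module T = Trail (Returns⇒Trail j (insert b z) u z r)
    shift : ∀ s → fold c G (suc (suc s)) ≡ fold z G (suc s)
    shift s = ≡.sym (fold-shift c (suc s))
    distinct : ∀ (s t : Fin (suc j)) → fold c G (suc (toℕ s)) ≡ fold c G (suc (toℕ t)) → s ≡ t
    distinct zero    zero    e = ≡.refl
    distinct zero    (suc t) e = ⊥-elim (proj₁ (insert⁻-false b z (T.fresh t)) (≡.trans e (shift (toℕ t))))
    distinct (suc s) zero    e = ⊥-elim (proj₁ (insert⁻-false b z (T.fresh s)) (≡.trans (≡.sym e) (shift (toℕ s))))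
    distinct (suc s) (suc t) e = ≡.cong suc
      (T.distinct s t (≡.trans (≡.sym (shift (toℕ s))) (≡.trans e (shift (toℕ t)))))
    attracts : ∀ {y} → insert b z y ≡ true ⊎ (∃ λ (s : Fin j) → fold z G (suc (toℕ s)) ≡ y) →
               b y ≡ true ⊎ ∃ λ (s : Fin (suc j)) → fold c G (suc (toℕ s)) ≡ y
    attracts (inj₂ (s , e)) = inj₂ (suc s , ≡.trans (shift (toℕ s)) e)
    attracts (inj₁ hit) with insert⁻-true b z hit
    ... | inj₁ z≡y = inj₂ (zero , z≡y)
    ... | inj₂ by  = inj₁ by

  Trail⇒Returns : ∀ j b u c → Trail j b u c → Returns G j b u c
  Trail⇒Returns zero b u c trail = closed , acyclic
    where
    open Trail trail
    enters : ∀ v → ∃ λ t → b (fold v G t) ≡ true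
    enters v with attracts v
    ... | t , inj₁ hit = t , hit
    acyclic : Acyclic (cut b suc G)
    acyclic zero    = root
    acyclic (suc v) = let t , hit = enters v in enters⇒ToRoot b t hit
  Trail⇒Returns (suc j) b u c trail = fresh zero , Trail⇒Returns j (insert b z) u z (record
    { closed   = ≡.trans (shift j) closed
    ; fresh    = λ s → insert⁺-false b z
        (λ e → 0≢1+n (distinct zero (suc s) (≡.trans e (shift (toℕ s)))))
        (≡.trans (≡.cong b (shift (toℕ s))) (fresh (suc s)))
    ; distinct = λ s t e → suc-injective (distinct (suc s) (suc t)
        (≡.trans (≡.sym (shift (toℕ s))) (≡.trans e (shift (toℕ t)))))
    ; attracts = λ v → let t , hit = attracts v in t , attracts′ hit
    })
    where
    open Trail trail
    z = G c
    shift : ∀ s → fold z G (suc s) ≡ fold c G (suc (suc s))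
    shift s = fold-shift c (suc s)
    attracts′ : ∀ {y} → b y ≡ true ⊎ (∃ λ (s : Fin (suc j)) → fold c G (suc (toℕ s)) ≡ y) →
                insert b z y ≡ true ⊎ ∃ λ (s : Fin j) → fold z G (suc (toℕ s)) ≡ y
    attracts′ (inj₁ by)              = inj₁ (insert-⊇ b z by)
    attracts′ (inj₂ (zero , ≡.refl)) = inj₁ (insert-same b z)
    attracts′ (inj₂ (suc s , e))     = inj₂ (s , ≡.trans (shift (toℕ s)) e)

  -- Attraction of every orbit to u stands in for the stabilisation of the iterated images: it
  -- leaves room for no other cycle.
  record OnLimitCycle (N : ℕ) (u : Fin m) : Set where
    field
      distinct : ∀ (i j : Fin N) → fold u G (toℕ i) ≡ fold u G (toℕ j) → i ≡ j
      closed   : fold u G N ≡ u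
      attracts : ∀ v → ∃ λ t → fold v G t ≡ u

  Trail⇒OnLimitCycle : ∀ {N u} → Trail N (singleton u) u u → OnLimitCycle (suc N) u
  Trail⇒OnLimitCycle {N} {u} trail = record
    { distinct = distinct′
    ; closed   = closed
    ; attracts = λ v → let t , hit = attracts v in reaches v t hit
    }
    where
    open Trail trail
    u≢ : ∀ s → ¬ u ≡ fold u G (suc (toℕ s))
    u≢ s = proj₁ (insert⁻-false (λ _ → false) u (fresh s))
    distinct′ : ∀ (i j : Fin (suc N)) → fold u G (toℕ i) ≡ fold u G (toℕ j) → i ≡ j
    distinct′ zero    zero    e = ≡.refl
    distinct′ zero    (suc j) e = ⊥-elim (u≢ j e)
    distinct′ (suc i) zero    e = ⊥-elim (u≢ i (≡.sym e))
    distinct′ (suc i) (suc j) e = ≡.cong suc (distinct i j e)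
    reaches : ∀ v t → singleton u (fold v G t) ≡ true ⊎ (∃ λ (s : Fin N) → fold u G (suc (toℕ s)) ≡ fold v G t) →
              ∃ λ t → fold v G t ≡ u
    reaches v t (inj₁ hit) with insert⁻-true (λ _ → false) u hit
    ... | inj₁ u≡ = t , ≡.sym u≡
    -- The orbit meets the cycle s + 1 steps after u, so N - s more steps complete the turn of
    -- length N + 1.
    reaches v t (inj₂ (s , e)) = N ∸ toℕ s ℕ.+ t , (begin
      fold v G (N ∸ toℕ s ℕ.+ t)                 ≡⟨ fold-+ v G (N ∸ toℕ s) ⟩
      fold (fold v G t) G (N ∸ toℕ s)            ≡⟨ ≡.cong (λ y → fold y G (N ∸ toℕ s)) (≡.sym e) ⟩
      fold (fold u G (suc (toℕ s))) G (N ∸ toℕ s) ≡⟨ ≡.sym (fold-+ u G (N ∸ toℕ s)) ⟩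
      fold u G (N ∸ toℕ s ℕ.+ suc (toℕ s))
        ≡⟨ ≡.cong (fold u G) (≡.trans (ℕ.+-suc (N ∸ toℕ s) (toℕ s))
             (≡.cong suc (ℕ.m∸n+n≡m (ℕ.<⇒≤ (toℕ<n s))))) ⟩
      fold u G (suc N)                           ≡⟨ closed ⟩
      u                                          ∎)
      where open ≡.≡-Reasoning

  OnLimitCycle⇒Trail : ∀ {N u} → OnLimitCycle (suc N) u → Trail N (singleton u) u u
  OnLimitCycle⇒Trail {N} {u} onCycle = record
    { closed   = closed
    ; fresh    = λ s → insert⁺-false (λ _ → false) u (λ e → 0≢1+n (distinct zero (suc s) e)) ≡.refl
    ; distinct = λ s t e → suc-injective (distinct (suc s) (suc t) e)
    ; attracts = λ v → let t , e = attracts v in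
        t , inj₁ (≡.trans (≡.cong (singleton u) e) (insert-same (λ _ → false) u))
    }
    where
    open OnLimitCycle onCycle

  iteratedImage⁺ : ∀ t v → fold v G t ∈ iteratedImage G t
  iteratedImage⁺ zero    v = ∈⊤
  iteratedImage⁺ (suc t) v = ∈-image⁺ G (iteratedImage⁺ t v)

  iteratedImage⁻ : ∀ t {v} → v ∈ iteratedImage G t → ∃ λ v₀ → fold v₀ G t ≡ v
  iteratedImage⁻ zero    {v} _ = v , ≡.refl
  iteratedImage⁻ (suc t) v∈ with ∈-image⁻ G v∈
  ... | y , y∈ , ≡.refl = let v₀ , e = iteratedImage⁻ t y∈ in v₀ , ≡.cong G e

  module _ {N u} (onCycle : OnLimitCycle (suc N) u) where
    open OnLimitCycle onCycle

    orbit⊆iteratedImage : ∀ t i → fold u G i ∈ iteratedImage G t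
    orbit⊆iteratedImage zero    i = ∈⊤
    -- On a cycle of length N + 1 the predecessor of iterate i is iterate i + N.
    orbit⊆iteratedImage (suc t) i = ≡.subst (_∈ iteratedImage G (suc t)) period
      (∈-image⁺ G (orbit⊆iteratedImage t (i ℕ.+ N)))
      where
      period : fold u G (suc (i ℕ.+ N)) ≡ fold u G i
      period = ≡.trans (≡.cong (fold u G) (≡.sym (ℕ.+-suc i N)))
        (≡.trans (fold-+ u G i) (≡.cong (λ y → fold y G i) closed))

    orbit-finite : ∀ i → ∃ λ (j : Fin (suc N)) → fold u G (toℕ j) ≡ fold u G i
    orbit-finite zero = zero , ≡.refl
    orbit-finite (suc i) with orbit-finite i
    ... | j , e with ℕ.m≤n⇒m<n∨m≡n (toℕ<n j)
    ...   | inj₁ 1+j<1+N = fromℕ< 1+j<1+N ,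
              ≡.trans (≡.cong (fold u G) (toℕ-fromℕ< 1+j<1+N)) (≡.cong G e)
    ...   | inj₂ 1+j≡1+N = zero ,
              ≡.trans (≡.sym closed) (≡.trans (≡.cong (fold u G) (≡.sym 1+j≡1+N)) (≡.cong G e))

    limit : Subset m
    limit = iteratedImage G (suc m)

    limit⊆orbit : ∀ {v} → v ∈ limit → ∃ λ (j : Fin (suc N)) → fold u G (toℕ j) ≡ v
    limit⊆orbit {v} v∈ =
      let T , bound = uniform-bound (λ v t → ∃ λ i → fold v G t ≡ fold u G i)
                        (λ v s {t} (i , e) → s ℕ.+ i ,
                           ≡.trans (fold-+ v G s) (≡.trans (≡.cong (λ y → fold y G s) e) (≡.sym (fold-+ u G s))))
                        (λ v → let t , e = attracts v in t , 0 , e)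
          -- The iterated images are constant from `suc m` on, so v is also reached after T + suc m
          -- steps, and the last T of them already lead into the orbit of u.
          v₁ , e    = iteratedImage⁻ (T ℕ.+ suc m) (≡.subst (v ∈_) (≡.sym (constant-after G T)) v∈)
          i , e′    = bound (fold v₁ G (suc m))
          j , e″    = orbit-finite i
      in j , ≡.trans e″ (≡.trans (≡.sym e′) (≡.trans (≡.sym (fold-+ v₁ G T)) e))

    OnLimitCycle⇒ : ∃ λ S → (StabilizesTo G S × ∣ S ∣ ≡ suc N × ActsAsCycle G (suc N) S) × u ∈ S
    OnLimitCycle⇒ = limit , (stabilizes G
      , enumeration⇒∣p∣≡N (suc N) (λ j → fold u G (toℕ j)) distinct limit⊆orbit
          (λ j → orbit⊆iteratedImage (suc m) (toℕ j))
      , u , record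
        { distinct = distinct
        ; support  = λ v → mk⇔ limit⊆orbit (λ { (j , ≡.refl) → orbit⊆iteratedImage (suc m) (toℕ j) })
        ; closed   = closed
        }) , orbit⊆iteratedImage (suc m) 0

  OnLimitCycle⇐ : ∀ {N S v₀ u} → StabilizesTo G S → IsCycleOn G N S v₀ → u ∈ S → OnLimitCycle N u
  OnLimitCycle⇐ {N} {S} {v₀} {u} (M , toS) cyc u∈S with Equivalence.to (IsCycleOn.support cyc u) u∈S
  ... | j , ≡.refl = record
    -- Another N - j steps turn the iterates of u into those of v₀, where distinctness is known.
    { distinct = λ s t e → distinct s t (≡.trans (≡.sym (return (toℕ s)))
        (≡.trans (≡.cong (λ y → fold y G (N ∸ toℕ j)) e) (return (toℕ t))))
    ; closed   = ≡.trans (swap N (toℕ j)) (≡.cong (λ y → fold y G (toℕ j)) closed)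
    ; attracts = attracts
    }
    where
    open IsCycleOn cyc
    open ≡.≡-Reasoning
    swap : ∀ s t → fold (fold v₀ G t) G s ≡ fold (fold v₀ G s) G t
    swap s t = ≡.trans (≡.sym (fold-+ v₀ G s)) (≡.trans (≡.cong (fold v₀ G) (ℕ.+-comm s t)) (fold-+ v₀ G t))
    complete : ∀ (i : Fin N) → fold (fold v₀ G (toℕ i)) G (N ∸ toℕ i) ≡ v₀
    complete i = ≡.trans (≡.sym (fold-+ v₀ G (N ∸ toℕ i)))
      (≡.trans (≡.cong (fold v₀ G) (ℕ.m∸n+n≡m (ℕ.<⇒≤ (toℕ<n i)))) closed)
    return : ∀ s → fold (fold (fold v₀ G (toℕ j)) G s) G (N ∸ toℕ j) ≡ fold v₀ G s
    return s = begin
      fold (fold (fold v₀ G (toℕ j)) G s) G (N ∸ toℕ j) ≡⟨ fold-+ _ G (N ∸ toℕ j) ⟨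
      fold (fold v₀ G (toℕ j)) G (N ∸ toℕ j ℕ.+ s)      ≡⟨ ≡.cong (fold _ G) (ℕ.+-comm (N ∸ toℕ j) s) ⟩
      fold (fold v₀ G (toℕ j)) G (s ℕ.+ (N ∸ toℕ j))    ≡⟨ fold-+ _ G s ⟩
      fold (fold (fold v₀ G (toℕ j)) G (N ∸ toℕ j)) G s ≡⟨ ≡.cong (λ y → fold y G s) (complete j) ⟩
      fold v₀ G s                                       ∎
    attracts : ∀ v → ∃ λ t → fold v G t ≡ fold v₀ G (toℕ j)
    attracts v with Equivalence.to (support _) (≡.subst (fold v G M ∈_) (toS M ℕ.≤-refl) (iteratedImage⁺ M v))
    -- M steps lead into S at position i, N - i more lead to v₀, and j more to u.
    ... | i , e = toℕ j ℕ.+ (N ∸ toℕ i ℕ.+ M) , (begin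
      fold v G (toℕ j ℕ.+ (N ∸ toℕ i ℕ.+ M))                   ≡⟨ fold-+ v G (toℕ j) ⟩
      fold (fold v G (N ∸ toℕ i ℕ.+ M)) G (toℕ j)              ≡⟨ ≡.cong (λ y → fold y G (toℕ j)) (fold-+ v G (N ∸ toℕ i)) ⟩
      fold (fold (fold v G M) G (N ∸ toℕ i)) G (toℕ j)         ≡⟨ ≡.cong (λ y → fold (fold y G (N ∸ toℕ i)) G (toℕ j)) e ⟨
      fold (fold (fold v₀ G (toℕ i)) G (N ∸ toℕ i)) G (toℕ j)  ≡⟨ ≡.cong (λ y → fold y G (toℕ j)) (complete i) ⟩
      fold v₀ G (toℕ j)                                        ∎)

  -- `Returns` counts the vertices after u, hence N there against the cycle length suc N.
  Returns⇔OnLimitCycle : ∀ {N u} → Returns G N (singleton u) u u ⇔ OnLimitCycle (suc N) u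
  Returns⇔OnLimitCycle = mk⇔ (Trail⇒OnLimitCycle ∘ Returns⇒Trail _ _ _ _)
                             (Trail⇒Returns _ _ _ _ ∘ OnLimitCycle⇒Trail)

module _ {m} {G H : Fin m → Fin m} (G≗H : G ≗ H) where
  fold-cong : ∀ v t → fold v G t ≡ fold v H t
  fold-cong v zero    = ≡.refl
  fold-cong v (suc t) = ≡.trans (G≗H _) (≡.cong H (fold-cong v t))

  OnLimitCycle-cong : ∀ {N u} → OnLimitCycle G N u → OnLimitCycle H N u
  OnLimitCycle-cong {N} {u} onCycle = record
    { distinct = λ i j e → distinct i j (≡.trans (fold-cong u (toℕ i)) (≡.trans e (≡.sym (fold-cong u (toℕ j)))))
    ; closed   = ≡.trans (≡.sym (fold-cong u N)) closed
    ; attracts = λ v → let t , e = attracts v in t , ≡.trans (≡.sym (fold-cong v t)) e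
    }
    where open OnLimitCycle onCycle

  -- The detour through `OnLimitCycle` compares only iterates of single vertices, for which
  -- pointwise equality of the maps is enough.
  EventuallyCyclicMap-cong : ∀ {N} → EventuallyCyclicMap (suc N) G → EventuallyCyclicMap (suc N) H
  EventuallyCyclicMap-cong (S , st , ∣S∣≡N , v , cyc) =
    let v∈S = Equivalence.from (IsCycleOn.support cyc v) (zero , ≡.refl)
        T , ec , _ = OnLimitCycle⇒ H (OnLimitCycle-cong (OnLimitCycle⇐ G st cyc v∈S))
    in T , ec

-- The probability of a limit cycle of given length.

module LimitCycles (K : Field) where
  open Field K hiding (zero)
  open Expressions K
  open FiniteSums K
  open SymmetricFunctions K
  open Expectation K
  open Forests K
  open Solver commutativeSemiring using (solve; _:=_; _:+_; _:*_; con)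
  open SetoidReasoning setoid

  masked : ∀ {m} → (Fin m → Carrier) → (Fin m → Bool) → Fin m → Carrier
  masked q b v = if b v then 0# else q v

  masked-insert : ∀ {m} (q : Fin m → Carrier) b z v → masked q (insert b z) v ≈ zeroed (masked q b) z v
  masked-insert q b z v with does (z ≟F v)
  ... | true  = refl
  ... | false = refl

  masked-𝟙 : ∀ {m} (q : Fin m → Carrier) b v → masked q b v ≈ q v * 𝟙 (not (b v))
  masked-𝟙 q b v with b v
  ... | true  = sym (zeroʳ _)
  ... | false = sym (*-identityʳ _)

  returns-update-zero : ∀ {m} (G : Fin m → Fin m) b u c x → b c ≡ true →
    ⟦ returns? (update G c x) 0 b u c ⟧ ≈ ⟦ u ≟F x ⟧ * ⟦ acyclic? (cut b suc G) ⟧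
  returns-update-zero G b u c x bc = trans
    (⟦⟧-cong (returns? (update G c x) 0 b u c) ((u ≟F x) ×-dec acyclic? (cut b suc G))
      (λ (e , ac) → ≡.trans (≡.sym e) (update-same G c x) , λ y → ToRoot-cong (cut-local bc agree) (ac y))
      (λ (e , ac) → ≡.trans (update-same G c x) (≡.sym e) ,
                    λ y → ToRoot-cong (cut-local bc (≡.sym ∘ agree)) (ac y)))
    (⟦⟧-× (u ≟F x) (acyclic? (cut b suc G)))
    where
    agree : ∀ {v} → ¬ c ≡ v → update G c x v ≡ G v
    agree = update-other G c x

  returns-update-suc : ∀ {m} (G : Fin m → Fin m) j b u c x → b c ≡ true →
    ⟦ returns? (update G c x) (suc j) b u c ⟧ ≈ 𝟙 (not (b x)) * ⟦ returns? G j (insert b x) u x ⟧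
  returns-update-suc G j b u c x bc = trans
    (⟦⟧-cong (returns? (update G c x) (suc j) b u c) ((b x ≟B false) ×-dec returns? G j (insert b x) u x)
      (λ r → let bx , r′ = ≡.subst (P (update G c x)) (update-same G c x) r
             in bx , local bx (update-other G c x) r′)
      (λ (bx , r) → ≡.subst (P (update G c x)) (≡.sym (update-same G c x))
                      (bx , local bx (≡.sym ∘ update-other G c x) r)))
    (trans (⟦⟧-× (b x ≟B false) (returns? G j (insert b x) u x)) (*-congʳ (false? (b x))))
    where
    P : (Fin _ → Fin _) → Fin _ → Set
    P H z = b z ≡ false × Returns H j (insert b z) u z
    local : b x ≡ false → ∀ {H H′ : Fin _ → Fin _} → (∀ {v} → ¬ c ≡ v → H v ≡ H′ v) →
            Returns H j (insert b x) u x → Returns H′ j (insert b x) u x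
    local bx = Returns-local j (insert-⊇ b x bc) (λ { ≡.refl → not-¬ bc bx })
    false? : ∀ b₀ → ⟦ b₀ ≟B false ⟧ ≈ 𝟙 (not b₀)
    false? true  = refl
    false? false = refl

  module _ {m} (q : Fin m → Carrier) (Σq≈1 : sumOver (allFin m) q ≈ 1#) where
    -- The return to u costs q u, and the letters of the word are drawn outside b; the mass of the
    -- completed word is 1 minus that of one further letter, which gives d_j - d_{j+1} for the
    -- masked law. The form without subtraction keeps the induction within semiring identities.
    𝔼-returns : ∀ j b u c → b c ≡ true →
      𝔼ᶠ m q (λ G → ⟦ returns? G j b u c ⟧) + q u * d (suc j) (masked q b) ≈ q u * d j (masked q b)
    𝔼-returns zero b u c bc = begin
      𝔼ᶠ m q (λ G → ⟦ returns? G 0 b u c ⟧) + q u * d 1 (masked q b)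
        ≈⟨ +-congʳ (𝔼ᶠ-resample m q Σq≈1 c (λ G → ⟦ returns? G 0 b u c ⟧)) ⟩
      mean (allFin m) q (λ x → 𝔼ᶠ m q (λ G → ⟦ returns? (update G c x) 0 b u c ⟧)) + q u * d 1 (masked q b)
        ≈⟨ +-congʳ (mean-cong (allFin m) q λ x → trans
             (𝔼ᶠ-cong m q λ G → returns-update-zero G b u c x bc)
             (trans (mean-*ˡ (choices {m} λ _ → allFin m) _ _ _)
               (trans (*-congˡ (𝔼-acyclic q Σq≈1 b suc)) (*-comm _ _)))) ⟩
      mean (allFin m) q (λ x → A * ⟦ u ≟F x ⟧) + q u * d 1 (masked q b)
        ≈⟨ +-congʳ (trans (Σ-cong (allFin m) λ x → sym (*-assoc _ _ _)) (Σ-δ u (λ x → q x * A))) ⟩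
      q u * A + q u * d 1 (masked q b)
        ≈⟨ distribˡ _ _ _ ⟨
      q u * (A + d 1 (masked q b))
        -- A is the mass of b, and `d 1` of the masked law is the mass of its complement.
        ≈⟨ *-congˡ (trans (+-congˡ (Σ-cong (allFin m) λ v → trans (*-identityʳ _) (masked-𝟙 q b v)))
             (trans (sym (mean-+ (allFin m) q (λ v → 𝟙 (b v)) (λ v → 𝟙 (not (b v)))))
             (trans (mean-cong (allFin m) q λ v → trans (+-comm _ _) (𝟙-not (b v)))
                    (mean-const (allFin m) q Σq≈1 1#)))) ⟩
      q u * 1# ∎
      where A = mean (allFin m) q (λ z → 𝟙 (b z))
    𝔼-returns (suc j) b u c bc = begin
      𝔼ᶠ m q (λ G → ⟦ returns? G (suc j) b u c ⟧) + q u * d (2 ℕ.+ j) g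
        ≈⟨ +-cong
             (trans (𝔼ᶠ-resample m q Σq≈1 c (λ G → ⟦ returns? G (suc j) b u c ⟧))
               (mean-cong (allFin m) q λ x → trans
                 (𝔼ᶠ-cong m q λ G → returns-update-suc G j b u c x bc)
                 (mean-*ˡ (choices {m} λ _ → allFin m) _ (𝟙 (not (b x))) _)))
             (trans (*-congˡ (d-masked (suc j))) (sym (mean-*ˡ (allFin m) q _ _))) ⟩
      mean (allFin m) q (λ x → 𝟙 (not (b x)) * E x)
        + mean (allFin m) q (λ x → q u * (𝟙 (not (b x)) * d (suc j) (masked q (insert b x))))
        ≈⟨ mean-+ (allFin m) q _ _ ⟨
      mean (allFin m) q (λ x → 𝟙 (not (b x)) * E x
                               + q u * (𝟙 (not (b x)) * d (suc j) (masked q (insert b x))))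
        ≈⟨ mean-cong (allFin m) q (λ x → trans
             (solve 4 (λ i e q d → i :* e :+ q :* (i :* d) := i :* (e :+ q :* d)) refl
               (𝟙 (not (b x))) (E x) (q u) (d (suc j) (masked q (insert b x))))
             (trans (*-congˡ (𝔼-returns j (insert b x) u x (insert-same b x)))
               (solve 3 (λ i q d → i :* (q :* d) := q :* (i :* d)) refl
                 (𝟙 (not (b x))) (q u) (d j (masked q (insert b x)))))) ⟩
      mean (allFin m) q (λ x → q u * (𝟙 (not (b x)) * d j (masked q (insert b x))))
        ≈⟨ trans (mean-*ˡ (allFin m) q _ _) (*-congˡ (sym (d-masked j))) ⟩
      q u * d (suc j) g ∎
      where
      g = masked q b
      E : Fin m → Carrier
      E x = 𝔼ᶠ m q (λ G → ⟦ returns? G j (insert b x) u x ⟧)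
      d-masked : ∀ i → d (suc i) g ≈ mean (allFin m) q (λ x → 𝟙 (not (b x)) * d i (masked q (insert b x)))
      d-masked i = Σ-cong (allFin m) λ x → trans
        (*-cong (masked-𝟙 q b x) (d-cong i λ v → sym (masked-insert q b x v)))
        (*-assoc _ _ _)

  Σ-∈ : ∀ {m} (S : Subset m) → (Σ[ u ← allFin m ] ⟦ u ∈? S ⟧) ≈ fromℕ ∣ S ∣
  Σ-∈ []            = refl
  Σ-∈ {suc m} (inside  ∷ S) = trans (Σ-suc m λ u → ⟦ u ∈? (inside ∷ S) ⟧) (+-congˡ (Σ-∈ S))
  Σ-∈ {suc m} (outside ∷ S) = trans (Σ-suc m λ u → ⟦ u ∈? (outside ∷ S) ⟧) (trans (+-identityˡ _) (Σ-∈ S))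

  -- The starting vertices u that satisfy `Returns` are exactly the elements of the stable set, so a
  -- map with a limit cycle of length N + 1 is counted N + 1 times.
  N*EventuallyCyclicMap : ∀ N {m} (G : Fin m → Fin m) →
    (ec? : Dec (EventuallyCyclicMap (suc N) G)) →
    fromℕ (suc N) * ⟦ ec? ⟧ ≈ (Σ[ u ← allFin m ] ⟦ returns? G N (singleton u) u u ⟧)
  N*EventuallyCyclicMap N {m} G (yes (S , st , ∣S∣≡1+N , v , cyc)) = begin
    fromℕ (suc N) * 1#  ≈⟨ *-identityʳ _ ⟩
    fromℕ (suc N)       ≈⟨ reflexive (≡.cong fromℕ ∣S∣≡1+N) ⟨
    fromℕ ∣ S ∣         ≈⟨ Σ-∈ S ⟨
    (Σ[ u ← allFin m ] ⟦ u ∈? S ⟧)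
      ≈⟨ Σ-cong (allFin m) (λ u → ⟦⟧-cong (u ∈? S) (returns? G N (singleton u) u u)
           (λ u∈S → Equivalence.from (Returns⇔OnLimitCycle G) (OnLimitCycle⇐ G st cyc u∈S))
           (λ r → let T , (st′ , _) , u∈T = OnLimitCycle⇒ G (Equivalence.to (Returns⇔OnLimitCycle G) r)
                  in ≡.subst (u ∈_) (stable-unique G st′ st) u∈T)) ⟩
    (Σ[ u ← allFin m ] ⟦ returns? G N (singleton u) u u ⟧) ∎
  N*EventuallyCyclicMap N {m} G (no ¬ec) = begin
    fromℕ (suc N) * 0#  ≈⟨ zeroʳ _ ⟩
    0#                  ≈⟨ Σ-zero (allFin m) ⟨
    (Σ[ u ← allFin m ] 0#)
      ≈⟨ Σ-cong (allFin m) (λ u → ⟦⟧-false (returns? G N (singleton u) u u) (λ r →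
           let T , ec , _ = OnLimitCycle⇒ G (Equivalence.to (Returns⇔OnLimitCycle G) r) in ¬ec (T , ec))) ⟨
    (Σ[ u ← allFin m ] ⟦ returns? G N (singleton u) u u ⟧) ∎

  𝔼-eventuallyCyclicMap : ∀ N {m} (q : Fin m → Carrier) → sumOver (allFin m) q ≈ 1# →
    fromℕ (suc N) * 𝔼ᶠ m q (λ G → ⟦ eventuallyCyclicMap? G (suc N) ⟧) + d (2 ℕ.+ N) q ≈ d (suc N) q
  𝔼-eventuallyCyclicMap N {m} q Σq≈1 = begin
    fromℕ (suc N) * 𝔼ᶠ m q (λ G → ⟦ eventuallyCyclicMap? G (suc N) ⟧) + d (2 ℕ.+ N) q
      ≈⟨ +-congʳ (trans (sym (mean-*ˡ (choices {m} λ _ → allFin m) _ _ _))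
           (trans (𝔼ᶠ-cong m q λ G → N*EventuallyCyclicMap N G (eventuallyCyclicMap? G (suc N)))
                  (mean-Σ (choices {m} λ _ → allFin m) _ (allFin m) λ G u → ⟦ returns? G N (singleton u) u u ⟧))) ⟩
    (Σ[ u ← allFin m ] 𝔼ᶠ m q (λ G → ⟦ returns? G N (singleton u) u u ⟧))
      + (Σ[ u ← allFin m ] q u * d (suc N) (zeroed q u))
      ≈⟨ Σ-+ (allFin m) _ _ ⟨
    (Σ[ u ← allFin m ] 𝔼ᶠ m q (λ G → ⟦ returns? G N (singleton u) u u ⟧) + q u * d (suc N) (zeroed q u))
      ≈⟨ Σ-cong (allFin m) (λ u → trans (+-congˡ (*-congˡ (d-singleton (suc N) u)))
           (trans (𝔼-returns q Σq≈1 N (singleton u) u u (insert-same (λ _ → false) u))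
                  (*-congˡ (sym (d-singleton N u))))) ⟩
    d (suc N) q ∎
    where
    d-singleton : ∀ i u → d i (zeroed q u) ≈ d i (masked q (singleton u))
    d-singleton i u = d-cong i λ v → sym (masked-insert q (λ _ → false) u v)

-- Cyclic indices and composites of consecutive maps.

module _ {k : ℕ} .{{_ : NonZero k}} where
  private
    %-absorbˡ : ∀ a b → (a % k ℕ.+ b) % k ≡ (a ℕ.+ b) % k
    %-absorbˡ a b = begin
      (a % k ℕ.+ b) % k             ≡⟨ %-distribˡ-+ (a % k) b k ⟩
      (a % k % k ℕ.+ b % k) % k     ≡⟨ ≡.cong (λ s → (s ℕ.+ b % k) % k) (m%n%n≡m%n a k) ⟩
      (a % k ℕ.+ b % k) % k         ≡⟨ %-distribˡ-+ a b k ⟨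
      (a ℕ.+ b) % k                 ∎
      where open ≡.≡-Reasoning

    full-turn : ∀ (i : Fin k) → (toℕ i ℕ.+ k) % k ≡ toℕ i
    full-turn i = ≡.trans ([m+n]%n≡m%n (toℕ i) k) (m<n⇒m%n≡m (toℕ<n i))

    suc-pred : suc (k ∸ 1) ≡ k
    suc-pred = ℕ.suc-pred k

    toℕ-next : ∀ (i : Fin k) → toℕ (next i) ≡ suc (toℕ i) % k
    toℕ-next i = toℕ-fromℕ< (m%n<n (suc (toℕ i)) k)

    toℕ-prev : ∀ (i : Fin k) → toℕ (prev i) ≡ (toℕ i ℕ.+ (k ∸ 1)) % k
    toℕ-prev i = toℕ-fromℕ< (m%n<n (toℕ i ℕ.+ (k ∸ 1)) k)

  next-prev : ∀ (i : Fin k) → next (prev i) ≡ i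
  next-prev i = toℕ-injective (begin
    toℕ (next (prev i))                        ≡⟨ toℕ-next (prev i) ⟩
    suc (toℕ (prev i)) % k                     ≡⟨ ≡.cong (_% k) (≡.trans (≡.cong suc (toℕ-prev i)) (ℕ.+-comm 1 _)) ⟩
    ((toℕ i ℕ.+ (k ∸ 1)) % k ℕ.+ 1) % k        ≡⟨ %-absorbˡ (toℕ i ℕ.+ (k ∸ 1)) 1 ⟩
    (toℕ i ℕ.+ (k ∸ 1) ℕ.+ 1) % k
      ≡⟨ ≡.cong (_% k) (≡.trans (ℕ.+-assoc (toℕ i) (k ∸ 1) 1)
           (≡.cong (toℕ i ℕ.+_) (≡.trans (ℕ.+-comm (k ∸ 1) 1) suc-pred))) ⟩
    (toℕ i ℕ.+ k) % k                          ≡⟨ full-turn i ⟩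
    toℕ i                                      ∎)
    where open ≡.≡-Reasoning

  prev-next : ∀ (i : Fin k) → prev (next i) ≡ i
  prev-next i = toℕ-injective (begin
    toℕ (prev (next i))                        ≡⟨ toℕ-prev (next i) ⟩
    (toℕ (next i) ℕ.+ (k ∸ 1)) % k             ≡⟨ ≡.cong (λ s → (s ℕ.+ (k ∸ 1)) % k) (toℕ-next i) ⟩
    (suc (toℕ i) % k ℕ.+ (k ∸ 1)) % k          ≡⟨ %-absorbˡ (suc (toℕ i)) (k ∸ 1) ⟩
    (suc (toℕ i) ℕ.+ (k ∸ 1)) % k
      ≡⟨ ≡.cong (_% k) (≡.trans (≡.sym (ℕ.+-suc (toℕ i) (k ∸ 1)))
           (≡.cong (toℕ i ℕ.+_) suc-pred)) ⟩
    (toℕ i ℕ.+ k) % k                          ≡⟨ full-turn i ⟩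
    toℕ i                                      ∎)
    where open ≡.≡-Reasoning

  next^-toℕ : ∀ (i : Fin k) → fold first next (toℕ i) ≡ i
  next^-toℕ i = toℕ-injective (≡.trans (toℕ-next^ (toℕ i)) (m<n⇒m%n≡m (toℕ<n i)))

  next^-injective : ∀ {s t} → s ℕ.< k → t ℕ.< k → fold first next s ≡ fold first next t → s ≡ t
  next^-injective {s} {t} s<k t<k e = begin
    s                          ≡⟨ m<n⇒m%n≡m s<k ⟨
    s % k                      ≡⟨ toℕ-next^ s ⟨
    toℕ (fold first next s)    ≡⟨ ≡.cong toℕ e ⟩
    toℕ (fold first next t)    ≡⟨ toℕ-next^ t ⟩
    t % k                      ≡⟨ m<n⇒m%n≡m t<k ⟩
    t                          ∎
    where open ≡.≡-Reasoning

  module _ {n : Fin k → ℕ} where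
    -- The composite of the last l maps, where l + t ≡ k.
    tail : Tuple n → ∀ l t → l ℕ.+ t ≡ k → Fin (n (fold first next t)) → Fin (n first)
    tail f zero    t e v = ≡.subst (Fin ∘ n) next^k-first (≡.subst (Fin ∘ n ∘ fold first next) e v)
    tail f (suc l) t e v = tail f l (suc t) (≡.trans (ℕ.+-suc l t) e) (f (fold first next t) v)

    tail-walk : ∀ (f : Tuple n) l t e v → tail f l t e (walk f t v) ≡ composite f v
    tail-walk f zero    t ≡.refl v = ≡.refl
    tail-walk f (suc l) t e      v = tail-walk f l (suc t) (≡.trans (ℕ.+-suc l t) e) v

    tail-local : ∀ {f f′ : Tuple n} l t e →
      (∀ s → t ≤ s → s ℕ.< k → f (fold first next s) ≡ f′ (fold first next s)) →
      tail f l t e ≗ tail f′ l t e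
    tail-local zero    t e agree v = ≡.refl
    tail-local {f} {f′} (suc l) t e agree v = ≡.trans
      (tail-local l (suc t) _ (λ s t<s → agree s (ℕ.<⇒≤ t<s)) (f _ v))
      (≡.cong (λ g → tail f′ l (suc t) (≡.trans (ℕ.+-suc l t) e) (g v))
        (agree t ℕ.≤-refl (≡.subst (t ℕ.<_) e (ℕ.m<n+m t ℕ.z<s))))

    -- The positions after t and below k differ from t even as cyclic indices, by `next^-injective`,
    -- so the update is met only in the first map applied.
    tail-update : ∀ (f : Tuple n) l t e (g : Fin (n (fold first next t)) → Fin (n (fold first next (suc t)))) →
      tail (update f (fold first next t) g) (suc l) t e
      ≗ tail f l (suc t) (≡.trans (ℕ.+-suc l t) e) ∘ g
    tail-update f l t e g v = ≡.trans
      (≡.cong (λ h → tail (update f (fold first next t) g) l (suc t) _ (h v)) (update-same f (fold first next t) g))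
      (tail-local l (suc t) _ (λ s t<s s<k → update-other f (fold first next t) g
        λ e → ℕ.<⇒≢ t<s (next^-injective (ℕ.<-trans t<s s<k) s<k e)) (g v))

-- Averaging over random cyclic tuples.

module CyclicTuples (K : Field) where
  open Field K hiding (zero)
  open Expressions K
  open FiniteSums K
  open SymmetricFunctions K
  open Expectation K
  open DistinctSamples K
  open LimitCycles K
  open SetoidReasoning setoid

  Π-next : ∀ {k} .{{_ : NonZero k}} (h : Fin k → Carrier) →
           (Π[ i ← allFin k ] h (next i)) ≈ prodOver (allFin k) h
  Π-next {k} h = begin
    prodOver (allFin k) (h ∘ next) ≈⟨ as-sum (h ∘ next) ⟩
    product (h ∘ next)
      ≈⟨ Sum.sum-permute *-commutativeMonoid h (permutation next prev next-prev prev-next) ⟨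
    product h                      ≈⟨ as-sum h ⟨
    prodOver (allFin k) h          ∎
    where
    product : ∀ {m} → (Fin m → Carrier) → Carrier
    product = Sum.sum *-commutativeMonoid
    as-sum : ∀ {m} (t : Fin m → Carrier) → prodOver (allFin m) t ≈ product t
    as-sum {zero}  t = refl
    as-sum {suc m} t = trans (Π-suc m t) (*-congˡ (as-sum (t ∘ suc)))

  pushforward-subst : ∀ {k} (n : Fin k → ℕ) {i j} (e : i ≡ j) (p : Fin (n i) → Carrier) N →
    d N (pushforward (≡.subst (Fin ∘ n) e) p) ≈ d N p
  pushforward-subst n ≡.refl p N = d-cong N λ z → trans
    (Σ-cong (allFin _) λ y → *-congˡ (⟦⟧-cong (y ≟F z) (z ≟F y) ≡.sym ≡.sym))
    (Σ-δ z p)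

  -- The product of the l + 1 values from h t to h (t + l), in the order in which `𝔼-d-tail` splits
  -- off maps. A tail of l maps has l + 1 sets along it, hence the extra factor.
  interval : ℕ → ℕ → (ℕ → Carrier) → Carrier
  interval zero    t h = h t
  interval (suc l) t h = h t * interval l (suc t) h

  interval-Π : ∀ l t h → interval l t h ≈ (Π[ i ← allFin (suc l) ] h (toℕ i ℕ.+ t))
  interval-Π zero    t h = sym (*-identityʳ _)
  interval-Π (suc l) t h = trans
    (*-congˡ (trans (interval-Π l (suc t) h)
      (Π-cong (allFin (suc l)) λ i → reflexive (≡.cong h (ℕ.+-suc (toℕ i) t)))))
    (sym (Π-suc (suc l) λ i → h (toℕ i ℕ.+ t)))

  module _ {k} .{{_ : NonZero k}} (n : Fin k → ℕ) (p : ∀ i → Fin (n i) → Carrier)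
           (Σp≈1 : ∀ i → sumOver (allFin (n i)) (p i) ≈ 1#) where
    private
      maps : ∀ i → List (Fin (n i) → Fin (n (next i)))
      maps i = choices λ _ → allFin (n (next i))

      law : ∀ i → (Fin (n i) → Fin (n (next i))) → Carrier
      law i g = Π[ v ← allFin (n i) ] p (next i) (g v)

      law-normalised : ∀ i → sumOver (maps i) (law i) ≈ 1#
      law-normalised i = 𝔼-normalised {n i} (λ _ → allFin (n (next i))) (λ _ → p (next i)) (λ _ → Σp≈1 (next i))

    𝔼ᵗ : (Tuple n → Carrier) → Carrier
    𝔼ᵗ = 𝔼 maps law

    𝔼ᵗ-cong : {φ ψ : Tuple n → Carrier} → (∀ f → φ f ≈ ψ f) → 𝔼ᵗ φ ≈ 𝔼ᵗ ψ
    𝔼ᵗ-cong = mean-cong (allTuples n) _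

    𝔼ᵗ-resample : ∀ i φ → 𝔼ᵗ φ ≈ 𝔼ᵗ (λ f → 𝔼ᶠ (n i) (p (next i)) (λ g → φ (update f i g)))
    𝔼ᵗ-resample = 𝔼-resample maps law law-normalised

    pᵢ : ∀ t → Fin (n (fold first next t)) → Carrier
    pᵢ t = p (fold first next t)

    -- Redrawing the map at position t leaves the later maps alone. Given these, the tail is a
    -- random map whose values are independent with the pushed-forward law.
    𝔼-tail : ∀ l t e {Φ : (Fin (n (fold first next t)) → Fin (n first)) → Carrier} →
      (∀ {g g′} → g ≗ g′ → Φ g ≈ Φ g′) →
      𝔼ᵗ (λ f → Φ (tail f (suc l) t e)) ≈
      𝔼ᵗ (λ f → 𝔼ᶠ (n (fold first next t))
        (pushforward (tail f l (suc t) (≡.trans (ℕ.+-suc l t) e)) (pᵢ (suc t))) Φ)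
    𝔼-tail l t e {Φ} Φ-cong = trans
      (𝔼ᵗ-resample (fold first next t) (λ f → Φ (tail f (suc l) t e)))
      (𝔼ᵗ-cong λ f → trans
        (𝔼ᶠ-cong (n (fold first next t)) (pᵢ (suc t)) λ g → Φ-cong (tail-update f l t e g))
        (𝔼ᶠ-pushforward (n (fold first next t)) (tail f l (suc t) _) (pᵢ (suc t)) Φ Φ-cong))

    -- Averaging over the map at position t splits off `d N (pᵢ t)` and leaves the same expression
    -- one position later.
    𝔼-d-tail : ∀ N l t e →
      𝔼ᵗ (λ f → d N (pushforward (tail f l t e) (pᵢ t))) ≈ interval l t (λ s → d N (pᵢ s))
    𝔼-d-tail N zero t ≡.refl = trans
      (𝔼ᵗ-cong λ f → pushforward-subst n next^k-first (pᵢ t) N)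
      (mean-const (allTuples n) _ (𝔼-normalised maps law law-normalised) _)
    𝔼-d-tail N (suc l) t e = begin
      𝔼ᵗ (λ f → d N (pushforward (tail f (suc l) t e) (pᵢ t)))
        ≈⟨ 𝔼-tail l t e (λ g≗g′ → d-cong N (pushforward-congˡ g≗g′ (pᵢ t))) ⟩
      𝔼ᵗ (λ f → 𝔼ᶠ (n (fold first next t)) (q f) (λ g → d N (pushforward g (pᵢ t))))
        ≈⟨ 𝔼ᵗ-cong (λ f → trans
             (𝔼ᶠ-cong (n (fold first next t)) (q f) λ g → d-cong N λ z → sym (*-identityˡ _))
             (trans (𝔼-d-pushforward N (q f)
                      (pushforward-normalised (tail f l (suc t) e′) (pᵢ (suc t)) (Σp≈1 _))
                      -- The weight r starts as 1, since no image letter has been used.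
                      (pᵢ t) (λ _ → 1#))
                    (*-congˡ (d-cong N λ z → *-identityˡ _)))) ⟩
      𝔼ᵗ (λ f → d N (pᵢ t) * d N (q f))
        ≈⟨ mean-*ˡ (allTuples n) _ (d N (pᵢ t)) _ ⟩
      d N (pᵢ t) * 𝔼ᵗ (λ f → d N (q f))
        ≈⟨ *-congˡ (𝔼-d-tail N l (suc t) e′) ⟩
      d N (pᵢ t) * interval l (suc t) (λ s → d N (pᵢ s)) ∎
      where
      e′ = ≡.trans (ℕ.+-suc l t) e
      q = λ (f : Tuple n) → pushforward (tail f l (suc t) e′) (pᵢ (suc t))

    𝔼-d-composite : ∀ N l e → 𝔼ᵗ (λ f → d N (pushforward (tail f l 1 e) (pᵢ 1))) ≈ (Π[ i ← allFin k ] d N (p i))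
    𝔼-d-composite N l e = begin
      𝔼ᵗ (λ f → d N (pushforward (tail f l 1 e) (pᵢ 1)))   ≈⟨ 𝔼-d-tail N l 1 e ⟩
      interval l 1 (λ s → d N (pᵢ s))                      ≈⟨ interval-Π l 1 _ ⟩
      (Π[ i ← allFin (suc l) ] d N (pᵢ (toℕ i ℕ.+ 1)))
        ≈⟨ Π-suc≡k (≡.trans (ℕ.+-comm 1 l) e) ⟩
      (Π[ i ← allFin k ] d N (pᵢ (toℕ i ℕ.+ 1)))
        -- The positions run from 1 to k, a full turn that begins one place after `first`.
        ≈⟨ Π-cong (allFin k) (λ i → reflexive (≡.cong (λ s → d N (p s))
             (≡.trans (≡.cong (fold first next) (ℕ.+-comm (toℕ i) 1)) (≡.cong next (next^-toℕ i))))) ⟩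
      (Π[ i ← allFin k ] d N (p (next i)))                 ≈⟨ Π-next (λ i → d N (p i)) ⟩
      (Π[ i ← allFin k ] d N (p i))                        ∎
      where
      Π-suc≡k : ∀ {m} → m ≡ k →
        (Π[ i ← allFin m ] d N (pᵢ (toℕ i ℕ.+ 1))) ≈ (Π[ i ← allFin k ] d N (pᵢ (toℕ i ℕ.+ 1)))
      Π-suc≡k ≡.refl = refl

    𝔼-eventuallyCyclic : ∀ N →
      fromℕ (suc N) * 𝔼ᵗ (λ f → ⟦ eventuallyCyclic? (suc N) f ⟧) + (Π[ i ← allFin k ] d (2 ℕ.+ N) (p i))
      ≈ (Π[ i ← allFin k ] d (suc N) (p i))
    𝔼-eventuallyCyclic N = begin
      fromℕ (suc N) * 𝔼ᵗ (λ f → ⟦ eventuallyCyclic? (suc N) f ⟧) + (Π[ i ← allFin k ] d (2 ℕ.+ N) (p i))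
        ≈⟨ +-cong
             (trans (*-congˡ (trans
                (𝔼ᵗ-cong λ f → ec-cong λ v → ≡.sym (tail-walk f (suc l) 0 l+1≡k v))
                (𝔼-tail l 0 l+1≡k ec-cong)))
               (sym (mean-*ˡ (allTuples n) _ (fromℕ (suc N)) _)))
             (sym (𝔼-d-composite (2 ℕ.+ N) l l+1≡k′)) ⟩
      𝔼ᵗ (λ f → fromℕ (suc N) * 𝔼ᶠ (n first) (q f) (λ G → ⟦ eventuallyCyclicMap? G (suc N) ⟧))
        + 𝔼ᵗ (λ f → d (2 ℕ.+ N) (q f))
        ≈⟨ mean-+ (allTuples n) _ _ _ ⟨
      𝔼ᵗ (λ f → fromℕ (suc N) * 𝔼ᶠ (n first) (q f) (λ G → ⟦ eventuallyCyclicMap? G (suc N) ⟧)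
                + d (2 ℕ.+ N) (q f))
        ≈⟨ 𝔼ᵗ-cong (λ f → 𝔼-eventuallyCyclicMap N (q f)
             (pushforward-normalised (tail f l 1 l+1≡k′) (pᵢ 1) (Σp≈1 _))) ⟩
      𝔼ᵗ (λ f → d (suc N) (q f))
        ≈⟨ 𝔼-d-composite (suc N) l l+1≡k′ ⟩
      (Π[ i ← allFin k ] d (suc N) (p i)) ∎
      where
      l = ℕ.pred k
      l+1≡k : suc l ℕ.+ 0 ≡ k
      l+1≡k = ≡.trans (ℕ.+-identityʳ _) (ℕ.suc-pred k)
      l+1≡k′ : l ℕ.+ 1 ≡ k
      l+1≡k′ = ≡.trans (ℕ.+-suc l 0) l+1≡k
      q : Tuple n → Fin (n first) → Carrier
      q f = pushforward (tail f l 1 l+1≡k′) (pᵢ 1)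
      ec-cong : {G H : Fin (n first) → Fin (n first)} → G ≗ H →
                ⟦ eventuallyCyclicMap? G (suc N) ⟧ ≈ ⟦ eventuallyCyclicMap? H (suc N) ⟧
      ec-cong {G} {H} G≗H = ⟦⟧-cong (eventuallyCyclicMap? G (suc N)) (eventuallyCyclicMap? H (suc N))
        (EventuallyCyclicMap-cong G≗H) (EventuallyCyclicMap-cong (≡.sym ∘ G≗H))

-- From probabilities back to the variables.

module Scaling (K : Field) where
  open Field K hiding (zero)
  open Expressions K
  open FiniteSums K
  open SymmetricFunctions K
  open CyclicTuples K
  open Mult semiring using (×1-homo-*)
  open Exp semiring using (^-congˡ)
  open CommutativeExp commutativeSemiring using (^-distrib-*)
  open RingProperties ring using (-‿distribʳ-*)
  open GroupProperties +-group using (//-rightDividesʳ)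
  open Solver commutativeSemiring using (solve; _:=_; _:+_; _:*_; con)
  open SetoidReasoning setoid

  fromℕ-^ : ∀ a k → fromℕ (a ℕ.^ k) ≈ fromℕ a ^ k
  fromℕ-^ a zero    = +-identityʳ 1#
  fromℕ-^ a (suc k) = trans (×1-homo-* a (a ℕ.^ k)) (*-congˡ (fromℕ-^ a k))

  inverseˡ : ∀ {x} → ¬ x ≈ 0# → x ⁻¹ * x ≈ 1#
  inverseˡ x≉0 = trans (*-comm _ _) (inverseʳ _ x≉0)

  -- The factor x ^ b clears the denominator, so that the same identity covers both signs of the
  -- exponent.
  ^ℤ-⊖ : ∀ {x} → ¬ x ≈ 0# → ∀ a b → x ^ℤ (a ℤ.⊖ b) * x ^ b ≈ x ^ a
  ^ℤ-⊖ x≉0 a zero = *-identityʳ _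
  ^ℤ-⊖ {x} x≉0 zero (suc b) = power b
    where
    power : ∀ b → (x ⁻¹) ^ suc b * x ^ suc b ≈ 1#
    power zero    = trans (*-cong (*-identityʳ _) (*-identityʳ _)) (inverseˡ x≉0)
    power (suc b) = trans
      (solve 4 (λ a b c d → a :* b :* (c :* d) := a :* c :* (b :* d)) refl _ _ _ _)
      (trans (*-cong (inverseˡ x≉0) (power b)) (*-identityˡ 1#))
  ^ℤ-⊖ {x} x≉0 (suc a) (suc b) = begin
    x ^ℤ (suc a ℤ.⊖ suc b) * (x * x ^ b) ≈⟨ *-congʳ (reflexive (≡.cong (x ^ℤ_) (ℤ.[1+m]⊖[1+n]≡m⊖n a b))) ⟩
    x ^ℤ (a ℤ.⊖ b) * (x * x ^ b)         ≈⟨ solve 3 (λ a b c → a :* (b :* c) := b :* (a :* c)) refl _ _ _ ⟩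
    x * (x ^ℤ (a ℤ.⊖ b) * x ^ b)         ≈⟨ *-congˡ (^ℤ-⊖ x≉0 a b) ⟩
    x * x ^ a                            ∎

  ^ℤ-minus : ∀ {x} → ¬ x ≈ 0# → ∀ a b → x ^ℤ (+ a ℤ.- + b) * x ^ b ≈ x ^ a
  ^ℤ-minus {x} x≉0 a b = trans
    (*-congʳ (reflexive (≡.cong (x ^ℤ_) (ℤ.m-n≡m⊖n a b)))) (^ℤ-⊖ x≉0 a b)

  Π-*ˡ : ∀ k c (t : Fin k → Carrier) → (Π[ j ← allFin k ] c * t j) ≈ c ^ k * prodOver (allFin k) t
  Π-*ˡ k c t = trans (Π-* (allFin k) (λ _ → c) t) (*-congʳ (Π-const k c))

  module _ {k} .{{_ : NonZero k}} (n : Fin k → ℕ) (x : ∀ i → Fin (n i) → Carrier)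
           (e₁≉0 : ∀ i → ¬ e 1 (x i) ≈ 0#) where
    private
      E : Fin k → Carrier
      E i = e 1 (x i)

      p : ∀ i → Fin (n i) → Carrier
      p i v = E i ⁻¹ * x i v

      Σp≈1 : ∀ i → sumOver (allFin (n i)) (p i) ≈ 1#
      Σp≈1 i = trans (Σ-*ˡ (allFin (n i)) (E i ⁻¹) (x i))
        (trans (*-congˡ (sym (e-1 (x i)))) (inverseˡ (e₁≉0 i)))

      x≈Ep : ∀ i v → x i v ≈ E i * p i v
      x≈Ep i v = sym (trans (sym (*-assoc _ _ _)) (trans (*-congʳ (inverseʳ _ (e₁≉0 i))) (*-identityˡ _)))

      -- Every vertex of the preceding set has its image in Xᵢ, so `E i` occurs `n (prev i)` times
      -- in a weight.
      scale : Carrier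
      scale = Π[ i ← allFin k ] E i ^ n (prev i)

    weight-scale : ∀ f → weight x f ≈ scale * weight p f
    weight-scale f = begin
      weight x f
        ≈⟨ Π-cong (allFin k) (λ i → trans
             (Π-cong (allFin (n i)) λ v → x≈Ep (next i) (f i v))
             (Π-*ˡ (n i) (E (next i)) _)) ⟩
      (Π[ i ← allFin k ] E (next i) ^ n i * (Π[ v ← allFin (n i) ] p (next i) (f i v)))
        ≈⟨ Π-* (allFin k) _ _ ⟩
      (Π[ i ← allFin k ] E (next i) ^ n i) * weight p f
        ≈⟨ *-congʳ (trans
             (Π-cong (allFin k) λ i → reflexive (≡.cong (λ j → E (next i) ^ n j) (≡.sym (prev-next i))))
             (Π-next λ i → E i ^ n (prev i))) ⟩
      scale * weight p f ∎

    Σ-EC : ∀ N → (Σ[ f ← EC n N ] weight x f) ≈ scale * 𝔼ᵗ n p Σp≈1 (λ f → ⟦ eventuallyCyclic? N f ⟧)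
    Σ-EC N = trans (Σ-filter (eventuallyCyclic? N) (allTuples n) (weight x))
      (trans (Σ-cong (allTuples n) λ f → trans (*-congʳ (weight-scale f)) (*-assoc _ _ _))
             (Σ-*ˡ (allTuples n) scale _))

    Π-d : ∀ N → (Π[ i ← allFin k ] d N (p i)) ≈ fromℕ ((N !) ℕ.^ k) * (Π[ i ← allFin k ] e N (p i))
    Π-d N = trans (Π-cong (allFin k) λ i → d≈N!e N (p i))
      (trans (Π-*ˡ k (fromℕ (N !)) _) (*-congʳ (sym (fromℕ-^ (N !) k))))

    Π-e-scale : ∀ N → (Π[ i ← allFin k ] e N (x i)) ≈ (Π[ i ← allFin k ] E i ^ N) * (Π[ i ← allFin k ] e N (p i))
    Π-e-scale N = trans
      (Π-cong (allFin k) λ i → trans (e-cong N (x≈Ep i)) (e-scale N (E i) (p i)))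
      (Π-* (allFin k) _ _)

    Σ-EC-formula : ∀ N .{{_ : NonZero N}} → ¬ fromℕ N ≈ 0# →
      (Σ[ f ← EC n N ] weight x f)
      ≈ fromℕ ((N !) ℕ.^ k) * fromℕ N ⁻¹
        * (Π[ i ← allFin k ] e 1 (x i) ^ℤ (+ n (prev i) ℤ.- + (N ℕ.+ 1)))
        * ((Π[ j ← allFin k ] e N (x j) * e 1 (x j))
           - fromℕ ((N ℕ.+ 1) ℕ.^ k) * (Π[ j ← allFin k ] e (N ℕ.+ 1) (x j)))
    Σ-EC-formula (suc N′) N≉0 rewrite ℕ.+-comm N′ 1 = begin
      (Σ[ f ← EC n N ] weight x f)              ≈⟨ Σ-EC N ⟩
      scale * P                                 ≈⟨ *-congˡ (*-identityˡ P) ⟨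
      scale * (1# * P)                          ≈⟨ *-congˡ (*-congʳ (inverseˡ N≉0)) ⟨
      scale * (fromℕ N ⁻¹ * fromℕ N * P)        ≈⟨ *-congˡ (*-assoc _ _ _) ⟩
      scale * (fromℕ N ⁻¹ * (fromℕ N * P))      ≈⟨ *-congˡ (*-congˡ NP) ⟩
      scale * (fromℕ N ⁻¹ * (F * (a - M * b)))  ≈⟨ *-congʳ scale-split ⟨
      C * B * (fromℕ N ⁻¹ * (F * (a - M * b)))
        ≈⟨ solve 5 (λ c b i f z → c :* b :* (i :* (f :* z)) := f :* i :* c :* (b :* z)) refl
             C B (fromℕ N ⁻¹) F (a - M * b) ⟩
      F * fromℕ N ⁻¹ * C * (B * (a - M * b))    ≈⟨ *-congˡ bracket ⟨
      F * fromℕ N ⁻¹ * C * ((Π[ j ← allFin k ] e N (x j) * e 1 (x j)) - M * (Π[ j ← allFin k ] e (suc N) (x j))) ∎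
      where
      N = suc N′
      P = 𝔼ᵗ n p Σp≈1 (λ f → ⟦ eventuallyCyclic? N f ⟧)
      F = fromℕ ((N !) ℕ.^ k)
      M = fromℕ (suc N ℕ.^ k)
      a = Π[ i ← allFin k ] e N (p i)
      b = Π[ i ← allFin k ] e (suc N) (p i)
      -- Both terms of the bracket have degree N + 1 in each class of variables and therefore scale
      -- by this factor; dividing `scale` by it gives the exponents in C.
      B = Π[ i ← allFin k ] E i ^ suc N
      C = Π[ i ← allFin k ] e 1 (x i) ^ℤ (+ n (prev i) ℤ.- + suc N)

      scale-split : C * B ≈ scale
      scale-split = trans (sym (Π-* (allFin k) _ _))
        (Π-cong (allFin k) λ i → ^ℤ-minus (e₁≉0 i) (n (prev i)) (suc N))

      -- The constant (N + 1)^k is the ratio of the factors ((N + 1)!)^k and (N!)^k that turn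
      -- products of e into products of d.
      F-suc : fromℕ ((suc N !) ℕ.^ k) ≈ F * M
      F-suc = begin
        fromℕ ((suc N !) ℕ.^ k)               ≈⟨ fromℕ-^ (suc N !) k ⟩
        fromℕ (suc N !) ^ k                   ≈⟨ ^-congˡ k (×1-homo-* (suc N) (N !)) ⟩
        (fromℕ (suc N) * fromℕ (N !)) ^ k     ≈⟨ ^-distrib-* (fromℕ (suc N)) (fromℕ (N !)) k ⟩
        fromℕ (suc N) ^ k * fromℕ (N !) ^ k   ≈⟨ *-comm _ _ ⟩
        fromℕ (N !) ^ k * fromℕ (suc N) ^ k   ≈⟨ *-cong (fromℕ-^ (N !) k) (fromℕ-^ (suc N) k) ⟨
        F * M                                 ∎

      *-distribˡ-minus : ∀ u v w → u * (v - w) ≈ u * v - u * w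
      *-distribˡ-minus u v w = trans (distribˡ _ _ _) (+-congˡ (sym (-‿distribʳ-* u w)))

      NP : fromℕ N * P ≈ F * (a - M * b)
      NP = begin
        fromℕ N * P                                   ≈⟨ //-rightDividesʳ (F * (M * b)) (fromℕ N * P) ⟨
        fromℕ N * P + F * (M * b) - F * (M * b)       ≈⟨ +-congʳ total-d ⟩
        F * a - F * (M * b)                           ≈⟨ *-distribˡ-minus F a (M * b) ⟨
        F * (a - M * b)                               ∎
        where
        total-d : fromℕ N * P + F * (M * b) ≈ F * a
        total-d = trans
          (+-congˡ (sym (trans (Π-d (suc N)) (trans (*-congʳ F-suc) (*-assoc _ _ _)))))
          (trans (𝔼-eventuallyCyclic n p Σp≈1 N′) (Π-d N))

      bracket : (Π[ j ← allFin k ] e N (x j) * e 1 (x j)) - M * (Π[ j ← allFin k ] e (suc N) (x j))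
                ≈ B * (a - M * b)
      bracket = begin
        (Π[ j ← allFin k ] e N (x j) * e 1 (x j)) - M * (Π[ j ← allFin k ] e (suc N) (x j))
          ≈⟨ +-cong
               (begin
                 (Π[ j ← allFin k ] e N (x j) * e 1 (x j))
                   ≈⟨ Π-* (allFin k) _ _ ⟩
                 (Π[ j ← allFin k ] e N (x j)) * prodOver (allFin k) E
                   ≈⟨ *-congʳ (Π-e-scale N) ⟩
                 (Π[ i ← allFin k ] E i ^ N) * a * prodOver (allFin k) E
                   ≈⟨ solve 3 (λ u a v → u :* a :* v := v :* u :* a) refl _ _ _ ⟩
                 prodOver (allFin k) E * (Π[ i ← allFin k ] E i ^ N) * a
                   ≈⟨ *-congʳ (Π-* (allFin k) _ _) ⟨
                 B * a ∎)
               (-‿cong (trans (*-congˡ (Π-e-scale (suc N)))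
                 (solve 3 (λ m b c → m :* (b :* c) := b :* (m :* c)) refl M B b))) ⟩
        B * a - B * (M * b) ≈⟨ *-distribˡ-minus B a (M * b) ⟨
        B * (a - M * b) ∎

-- Nonvanishing of e₁(Xᵢ) and of N in the field of rational functions.

-- The value at the point (1, …, 1).
evaluate : ∀ m → IntegralDomain.Carrier ℚ[ m ] → ℚ.ℚ
evaluate zero    a = a
evaluate (suc m) p = foldr (λ a s → evaluate m a ℚ.+ s) ℚ.0ℚ p

evaluate-≈0 : ∀ m {a} → IntegralDomain._≈_ ℚ[ m ] a (IntegralDomain.0# ℚ[ m ]) → evaluate m a ≡ ℚ.0ℚ
evaluate-≈0 zero    a≡0 = a≡0
evaluate-≈0 (suc m) {p} p≈0 = coefficients p p≈0
  where
  open UnivariatePolynomials ℚ[ m ]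
  coefficients : ∀ p → p ≈ₚ [] → evaluate (suc m) p ≡ ℚ.0ℚ
  coefficients []      _   = ≡.refl
  coefficients (a ∷ p) e = ≡.cong₂ ℚ._+_ (evaluate-≈0 m (coeff-≈ e 0))
    (coefficients p (≈-coeff (coeff-≈ e ∘ suc)))

evaluate-+ : ∀ m a b → evaluate m (IntegralDomain._+_ ℚ[ m ] a b) ≡ evaluate m a ℚ.+ evaluate m b
evaluate-+ zero    a       b       = ≡.refl
evaluate-+ (suc m) []      q       = ≡.sym (ℚ.+-identityˡ _)
evaluate-+ (suc m) (a ∷ p) []      = ≡.sym (ℚ.+-identityʳ _)
evaluate-+ (suc m) (a ∷ p) (b ∷ q) = ≡.trans
  (≡.cong₂ ℚ._+_ (evaluate-+ m a b) (evaluate-+ (suc m) p q))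
  (interchange (evaluate m a) (evaluate m b) (evaluate (suc m) p) (evaluate (suc m) q))
  where
  open CommutativeSemigroupProperties (IntegralDomain.+-commutativeSemigroup ℚ-domain) using (interchange)

evaluate-1 : ∀ m → evaluate m (IntegralDomain.1# ℚ[ m ]) ≡ ℚ.1ℚ
evaluate-1 zero    = ≡.refl
evaluate-1 (suc m) = ≡.cong (ℚ._+ ℚ.0ℚ) (evaluate-1 m)

evaluate-0 : ∀ m → evaluate m (IntegralDomain.0# ℚ[ m ]) ≡ ℚ.0ℚ
evaluate-0 m = evaluate-≈0 m (IntegralDomain.refl ℚ[ m ])

evaluate-indeterminate : ∀ {m} (i : Fin m) → evaluate m (indeterminate i) ≡ ℚ.1ℚ
evaluate-indeterminate {suc m} zero    =
  ≡.cong₂ (λ a b → a ℚ.+ (b ℚ.+ ℚ.0ℚ)) (evaluate-0 m) (evaluate-1 m)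
evaluate-indeterminate {suc m} (suc i) = ≡.cong (ℚ._+ ℚ.0ℚ) (evaluate-indeterminate i)

fromℕℚ : ℕ → ℚ.ℚ
fromℕℚ zero    = ℚ.0ℚ
fromℕℚ (suc l) = ℚ.1ℚ ℚ.+ fromℕℚ l

fromℕℚ-nonNegative : ∀ l → ℚ.NonNegative (fromℕℚ l)
fromℕℚ-positive : ∀ l → ℚ.Positive (fromℕℚ (suc l))
fromℕℚ-nonNegative zero    = _
fromℕℚ-nonNegative (suc l) = ℚ.pos⇒nonNeg (fromℕℚ (suc l)) {{fromℕℚ-positive l}}
fromℕℚ-positive l = ℚ.pos+nonNeg⇒pos ℚ.1ℚ (fromℕℚ l) {{fromℕℚ-nonNegative l}}

fromℕℚ-suc≢0 : ∀ l → ¬ fromℕℚ (suc l) ≡ ℚ.0ℚ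
fromℕℚ-suc≢0 l e = ℚ.<⇒≢ (ℚ.positive⁻¹ (fromℕℚ (suc l)) {{fromℕℚ-positive l}}) (≡.sym e)

module RationalFunctions (m : ℕ) where
  private
    module D = IntegralDomain ℚ[ m ]
  open Field ℚ⟨ m ⟩ hiding (zero)
  open Expressions ℚ⟨ m ⟩
  open Fractions ℚ[ m ] using (embed; ≈-cross; numerator≈0)
  open Solver D.commutativeSemiring using (solve; _:=_; _:+_; _:*_; con)

  embed-+ : ∀ a b → embed a + embed b ≈ embed (a D.+ b)
  embed-+ a b = ≈-cross (solve 2
    (λ a b → (a :* con 1 :+ b :* con 1) :* con 1 := (a :+ b) :* (con 1 :* con 1)) D.refl a b)

  -- Restricted to fractions with denominator 1, where evaluation at (1, ..., 1) is defined. There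
  -- e₁(Xᵢ) takes the positive value nᵢ, so it is not zero as a rational function.
  HasValue : Carrier → ℚ.ℚ → Set
  HasValue x c = ∃ λ a → x ≈ embed a × evaluate m a ≡ c

  value≢0⇒≉0 : ∀ {x c} → HasValue x c → ¬ c ≡ ℚ.0ℚ → ¬ x ≈ 0#
  value≢0⇒≉0 (a , x≈a , ≡.refl) c≢0 x≈0 = c≢0 (evaluate-≈0 m (numerator≈0 (trans (sym x≈a) x≈0)))

  HasValue-0 : HasValue 0# ℚ.0ℚ
  HasValue-0 = D.0# , refl , evaluate-0 m

  HasValue-1 : HasValue 1# ℚ.1ℚ
  HasValue-1 = D.1# , refl , evaluate-1 m

  HasValue-variable : ∀ i → HasValue (variable-of {m} i) ℚ.1ℚ
  HasValue-variable i = indeterminate {m} i , refl {variable-of {m} i} , evaluate-indeterminate i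

  HasValue-+ : ∀ {x y c c′} → HasValue x c → HasValue y c′ → HasValue (x + y) (c ℚ.+ c′)
  HasValue-+ (a , x≈a , ≡.refl) (b , y≈b , ≡.refl) =
    a D.+ b , trans (+-cong x≈a y≈b) (embed-+ a b) , evaluate-+ m a b

  HasValue-fromℕ : ∀ l → HasValue (fromℕ l) (fromℕℚ l)
  HasValue-fromℕ zero    = HasValue-0
  HasValue-fromℕ (suc l) = HasValue-+ HasValue-1 (HasValue-fromℕ l)

  HasValue-sum : {A : Set} (as : List A) {t : A → Carrier} → (∀ a → HasValue (t a) ℚ.1ℚ) →
                 HasValue (sumOver as t) (fromℕℚ (length as))
  HasValue-sum []       t1 = HasValue-0
  HasValue-sum (a ∷ as) t1 = HasValue-+ (t1 a) (HasValue-sum as t1)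

  fromℕ≉0 : ∀ N .{{_ : NonZero N}} → ¬ fromℕ N ≈ 0#
  fromℕ≉0 (suc l) = value≢0⇒≉0 (HasValue-fromℕ (suc l)) (fromℕℚ-suc≢0 l)

  e₁-variables≉0 : ∀ l → NonZero l → (i : Fin l → Fin m) → ¬ e 1 (λ v → variable-of {m} (i v)) ≈ 0#
  e₁-variables≉0 (suc l) _ i e≈0 = value≢0⇒≉0
    (HasValue-sum (allFin (suc l)) λ v → HasValue-variable (i v)) (fromℕℚ-suc≢0 (length (tabulate {n = l} suc)))
    (trans (sym (SymmetricFunctions.e-1 ℚ⟨ m ⟩ λ v → variable-of {m} (i v))) e≈0)

theorem1p3 : (k N : ℕ) .{{_ : NonZero k}} .{{_ : NonZero N}} →
    (n : Fin k → ℕ) → (∀ i → NonZero (n i)) →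
    let open Field ℚ⟨ total n ⟩
        open Expressions ℚ⟨ total n ⟩
        x = vertexVariable n
    in (Σ[ f ← EC n N ] weight x f)
       ≈ fromℕ ((N !) ℕ.^ k) * fromℕ N ⁻¹
         * (Π[ i ← allFin k ] e 1 (x i) ^ℤ (+ n (prev i) ℤ.- + (N ℕ.+ 1)))
         * ((Π[ j ← allFin k ] e N (x j) * e 1 (x j))
            - fromℕ ((N ℕ.+ 1) ℕ.^ k) * (Π[ j ← allFin k ] e (N ℕ.+ 1) (x j)))
theorem1p3 k N n n≢0 = Scaling.Σ-EC-formula ℚ⟨ total n ⟩ n (vertexVariable n)
  (λ i → e₁-variables≉0 (n i) (n≢0 i) (position n i)) N (fromℕ≉0 N)
  where open RationalFunctions (total n)
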